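{- Let $0\le m\le n$ and let $C\subseteq\Delta_n^m$ be a weakly separated collection of maximum cardinality among weakly separated collections contained in $\Delta_n^m$. If $C\ne\mathcal{IS}_n^m$, then $C$ admits a lowering 4-flip. In particular, all weakly separated collections in $\Delta_n^m$ of maximum cardinality are obtained from one another by finite sequences of 4-flips.
   Context: Notation: $[n]=\{1,\dots,n\}$, $[p..q]=\{p,\dots,q\}$; $Xij=X\cup\{i,j\}$ etc. $\Delta_n^m=\{S\subseteq[n]:|S|=m\}$. $\mathcal{IS}_n^m$ is the collection of all $m$-element intervals $[p..q]$ in $[n]$ together with all $m$-element sets of the form $[1..p]\cup[q..r]$ with $p\ge1$, $q\le r$ and $q>p+1$. Weak separation. For $X,Y\subseteq[n]$, $X\prec Y$ means $Y\setminus X\ne\emptyset$ and $i<j$ for all $i\in X\setminus Y$, $j\in Y\setminus X$. $X\rhd Y$ means $Y\setminus X$ has a bipartition $\{Y_1,Y_2\}$ with $Y_1,Y_2,X\setminus Y$ nonempty and $Y_1\prec X\setminus Y\prec Y_2$. $X,Y$ are weakly separated if $X\prec Y$, or $Y\prec X$, or ($X\rhd Y$ and $|X|\ge|Y|$), or ($Y\rhd X$ and $|Y|\ge|X|$). A collection is weakly separated if any two members are. 4-flips. For $i<j<k<\ell$ in $[n]$ and $X\subseteq[n]\setminus\{i,j,k,\ell\}$ with $|X|=m-2$: if a collection contains $Xij,Xk\ell,Xi\ell,Xjk$ and exactly one $Y\in\{Xik,Xj\ell\}$, a 4-flip replaces $Y$ by the other member; it is lowering if $Y=Xj\ell$ (replaced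 by $Xik$) and raising if $Y=Xik$. -}

module Defs where

open import Data.Nat as ℕ using (ℕ; suc; _∸_)
open import Data.Fin using (Fin; toℕ)
import Data.Fin as F
open import Data.Fin.Subset using (Subset; _∈_; _∉_; _∪_; _∩_; _─_; ⁅_⁆; ∣_∣; Nonempty; Empty)
open import Data.List using (List; length)
open import Data.List.Relation.Unary.All using (All)
open import Data.List.Relation.Unary.Unique.Propositional using (Unique)
import Data.List.Membership.Propositional as LM
open import Data.Product using (Σ; ∃; ∃-syntax; _×_; _,_)
open import Data.Sum using (_⊎_)
open import Relation.Nullary using (¬_)
open import Relation.Binary.PropositionalEquality using (_≡_; _≢_)
open import Relation.Binary.Construct.Closure.ReflexiveTransitive using (Star)
open import Function.Bundles using (_⇔_)

-- Elements of [n] are represented by Fin n; the element x : Fin n stands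
-- for the number toℕ x + 1 ∈ [n] (order preserving).
rank : ∀ {n} → Fin n → ℕ
rank x = suc (toℕ x)

_≺_ : ∀ {n} → Subset n → Subset n → Set
_≺_ {n} X Y = Nonempty (Y ─ X) × (∀ (i j : Fin n) → i ∈ (X ─ Y) → j ∈ (Y ─ X) → i F.< j)

_▷_ : ∀ {n} → Subset n → Subset n → Set
_▷_ {n} X Y = Σ (Subset n) λ Y₁ → Σ (Subset n) λ Y₂ →
  (Y₁ ∪ Y₂ ≡ Y ─ X) × Empty (Y₁ ∩ Y₂) ×
  Nonempty Y₁ × Nonempty Y₂ × Nonempty (X ─ Y) ×
  (Y₁ ≺ (X ─ Y)) × ((X ─ Y) ≺ Y₂)

WeaklySeparated : ∀ {n} → Subset n → Subset n → Set
WeaklySeparated X Y =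
  (X ≺ Y) ⊎ (Y ≺ X) ⊎ ((X ▷ Y) × ∣ Y ∣ ℕ.≤ ∣ X ∣) ⊎ ((Y ▷ X) × ∣ X ∣ ℕ.≤ ∣ Y ∣)

-- A collection (finite set) of subsets of [n], represented as a duplicate-free list.
Collection : ℕ → Set
Collection n = List (Subset n)

WSCollection : (n m : ℕ) → Collection n → Set
WSCollection n m C =
  Unique C × All (λ S → ∣ S ∣ ≡ m) C ×
  (∀ X Y → X LM.∈ C → Y LM.∈ C → X ≢ Y → WeaklySeparated X Y)

MaxWSCollection : (n m : ℕ) → Collection n → Set
MaxWSCollection n m C =
  WSCollection n m C × (∀ D → WSCollection n m D → length D ℕ.≤ length C)

-- Interval [p..q] in [n] (possibly empty, when q < p).
IsInterval : ∀ {n} → Subset n → Set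
IsInterval {n} S = Σ ℕ λ p → Σ ℕ λ q →
  1 ℕ.≤ p × q ℕ.≤ n × (∀ x → (x ∈ S) ⇔ (p ℕ.≤ rank x × rank x ℕ.≤ q))

IsWrapped : ∀ {n} → Subset n → Set
IsWrapped {n} S = Σ ℕ λ p → Σ ℕ λ q → Σ ℕ λ r →
  1 ℕ.≤ p × q ℕ.≤ r × suc p ℕ.< q × r ℕ.≤ n ×
  (∀ x → (x ∈ S) ⇔ (rank x ℕ.≤ p ⊎ (q ℕ.≤ rank x × rank x ℕ.≤ r)))

InIS : (n m : ℕ) → Subset n → Set
InIS n m S = ∣ S ∣ ≡ m × (IsInterval S ⊎ IsWrapped S)

EqualsIS : (n m : ℕ) → Collection n → Set
EqualsIS n m C = ∀ S → (S LM.∈ C) ⇔ InIS n m S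

_∪₂_,_ : ∀ {n} → Subset n → Fin n → Fin n → Subset n
X ∪₂ a , b = X ∪ (⁅ a ⁆ ∪ ⁅ b ⁆)

FlipFrame : (n m : ℕ) → Collection n →
            Fin n → Fin n → Fin n → Fin n → Subset n → Set
FlipFrame n m C i j k l X =
  i F.< j × j F.< k × k F.< l ×
  i ∉ X × j ∉ X × k ∉ X × l ∉ X × ∣ X ∣ ≡ m ∸ 2 ×
  (X ∪₂ i , j) LM.∈ C × (X ∪₂ k , l) LM.∈ C ×
  (X ∪₂ i , l) LM.∈ C × (X ∪₂ j , k) LM.∈ C

AdmitsLoweringFlip : (n m : ℕ) → Collection n → Set
AdmitsLoweringFlip n m C =
  Σ (Fin n) λ i → Σ (Fin n) λ j → Σ (Fin n) λ k → Σ (Fin n) λ l → Σ (Subset n) λ X →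
  FlipFrame n m C i j k l X ×
  (X ∪₂ j , l) LM.∈ C × ¬ ((X ∪₂ i , k) LM.∈ C)

Replaced : ∀ {n} → Collection n → Subset n → Subset n → Collection n → Set
Replaced C Y Y' D = ∀ S → (S LM.∈ D) ⇔ ((S LM.∈ C × S ≢ Y) ⊎ S ≡ Y')

FourFlip : (n m : ℕ) → Collection n → Collection n → Set
FourFlip n m C D =
  Σ (Fin n) λ i → Σ (Fin n) λ j → Σ (Fin n) λ k → Σ (Fin n) λ l → Σ (Subset n) λ X →
  FlipFrame n m C i j k l X ×
  (  ((X ∪₂ j , l) LM.∈ C × ¬ ((X ∪₂ i , k) LM.∈ C) × Replaced C (X ∪₂ j , l) (X ∪₂ i , k) D)
   ⊎ ((X ∪₂ i , k) LM.∈ C × ¬ ((X ∪₂ j , l) LM.∈ C) × Replaced C (X ∪₂ i , k) (X ∪₂ j , l) D))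

SameSet : ∀ {n} → Collection n → Collection n → Set
SameSet C D = ∀ S → (S LM.∈ C) ⇔ (S LM.∈ D)

FlipConnected : (n m : ℕ) → Collection n → Collection n → Set
FlipConnected n m C D = Σ (Collection n) λ D' → Star (FourFlip n m) C D' × SameSet D' D

{-# OPTIONS --safe #-}

-- A set lies in IS iff, read as a 0-1 word, it avoids the pattern 0101. Split C by membership of the first
-- element of [1 + N]: the tails of its sets form two consecutive levels h and h + 1 of a collection in 2^[N],
-- and adding all co-intervals of size < h and all intervals of size > h + 1 gives a weakly separated
-- collection D whose size attains the upper bound M N = N (N + 1) / 2 + 1 for 2^[N].
--
-- The bound holds because deleting the first element of the ground set identifies, for each size, at most one
-- pair X, {first} ∪ X. If D attains it, there is exactly one such pair for each size, the mark, and every set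
-- of that size is comparable with the mark. By induction on N the marks show that D has no dead ends: a pair
-- S ⊂ S + a in D has a neighbouring pair on either side (prev, next), and so has a pair K + a, K + b (outer).
-- These are the local statements that the cells of D fit together along edges.
--
-- If a set of C avoiding the first element contains the pattern 101, walking along next in the complement of D
-- reaches a hexagon K + i, K + j, K + k, K + i + j, K + j + k, which is a lowering flip of C moving the first
-- element. Otherwise all sets of C avoiding the first element are intervals, the remaining ones form a maximum
-- collection of [N], and induction applies. A lowering flip keeps the size and weak separation and decreases
-- the sum of all elements, so every maximum collection descends to IS; flips are reversible.
module Submission where

open import Defs
open import Data.Nat using (ℕ; _≤_)
open import Data.Product using (_×_)
open import Relation.Nullary using (¬_)

open import Data.Bool.Base using (Bool; true; false; not; _∧_; _∨_; if_then_else_)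
open import Data.Bool.Properties using () renaming (_≟_ to _≟ᵇ_)
open import Data.Empty using (⊥; ⊥-elim)
open import Data.Fin.Base using (Fin; zero; suc; _<_; toℕ)
open import Data.Fin.Properties using (_≟_; <-cmp; <-trans; <-asym; <⇒≢; _<?_)
open import Data.Fin.Subset using (Subset; _∈_; ∣_∣; ∁; _─_; _∪_; _∩_; ⁅_⁆; Empty)
open import Data.Fin.Subset.Properties using (∣p∣≤n; ∣⊥∣≡0; ∣⊤∣≡n; x∈p∧x∉q⇒x∈p─q; p─q⊆p; x∈p∪q⁺; x∈p∪q⁻; x∈p∩q⁻; ⊆-antisym; ∪-identityʳ; ∪-assoc)
open import Data.Nat.Base as ℕ using (zero; suc; z≤n; s≤s; _+_; _∸_; _<ᵇ_; _≡ᵇ_)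
import Data.Nat.Properties as ℕ
open import Data.Product using (_,_; ∃; Σ-syntax; ∃-syntax; proj₁; proj₂)
open import Data.Sum using (_⊎_; inj₁; inj₂; [_,_]′)
open import Data.Vec.Base using ([]; _∷_; lookup; _[_]=_; _[_]≔_; here; there; tabulate; replicate)
open import Data.Vec.Properties
open import Function.Base using (_∘_; id; flip; const; case_of_)
open import Relation.Binary.Definitions using (tri<; tri≈; tri>)
open import Relation.Binary.PropositionalEquality
open import Relation.Nullary using (yes; no; does; Dec)


-- Deleting an element turns one level into two, so an induction inside a single level does not
-- close. It closes in 2^[N]: the rule for sets of different sizes is what equal-size separation
-- becomes when a leading element is removed. The sets added to `C` obey this rule automatically,
-- since a small set could violate it only by containing 010 and a large one only by containing 101.
-- Their number depends on `N` and `h` alone, so comparing `C` with IS already compares `D` with a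
-- collection of at least `M N` sets.
--
-- The marks drive the induction as follows. Among tails of one size, each that carries the first
-- element is `≼` each that does not, and the mark is of both kinds. When the induction hypothesis
-- yields a neighbour on the wrong side of this divide, the mark is squeezed between it and a given
-- set. That leaves two shapes: one violates weak separation, the other is the neighbour sought or
-- makes the given set itself the mark.
--
-- Passing to the complement puts the added intervals below the level of the flip, as co-intervals;
-- this keeps the bottom `K` of a hexagon under construction out of the collection.

-- Subsets of a finite ordered set: updates, sizes and the order `≼`.

module Subsets where

  private variable
    n : ℕ
    S T X Y Z : Subset n
    a b c x y z : Fin n

  infix 4 _∉_ _∈_∖_ _⊑_ _≼_
  infixl 6 _＋_ _－_

  -- Positive, unlike the library's x ∉ S, which is the negation of x ∈ S.
  _∉_ : Fin n → Subset n → Set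
  x ∉ S = S [ x ]= false

  _∈_∖_ : Fin n → Subset n → Subset n → Set
  x ∈ X ∖ Y = x ∈ X × x ∉ Y

  _＋_ _－_ : Subset n → Fin n → Subset n
  S ＋ a = S [ a ]≔ true
  S － a = S [ a ]≔ false

  ∈? : (x : Fin n) (S : Subset n) → x ∈ S ⊎ x ∉ S
  ∈? x S with lookup S x in eq
  ... | true  = inj₁ (lookup⇒[]= x S eq)
  ... | false = inj₂ (lookup⇒[]= x S eq)

  clash : x ∈ S → x ∉ S → ⊥
  clash p q with () ← trans (sym ([]=⇒lookup p)) ([]=⇒lookup q)

  ∈∉⇒≢ : x ∈ S → y ∉ S → x ≢ y
  ∈∉⇒≢ p q refl = clash p q

  ∉∈⇒≢ : x ∉ S → y ∈ S → x ≢ y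
  ∉∈⇒≢ p q refl = clash q p

  >⇒≢ : y < x → x ≢ y
  >⇒≢ y<x refl = <⇒≢ y<x refl

  <-irr : ∀ {x : Fin n} → x < x → ⊥
  <-irr x<x = <⇒≢ x<x refl

  ∈＋ : ∀ (S : Subset n) a → a ∈ S ＋ a
  ∈＋ S a = []≔-updates S a

  ∉－ : ∀ (S : Subset n) a → a ∉ S － a
  ∉－ S a = []≔-updates S a

  oth : ∀ {v w} → x ≢ a → S [ x ]= v → (S [ a ]≔ w) [ x ]= v
  oth {x = x} {a} {S} ne p = []≔-minimal S x a ne p

  unoth : ∀ {v w} → x ≢ a → (S [ a ]≔ w) [ x ]= v → S [ x ]= v
  unoth {x = x} {a} {S} {w = w} ne p =
    lookup⇒[]= x S (trans (sym (lookup∘update′ ne S w)) ([]=⇒lookup p))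

  in＋ : x ∈ S → x ∈ S ＋ a
  in＋ {x = x} {S} {a} p with x ≟ a
  ... | yes refl = ∈＋ S a
  ... | no  ne   = oth ne p

  out－ : x ∉ S → x ∉ S － a
  out－ {x = x} {S} {a} p with x ≟ a
  ... | yes refl = ∉－ S a
  ... | no  ne   = oth ne p

  in－⁻ : x ∈ S － a → x ∈ S
  in－⁻ {x = x} {S} {a} p with x ≟ a
  ... | yes refl = ⊥-elim (clash p (∉－ S a))
  ... | no  ne   = unoth ne p

  out＋⁻ : x ∉ S ＋ a → x ∉ S
  out＋⁻ {x = x} {S} {a} p with x ≟ a
  ... | yes refl = ⊥-elim (clash (∈＋ S a) p)
  ... | no  ne   = unoth ne p

  in＋⁻ : x ∈ S ＋ a → x ≡ a ⊎ x ∈ S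
  in＋⁻ {x = x} {S} {a} p with x ≟ a
  ... | yes e  = inj₁ e
  ... | no  ne = inj₂ (unoth ne p)

  －＋ : a ∈ S → S － a ＋ a ≡ S
  －＋ {a = a} {S} p = trans ([]≔-idempotent S a)
    (trans (cong (S [ a ]≔_) (sym ([]=⇒lookup p))) ([]≔-lookup S a))

  ＋－ : a ∉ S → S ＋ a － a ≡ S
  ＋－ {a = a} {S} p = trans ([]≔-idempotent S a)
    (trans (cong (S [ a ]≔_) (sym ([]=⇒lookup p))) ([]≔-lookup S a))

  upd-comm : ∀ {v w} → a ≢ b → S [ a ]≔ v [ b ]≔ w ≡ S [ b ]≔ w [ a ]≔ v
  upd-comm {a = a} {b} {S} ne = []≔-commutes S a b ne

  ∣＋∣ : a ∉ S → ∣ S ＋ a ∣ ≡ suc ∣ S ∣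
  ∣＋∣ {S = _ ∷ _} here = refl
  ∣＋∣ {S = true  ∷ _} (there p) = cong suc (∣＋∣ p)
  ∣＋∣ {S = false ∷ _} (there p) = ∣＋∣ p

  ∣－∣ : a ∈ S → suc ∣ S － a ∣ ≡ ∣ S ∣
  ∣－∣ {a = a} {S} p = trans (sym (∣＋∣ (∉－ S a))) (cong ∣_∣ (－＋ p))

  _⊑_ : Subset n → Subset n → Set
  X ⊑ Y = ∀ {x} → x ∈ X → x ∈ Y

  private
    ⊑-tail : ∀ {b b′} → b ∷ X ⊑ b′ ∷ Y → X ⊑ Y
    ⊑-tail f p with there q ← f (there p) = q

  ⊑-size : X ⊑ Y → ∣ X ∣ ℕ.≤ ∣ Y ∣
  ⊑-size {X = []}        {[]}        f = z≤n
  ⊑-size {X = true ∷ X}  {true ∷ Y}  f = s≤s (⊑-size (⊑-tail f))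
  ⊑-size {X = true ∷ X}  {false ∷ Y} f with () ← f here
  ⊑-size {X = false ∷ X} {true ∷ Y}  f = ℕ.m≤n⇒m≤1+n (⊑-size (⊑-tail f))
  ⊑-size {X = false ∷ X} {false ∷ Y} f = ⊑-size (⊑-tail f)

  ⊑-full : X ⊑ Y → ∣ Y ∣ ℕ.≤ ∣ X ∣ → X ≡ Y
  ⊑-full {X = []}        {[]}        f l = refl
  ⊑-full {X = true ∷ X}  {true ∷ Y}  f l = cong (true ∷_) (⊑-full (⊑-tail f) (ℕ.≤-pred l))
  ⊑-full {X = true ∷ X}  {false ∷ Y} f l with () ← f here
  ⊑-full {X = false ∷ X} {true ∷ Y}  f l =
    ⊥-elim (ℕ.<-irrefl refl (ℕ.≤-trans l (⊑-size (⊑-tail f))))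
  ⊑-full {X = false ∷ X} {false ∷ Y} f l = cong (false ∷_) (⊑-full (⊑-tail f) l)

  ⊑? : (X Y : Subset n) → X ⊑ Y ⊎ ∃[ x ] x ∈ X ∖ Y
  ⊑? [] [] = inj₁ id
  ⊑? (u ∷ X) (v ∷ Y) with ⊑? X Y
  ... | inj₂ (x , p , q) = inj₂ (suc x , there p , there q)
  ⊑? (true ∷ X)  (true ∷ Y)  | inj₁ f = inj₁ λ { here → here ; (there p) → there (f p) }
  ⊑? (true ∷ X)  (false ∷ Y) | inj₁ f = inj₂ (zero , here , here)
  ⊑? (false ∷ X) (v ∷ Y)     | inj₁ f = inj₁ λ { (there p) → there (f p) }

  differ : (X Y : Subset n) → ∣ X ∣ ≡ ∣ Y ∣ → X ≡ Y ⊎ ((∃[ x ] x ∈ X ∖ Y) × (∃[ y ] y ∈ Y ∖ X))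
  differ X Y e with ⊑? X Y | ⊑? Y X
  ... | inj₁ f | _      = inj₁ (⊑-full f (ℕ.≤-reflexive (sym e)))
  ... | inj₂ p | inj₁ g = inj₁ (sym (⊑-full g (ℕ.≤-reflexive e)))
  ... | inj₂ p | inj₂ q = inj₂ (p , q)

  ⊑-suc : X ⊑ Z → ∣ Z ∣ ≡ suc ∣ X ∣ → ∃[ z ] z ∉ X × Z ≡ X ＋ z
  ⊑-suc {X = X} {Z} f e with ⊑? Z X
  ... | inj₁ g = ⊥-elim (ℕ.<-irrefl refl (ℕ.≤-trans (ℕ.≤-reflexive (sym e)) (⊑-size g)))
  ... | inj₂ (z , p , q) = z , q , sym (⊑-full g (ℕ.≤-reflexive (trans e (sym (∣＋∣ q)))))
    where
    g : X ＋ z ⊑ Z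
    g r with in＋⁻ r
    ... | inj₁ refl = p
    ... | inj₂ s    = f s

  -- `_≺_` without the nonemptiness condition: it holds between equal sets, so a set squeezed by `≼`
  -- may coincide with either bound.
  _≼_ : Subset n → Subset n → Set
  X ≼ Y = ∀ {x y} → x ∈ X ∖ Y → y ∈ Y ∖ X → x < y

  ≼-antisym : X ≼ Y → Y ≼ X → ∣ X ∣ ≡ ∣ Y ∣ → X ≡ Y
  ≼-antisym {X = X} {Y} f g e with differ X Y e
  ... | inj₁ eq = eq
  ... | inj₂ ((x , p) , (y , q)) = ⊥-elim (<-asym (f p q) (g q p))

  _≤′_ : Fin n → Fin n → Set
  a ≤′ b = a ≡ b ⊎ a < b

  ≤′≤′-absurd : a ≤′ b → b ≤′ c → c < a → ⊥
  ≤′≤′-absurd (inj₁ refl) (inj₁ refl) l = <-irr l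
  ≤′≤′-absurd (inj₁ refl) (inj₂ p) l = <-asym p l
  ≤′≤′-absurd (inj₂ p) (inj₁ refl) l = <-asym p l
  ≤′≤′-absurd (inj₂ p) (inj₂ q) l = <-asym (<-trans p q) l

  data Between {n} (S Z : Subset n) (a x : Fin n) : Set where
    one  : ∀ z → z ∉ S → Z ≡ S ＋ z → a ≤′ z → z ≤′ x → Between S Z a x
    skip : ∀ s → s ∈ S → Z ≡ S ＋ a ＋ x － s → a < s → s < x → Between S Z a x

  -- If `Z` misses some `s` of `S`, an element of `Z` outside `S` other than `a` and `x` would lie
  -- both after and before `s`. So `Z` is contained in `S ＋ a ＋ x － s`, and the size forces
  -- equality. This is how a mark is located between a set with the head and a set without it.
  between : a ∉ S → x ∉ S → ∣ Z ∣ ≡ suc ∣ S ∣ → S ＋ a ≼ Z → Z ≼ S ＋ x → Between S Z a x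
  between {a = a} {S} {x} {Z} a∉ x∉ e f g with ⊑? S Z
  ... | inj₁ h with ⊑-suc h e
  ... | z , z∉ , refl = one z z∉ refl lo hi
    where
    lo : a ≤′ z
    lo with a ≟ z
    ... | yes e = inj₁ e
    ... | no ne = inj₂ (f (∈＋ S a , oth ne a∉) (∈＋ S z , oth (ne ∘ sym) z∉))
    hi : z ≤′ x
    hi with z ≟ x
    ... | yes e = inj₁ e
    ... | no ne = inj₂ (g (∈＋ S z , oth ne z∉) (∈＋ S x , oth (ne ∘ sym) x∉))
  between {a = a} {S} {x} {Z} a∉ x∉ e f g | inj₂ (s , s∈ , s∉) = res
    where
    s≢a = ∈∉⇒≢ s∈ a∉
    s≢x = ∈∉⇒≢ s∈ x∉
    hit : ∀ {z} → z ∈ Z → z ∉ S → z ≡ a ⊎ z ≡ x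
    hit {z} p q with z ≟ a | z ≟ x
    ... | yes e | _ = inj₁ e
    ... | _ | yes e = inj₂ e
    ... | no ne | no ne′ = ⊥-elim (<-asym (f (in＋ s∈ , s∉) (p , oth ne q)) (g (p , oth ne′ q) (in＋ s∈ , s∉)))
    U = S ＋ a ＋ x － s
    Z⊑U : Z ⊑ U
    Z⊑U {z} p with ∈? z S
    ... | inj₁ q = oth (∈∉⇒≢ p s∉) (in＋ (in＋ q))
    ... | inj₂ q with hit p q
    ... | inj₁ refl = oth (s≢a ∘ sym) (in＋ (∈＋ S a))
    ... | inj₂ refl = oth (s≢x ∘ sym) (∈＋ (S ＋ a) x)
    res : Between S Z a x
    res with a ≟ x
    -- With `a` equal to `x`, `Z` would fit into `S ＋ a － s`, which has only as many elements as
    -- `S`.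
    ... | yes refl = ⊥-elim (ℕ.<-irrefl refl (ℕ.≤-trans (ℕ.≤-reflexive (sym e)) (ℕ.≤-trans (⊑-size Z⊑V) (ℕ.≤-reflexive sz))))
      where
      Z⊑V : Z ⊑ S ＋ a － s
      Z⊑V p with ∈? _ S
      ... | inj₁ q = oth (∈∉⇒≢ p s∉) (in＋ q)
      ... | inj₂ q with hit p q
      ... | inj₁ refl = oth (s≢a ∘ sym) (∈＋ S a)
      ... | inj₂ refl = oth (s≢a ∘ sym) (∈＋ S a)
      sz : ∣ S ＋ a － s ∣ ≡ ∣ S ∣
      sz = ℕ.suc-injective (trans (∣－∣ (in＋ s∈)) (∣＋∣ a∉))
    ... | no a≢x = skip s s∈ Z≡U
          (g (subst (a ∈_) (sym Z≡U) (oth (s≢a ∘ sym) (in＋ (∈＋ S a))) , oth a≢x a∉) (in＋ s∈ , s∉))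
          (f (in＋ s∈ , s∉) (subst (x ∈_) (sym Z≡U) (oth (s≢x ∘ sym) (∈＋ (S ＋ a) x)) , oth (a≢x ∘ sym) x∉))
      where
      sz : ∣ U ∣ ≡ suc ∣ S ∣
      sz = ℕ.suc-injective (trans (∣－∣ (in＋ (in＋ s∈))) (trans (∣＋∣ (oth (a≢x ∘ sym) x∉)) (cong suc (∣＋∣ a∉))))
      Z≡U : Z ≡ U
      Z≡U = ⊑-full Z⊑U (ℕ.≤-reflexive (trans sz (sym e)))

  ∁∁ : (S : Subset n) → ∁ (∁ S) ≡ S
  ∁∁ [] = refl
  ∁∁ (true ∷ S) = cong (true ∷_) (∁∁ S)
  ∁∁ (false ∷ S) = cong (false ∷_) (∁∁ S)

  ∁-upd : ∀ {v} → ∁ (S [ a ]≔ v) ≡ ∁ S [ a ]≔ not v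
  ∁-upd {S = S} {a} = map-[]≔ not S a

  ∁⁺ : ∀ {v} → S [ x ]= v → ∁ S [ x ]= not v
  ∁⁺ here = here
  ∁⁺ (there p) = there (∁⁺ p)

  ∁⁻ : ∀ {v} → ∁ S [ x ]= v → S [ x ]= not v
  ∁⁻ {S = S} {x} {v} p = subst (λ R → R [ x ]= not v) (∁∁ S) (∁⁺ p)

  ∣∁∣ : (S : Subset n) → ∣ ∁ S ∣ + ∣ S ∣ ≡ n
  ∣∁∣ [] = refl
  ∣∁∣ (true ∷ S) = trans (ℕ.+-suc ∣ ∁ S ∣ ∣ S ∣) (cong suc (∣∁∣ S))
  ∣∁∣ (false ∷ S) = cong suc (∣∁∣ S)

  ∣∁∣-≡ : (X Y : Subset n) → ∣ X ∣ ≡ ∣ Y ∣ → ∣ ∁ X ∣ ≡ ∣ ∁ Y ∣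
  ∣∁∣-≡ X Y e = ℕ.+-cancelʳ-≡ ∣ X ∣ _ _
    (trans (∣∁∣ X) (trans (sym (∣∁∣ Y)) (cong (∣ ∁ Y ∣ +_) (sym e))))

  ∣∁∣-< : (X Y : Subset n) → ∣ X ∣ ℕ.< ∣ Y ∣ → ∣ ∁ Y ∣ ℕ.< ∣ ∁ X ∣
  ∣∁∣-< X Y l = ℕ.+-cancelʳ-< ∣ X ∣ _ _
    (subst (∣ ∁ Y ∣ + ∣ X ∣ ℕ.<_) (trans (∣∁∣ Y) (sym (∣∁∣ X))) (ℕ.+-monoʳ-< ∣ ∁ Y ∣ l))

  ∁-≼ : X ≼ Y → ∁ Y ≼ ∁ X
  ∁-≼ f (p , q) (r , s) = f (∁⁻ q , ∁⁻ p) (∁⁻ s , ∁⁻ r)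

  data Between⁻ {n} (T Z : Subset n) (a c : Fin n) : Set where
    one  : ∀ z → z ∈ T → Z ≡ T － z → c ≤′ z → z ≤′ a → Between⁻ T Z a c
    skip : ∀ z → z ∉ T → Z ≡ T － c － a ＋ z → c < z → z < a → Between⁻ T Z a c

  -- Complementation reverses `≼` and exchanges adding with removing, so this is `between` for `∁ T`
  -- with its two ends interchanged.
  between⁻ : a ∈ T → c ∈ T → suc ∣ Z ∣ ≡ ∣ T ∣ → T － a ≼ Z → Z ≼ T － c → Between⁻ T Z a c
  between⁻ {a = a} {T} {c} {Z} a∈ c∈ e f g
    with between {a = c} {S = ∁ T} {x = a} {Z = ∁ Z} (∁⁺ c∈) (∁⁺ a∈) sz
           (subst (_≼ ∁ Z) ∁-upd (∁-≼ g)) (subst (∁ Z ≼_) ∁-upd (∁-≼ f))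
    where
    sz : ∣ ∁ Z ∣ ≡ suc ∣ ∁ T ∣
    sz = ℕ.+-cancelʳ-≡ ∣ Z ∣ _ _ (trans (∣∁∣ Z) (trans (sym (∣∁∣ T))
           (trans (cong (∣ ∁ T ∣ +_) (sym e)) (ℕ.+-suc ∣ ∁ T ∣ ∣ Z ∣))))
  ... | one z z∉ eq lo hi = one z (∁⁻ z∉) (trans (sym (∁∁ Z)) (trans (cong ∁ eq) (trans ∁-upd (cong (_－ z) (∁∁ T))))) lo hi
  ... | skip z z∈ eq lo hi = skip z (∁⁻ z∈)
          (trans (sym (∁∁ Z)) (trans (cong ∁ eq) (trans ∁-upd (cong (_＋ z) (trans ∁-upd (cong (_－ a) (trans ∁-upd (cong (_－ c) (∁∁ T)))))))))
          lo hi

open Subsets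

-- Collections as predicates, weak separation in 2^[n], the bound `M` and collections attaining it.

module Collections where

  private variable
    n : ℕ

  Coll : ℕ → Set
  Coll n = Subset n → Bool

  infix 4 _∋_

  -- A record rather than the bare equation, so that `D` and `S` can be inferred from the type of a
  -- membership proof.
  record _∋_ {n} (D : Coll n) (S : Subset n) : Set where
    constructor mem
    field get : D S ≡ true
  open _∋_ public

  ∋? : (D : Coll n) (S : Subset n) → D ∋ S ⊎ D S ≡ false
  ∋? D S with D S in eq
  ... | true  = inj₁ (mem eq)
  ... | false = inj₂ refl

  ∌ : ∀ {D : Coll n} {S} → D ∋ S → D S ≡ false → ⊥
  ∌ (mem p) q with () ← trans (sym p) q

  search : (D : Coll n) → ∃ (D ∋_) ⊎ (∀ S → D S ≡ false)
  search {zero} D with ∋? D []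
  ... | inj₁ p = inj₁ ([] , p)
  ... | inj₂ q = inj₂ λ { [] → q }
  search {suc n} D with search (D ∘ (true ∷_)) | search (D ∘ (false ∷_))
  ... | inj₁ (S , mem p) | _                = inj₁ (_ , mem p)
  ... | inj₂ _           | inj₁ (S , mem p) = inj₁ (_ , mem p)
  ... | inj₂ f           | inj₂ g           = inj₂ λ { (true ∷ S) → f S ; (false ∷ S) → g S }

  card : Coll n → ℕ
  card {zero}  D = if D [] then 1 else 0
  card {suc n} D = card (D ∘ (true ∷_)) + card (D ∘ (false ∷_))

  card-mono : (P Q : Coll n) → (∀ {S} → P ∋ S → Q ∋ S) → card P ℕ.≤ card Q
  card-mono {zero} P Q f with P [] in eq
  ... | false = z≤n
  ... | true rewrite get (f {[]} (mem eq)) = s≤s z≤n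
  card-mono {suc n} P Q f =
    ℕ.+-mono-≤ (card-mono (P ∘ (true ∷_)) (Q ∘ (true ∷_)) λ { (mem p) → mem (get (f (mem p))) })
               (card-mono (P ∘ (false ∷_)) (Q ∘ (false ∷_)) λ { (mem p) → mem (get (f (mem p))) })

  card-cong : (P Q : Coll n) → (∀ S → P S ≡ Q S) → card P ≡ card Q
  card-cong P Q f = ℕ.≤-antisym (card-mono P Q λ { (mem p) → mem (trans (sym (f _)) p) })
                                (card-mono Q P λ { (mem p) → mem (trans (f _) p) })

  card-∨∧ : (P Q : Coll n) → card P + card Q ≡ card (λ S → P S ∨ Q S) + card (λ S → P S ∧ Q S)
  card-∨∧ {zero} P Q with P [] | Q []
  ... | true  | true  = refl
  ... | true  | false = refl
  ... | false | true  = refl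
  ... | false | false = refl
  card-∨∧ {suc n} P Q = trans (swap4 (card (P ∘ (true ∷_))) _ _ _)
    (trans (cong₂ _+_ (card-∨∧ (P ∘ (true ∷_)) (Q ∘ (true ∷_))) (card-∨∧ (P ∘ (false ∷_)) (Q ∘ (false ∷_))))
           (swap4 (card (λ S → P (true ∷ S) ∨ Q (true ∷ S))) _ _ _))
    where
    open import Algebra.Properties.CommutativeSemigroup ℕ.+-commutativeSemigroup using (interchange)
    swap4 : ∀ a b c d → (a + b) + (c + d) ≡ (a + c) + (b + d)
    swap4 = interchange

  card-∅ : (P : Coll n) → (∀ S → P S ≡ false) → card P ≡ 0
  card-∅ {zero} P f rewrite f [] = refl
  card-∅ {suc n} P f = cong₂ _+_ (card-∅ (P ∘ (true ∷_)) (f ∘ (true ∷_))) (card-∅ (P ∘ (false ∷_)) (f ∘ (false ∷_)))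

  card-⊎ : (P Q : Coll n) → (∀ {S} → P ∋ S → Q ∋ S → ⊥) → card (λ S → P S ∨ Q S) ≡ card P + card Q
  card-⊎ P Q f = sym (trans (card-∨∧ P Q) (trans (cong (card (λ S → P S ∨ Q S) +_) (card-∅ _ dis)) (ℕ.+-identityʳ _)))
    where
    dis : ∀ S → P S ∧ Q S ≡ false
    dis S with P S in p | Q S in q
    ... | true  | true  = ⊥-elim (f (mem p) (mem q))
    ... | true  | false = refl
    ... | false | _     = refl

  card-≥1 : (P : Coll n) {S : Subset n} → P ∋ S → 1 ℕ.≤ card P
  card-≥1 {zero} P {[]} (mem p) rewrite p = s≤s z≤n
  card-≥1 {suc n} P {true ∷ S} (mem p) = ℕ.≤-trans (card-≥1 _ {S} (mem p)) (ℕ.m≤m+n _ _)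
  card-≥1 {suc n} P {false ∷ S} (mem p) = ℕ.≤-trans (card-≥1 _ {S} (mem p)) (ℕ.m≤n+m _ _)

  card-≤1 : (P : Coll n) → (∀ {S T} → P ∋ S → P ∋ T → S ≡ T) → card P ℕ.≤ 1
  card-≤1 {zero} P f with P []
  ... | true  = s≤s z≤n
  ... | false = z≤n
  card-≤1 {suc n} P f with search (P ∘ (true ∷_))
  ... | inj₁ (S , mem p) = ℕ.≤-trans (ℕ.+-mono-≤ (card-≤1 _ λ { (mem p) (mem q) → ∷-injectiveʳ (f (mem p) (mem q)) })
                                                 (ℕ.≤-reflexive (card-∅ _ none))) (s≤s z≤n)
    where
    none : ∀ T → P (false ∷ T) ≡ false
    none T with P (false ∷ T) in q
    ... | false = refl
    ... | true with () ← f (mem p) (mem q)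
  ... | inj₂ g = ℕ.+-mono-≤ (ℕ.≤-reflexive (card-∅ _ g)) (card-≤1 _ λ { (mem p) (mem q) → ∷-injectiveʳ (f (mem p) (mem q)) })

  card-∁ : (P : Coll n) → card (P ∘ ∁) ≡ card P
  card-∁ {zero} P = refl
  card-∁ {suc n} P = trans (cong₂ _+_ (card-∁ (P ∘ (false ∷_))) (card-∁ (P ∘ (true ∷_)))) (ℕ.+-comm (card (P ∘ (false ∷_))) _)

  ∧⁻ : ∀ {u v} → u ∧ v ≡ true → u ≡ true × v ≡ true
  ∧⁻ {true} {true} _ = refl , refl

  ≡ᵇ⁻ : ∀ {j k} → (j ≡ᵇ k) ≡ true → j ≡ k
  ≡ᵇ⁻ {zero}  {zero}  _ = refl
  ≡ᵇ⁻ {suc j} {suc k} e = cong suc (≡ᵇ⁻ e)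

  ≡ᵇ⁺ : ∀ {j k} → j ≡ k → (j ≡ᵇ k) ≡ true
  ≡ᵇ⁺ {zero}  refl = refl
  ≡ᵇ⁺ {suc j} refl = ≡ᵇ⁺ {j} refl

  private
    at below : Coll n → ℕ → Coll n
    at P k S = P S ∧ (∣ S ∣ ≡ᵇ k)
    below P k S = P S ∧ (∣ S ∣ <ᵇ k)

    <ᵇ-suc : ∀ s k → (s <ᵇ suc k) ≡ ((s <ᵇ k) ∨ (s ≡ᵇ k))
    <ᵇ-suc zero zero = refl
    <ᵇ-suc zero (suc k) = refl
    <ᵇ-suc (suc s) zero = refl
    <ᵇ-suc (suc s) (suc k) = <ᵇ-suc s k

    <ᵇ-≡ᵇ : ∀ s k → (s <ᵇ k) ≡ true → (s ≡ᵇ k) ≡ true → ⊥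
    <ᵇ-≡ᵇ (suc s) (suc k) p q = <ᵇ-≡ᵇ s k p q

    ≤⇒<ᵇ : ∀ {s k} → s ℕ.≤ k → (s <ᵇ suc k) ≡ true
    ≤⇒<ᵇ z≤n = refl
    ≤⇒<ᵇ (s≤s p) = ≤⇒<ᵇ p

    card-below-suc : (P : Coll n) (k : ℕ) → card (below P (suc k)) ≡ card (below P k) + card (at P k)
    card-below-suc P k = trans (card-cong _ _ pt) (card-⊎ (below P k) (at P k)
      λ { {S} (mem p) (mem q) → <ᵇ-≡ᵇ ∣ S ∣ k (proj₂ (∧⁻ {P S} p)) (proj₂ (∧⁻ {P S} q)) })
      where
      pt : ∀ S → below P (suc k) S ≡ below P k S ∨ at P k S
      pt S with P S
      ... | true  = <ᵇ-suc ∣ S ∣ k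
      ... | false = refl

    card-below-0 : (P : Coll n) → card (below P 0) ≡ 0
    card-below-0 P = card-∅ _ pt
      where
      pt : ∀ S → below P 0 S ≡ false
      pt S with P S
      ... | true  = refl
      ... | false = refl

    card-below-all : (P : Coll n) → card (below P (suc n)) ≡ card P
    card-below-all P = card-cong _ _ pt
      where
      pt : ∀ S → below P (suc _) S ≡ P S
      pt S with P S
      ... | true  = ≤⇒<ᵇ (∣p∣≤n S)
      ... | false = refl

  OnePerSize : Coll n → Set
  OnePerSize P = ∀ {S T} → P ∋ S → P ∋ T → ∣ S ∣ ≡ ∣ T ∣ → S ≡ T

  private
    at-≤1 : (P : Coll n) → OnePerSize P → ∀ k → card (at P k) ℕ.≤ 1
    at-≤1 P f k = card-≤1 (at P k) λ { {S} {T} (mem p) (mem q) →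
      let p₁ , p₂ = ∧⁻ {P S} p ; q₁ , q₂ = ∧⁻ {P T} q
      in f (mem p₁) (mem q₁) (trans (≡ᵇ⁻ p₂) (sym (≡ᵇ⁻ q₂))) }

    below-≤ : (P : Coll n) → OnePerSize P → ∀ k → card (below P k) ℕ.≤ k
    below-≤ P f zero = ℕ.≤-reflexive (card-below-0 P)
    below-≤ P f (suc k) = subst (ℕ._≤ suc k) (sym (card-below-suc P k))
      (subst (card (below P k) + card (at P k) ℕ.≤_) (ℕ.+-comm k 1) (ℕ.+-mono-≤ (below-≤ P f k) (at-≤1 P f k)))

    below-< : (P : Coll n) → OnePerSize P → ∀ h → card (at P h) ≡ 0 → ∀ k → h ℕ.≤ k → card (below P (suc k)) ℕ.≤ k
    below-< P f h z k h≤k with ℕ.m≤n⇒m<n∨m≡n h≤k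
    ... | inj₂ refl = subst (ℕ._≤ h) (sym (trans (card-below-suc P h) (trans (cong (card (below P h) +_) z) (ℕ.+-identityʳ _)))) (below-≤ P f h)
    below-< P f h z (suc k) _ | inj₁ (s≤s h≤k) = subst (ℕ._≤ suc k) (sym (card-below-suc P (suc k)))
      (subst (card (below P (suc k)) + card (at P (suc k)) ℕ.≤_) (ℕ.+-comm k 1) (ℕ.+-mono-≤ (below-< P f h z k h≤k) (at-≤1 P f (suc k))))

  card-perSize-≤ : (P : Coll n) → OnePerSize P → card P ℕ.≤ suc n
  card-perSize-≤ P f = subst (ℕ._≤ suc _) (card-below-all P) (below-≤ P f _)

  -- If size `h` were missing, the running count `below` would fall behind by one at `h` and end
  -- with at most `n`.
  card-perSize-full : (P : Coll n) → OnePerSize P → suc n ℕ.≤ card P →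
                      ∀ h → h ℕ.≤ n → ∃[ S ] ∣ S ∣ ≡ h × P ∋ S
  card-perSize-full {n} P f big h h≤n with search (at P h)
  ... | inj₁ (S , mem p) = let p₁ , p₂ = ∧⁻ {P S} p in S , ≡ᵇ⁻ p₂ , mem p₁
  ... | inj₂ none = ⊥-elim (ℕ.<-irrefl refl (ℕ.≤-trans big
          (subst (ℕ._≤ n) (card-below-all P) (below-< P f h (card-∅ _ none) n h≤n))))

  card-perSize-≥ : (P : Coll n) → (∀ h → h ℕ.≤ n → ∃[ S ] ∣ S ∣ ≡ h × P ∋ S) → suc n ℕ.≤ card P
  card-perSize-≥ {n} P f = subst (suc n ℕ.≤_) (card-below-all P) (go (suc n) ℕ.≤-refl)
    where
    go : ∀ k → k ℕ.≤ suc n → k ℕ.≤ card (below P k)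
    go zero _ = z≤n
    go (suc k) (s≤s l) with f k l
    ... | S , e , mem p = subst (suc k ℕ.≤_) (sym (card-below-suc P k))
          (subst (ℕ._≤ card (below P k) + card (at P k)) (ℕ.+-comm k 1)
            (ℕ.+-mono-≤ (go k (ℕ.m≤n⇒m≤1+n l)) (card-≥1 (at P k) {S} (mem at-S))))
      where
      at-S : P S ∧ (∣ S ∣ ≡ᵇ k) ≡ true
      at-S = cong₂ _∧_ p (≡ᵇ⁺ e)

  -- Weak separation in 2^[n]: of two sets of different size, the larger one must not surround a part of the smaller one.
  record WS {n} (D : Coll n) : Set where
    field
      ws< : ∀ {X Y} → D ∋ X → D ∋ Y → ∣ X ∣ ℕ.< ∣ Y ∣ → ∀ {p q r} → p < q → q < r →
            p ∈ Y ∖ X → q ∈ X ∖ Y → r ∈ Y ∖ X → ⊥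
      ws= : ∀ {X Y} → D ∋ X → D ∋ Y → ∣ X ∣ ≡ ∣ Y ∣ → ∀ {p q r s} → p < q → q < r → r < s →
            p ∈ X ∖ Y → q ∈ Y ∖ X → r ∈ X ∖ Y → s ∈ Y ∖ X → ⊥
  open WS public

  WS-∁ : {D : Coll n} → WS D → WS (D ∘ ∁)
  ws< (WS-∁ w) {X} {Y} (mem x) (mem y) l pq qr (p , p′) (q , q′) (r , r′) =
    ws< w (mem y) (mem x) (∣∁∣-< X Y l) pq qr (∁⁺ p′ , ∁⁺ p) (∁⁺ q′ , ∁⁺ q) (∁⁺ r′ , ∁⁺ r)
  ws= (WS-∁ w) {X} {Y} (mem x) (mem y) e pq qr rs (p , p′) (q , q′) (r , r′) (s , s′) =
    ws= w (mem y) (mem x) (sym (∣∁∣-≡ X Y e)) pq qr rs (∁⁺ p′ , ∁⁺ p) (∁⁺ q′ , ∁⁺ q) (∁⁺ r′ , ∁⁺ r) (∁⁺ s′ , ∁⁺ s)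

  shrink common : Coll (suc n) → Coll n
  shrink D S = D (true ∷ S) ∨ D (false ∷ S)
  common D S = D (true ∷ S) ∧ D (false ∷ S)

  shrink⁻ : {D : Coll (suc n)} {S : Subset n} → shrink D ∋ S → D ∋ true ∷ S ⊎ D ∋ false ∷ S
  shrink⁻ {D = D} {S} (mem p) with D (true ∷ S) in eq
  ... | true  = inj₁ (mem eq)
  ... | false = inj₂ (mem p)

  shrink₁ : {D : Coll (suc n)} {S : Subset n} → D ∋ true ∷ S → shrink D ∋ S
  shrink₁ {D = D} {S} (mem p) = mem (cong (_∨ D (false ∷ S)) p)

  shrink₀ : {D : Coll (suc n)} {S : Subset n} → D ∋ false ∷ S → shrink D ∋ S
  shrink₀ {D = D} {S} (mem p) with D (true ∷ S) in eq
  ... | true  = mem (cong (_∨ D (false ∷ S)) eq)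
  ... | false = mem (trans (cong (_∨ D (false ∷ S)) eq) p)

  module _ {D : Coll (suc n)} (w : WS D) where

    -- If some `y` preceded `x`, the larger set `true ∷ X` would surround `y` by the head and `x`.
    head-≼ : ∀ {X Y} → D ∋ true ∷ X → D ∋ false ∷ Y → ∣ X ∣ ≡ ∣ Y ∣ → X ≼ Y
    head-≼ X∈ Y∈ e {x} {y} (p , p′) (q , q′) with <-cmp x y
    ... | tri< l _ _ = l
    ... | tri≈ _ refl _ = ⊥-elim (clash p q′)
    ... | tri> _ _ l = ⊥-elim (ws< w Y∈ X∈ (s≤s (ℕ.≤-reflexive (sym e))) (s≤s z≤n) (s≤s l)
            (here , here) (there q , there q′) (there p , there p′))

    -- Size comparisons can change only when the heads differ. If two sets of equal size lose this
    -- equality, the head is the missing fourth point of a forbidden alternation; if the tails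
    -- become equal in size, `head-≼` orders them.
    WS-shrink : WS (shrink D)
    ws< WS-shrink {X} {Y} X∈ Y∈ l pq qr (p , p′) (q , q′) (r , r′) with shrink⁻ X∈ | shrink⁻ Y∈
    ... | inj₁ x | inj₁ y = ws< w x y (s≤s l) (s≤s pq) (s≤s qr) (there p , there p′) (there q , there q′) (there r , there r′)
    ... | inj₂ x | inj₂ y = ws< w x y l (s≤s pq) (s≤s qr) (there p , there p′) (there q , there q′) (there r , there r′)
    ... | inj₂ x | inj₁ y = ws< w x y (ℕ.m≤n⇒m≤1+n l) (s≤s pq) (s≤s qr) (there p , there p′) (there q , there q′) (there r , there r′)
    ... | inj₁ x | inj₂ y with ℕ.m≤n⇒m<n∨m≡n l
    ... | inj₁ l′ = ws< w x y l′ (s≤s pq) (s≤s qr) (there p , there p′) (there q , there q′) (there r , there r′)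
    ... | inj₂ e = ws= w x y e (s≤s z≤n) (s≤s pq) (s≤s qr) (here , here) (there p , there p′) (there q , there q′) (there r , there r′)
    ws= WS-shrink {X} {Y} X∈ Y∈ e pq qr rs (p , p′) (q , q′) (r , r′) (s , s′) with shrink⁻ X∈ | shrink⁻ Y∈
    ... | inj₁ x | inj₁ y = ws= w x y (cong suc e) (s≤s pq) (s≤s qr) (s≤s rs) (there p , there p′) (there q , there q′) (there r , there r′) (there s , there s′)
    ... | inj₂ x | inj₂ y = ws= w x y e (s≤s pq) (s≤s qr) (s≤s rs) (there p , there p′) (there q , there q′) (there r , there r′) (there s , there s′)
    ... | inj₁ x | inj₂ y = <-asym qr (head-≼ x y e (r , r′) (q , q′))
    ... | inj₂ x | inj₁ y = <-asym pq (head-≼ y x (sym e) (q , q′) (p , p′))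

    common-perSize : OnePerSize (common D)
    common-perSize {S} {T} (mem p) (mem q) e = ≼-antisym (head-≼ (s₁ p) (s₀ q) e) (head-≼ (s₁ q) (s₀ p) (sym e)) e
      where
      s₁ : ∀ {S} → common D S ≡ true → D ∋ true ∷ S
      s₁ r = mem (proj₁ (∧⁻ r))
      s₀ : ∀ {S} → common D S ≡ true → D ∋ false ∷ S
      s₀ r = mem (proj₂ (∧⁻ r))

    card-shrink : card D ≡ card (shrink D) + card (common D)
    card-shrink = card-∨∧ (D ∘ (true ∷_)) (D ∘ (false ∷_))

  -- M n = n (n + 1) / 2 + 1.
  M : ℕ → ℕ
  M zero    = 1
  M (suc n) = M n + suc n

  card-≤M : (D : Coll n) → WS D → card D ℕ.≤ M n
  card-≤M {zero} D w with D []
  ... | true  = s≤s z≤n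
  ... | false = z≤n
  card-≤M {suc n} D w = subst (ℕ._≤ M (suc n)) (sym (card-shrink w))
    (ℕ.+-mono-≤ (card-≤M _ (WS-shrink w)) (card-perSize-≤ _ (common-perSize w)))

  record Max {n} (D : Coll n) : Set where
    constructor mkMax
    field
      ws  : WS D
      big : M n ℕ.≤ card D
  open Max public

  Max-∁ : {D : Coll n} → Max D → Max (D ∘ ∁)
  Max-∁ {n} {D} m = mkMax (WS-∁ (ws m)) (subst (M n ℕ.≤_) (sym (card-∁ D)) (big m))

  module _ {D : Coll (suc n)} (m : Max D) where
    private
      w = ws m
      tot : M n + suc n ℕ.≤ card (shrink D) + card (common D)
      tot = subst (M (suc n) ℕ.≤_) (card-shrink w) (big m)

    -- Two summands with separate upper bounds reach the sum of the bounds only if each reaches its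
    -- own. `mark` draws the other half of this conclusion.
    Max-shrink : Max (shrink D)
    Max-shrink = mkMax (WS-shrink w) (ℕ.+-cancelʳ-≤ (suc n) _ _
      (ℕ.≤-trans tot (ℕ.+-monoʳ-≤ (card (shrink D)) (card-perSize-≤ _ (common-perSize w)))))

    -- Only the size of `S` matters; passing a set instead of a number supplies the bound by `n` for
    -- free.
    mark : (S : Subset n) → ∃[ X ] ∣ X ∣ ≡ ∣ S ∣ × D ∋ true ∷ X × D ∋ false ∷ X
    mark S with card-perSize-full (common D) (common-perSize w)
                  (ℕ.+-cancelˡ-≤ (M n) _ _ (ℕ.≤-trans tot (ℕ.+-monoˡ-≤ (card (common D)) (card-≤M _ (WS-shrink w)))))
                  ∣ S ∣ (∣p∣≤n S)
    ... | X , e , mem p = let p₁ , p₂ = ∧⁻ {D (true ∷ X)} p in X , e , mem p₁ , mem p₂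

  record Fits {n} (D : Coll n) (U : Subset n) : Set where
    field
      fit-<  : ∀ {Y} → D ∋ Y → ∣ U ∣ ℕ.< ∣ Y ∣ → ∀ {p q r} → p < q → q < r → p ∈ Y ∖ U → q ∈ U ∖ Y → r ∈ Y ∖ U → ⊥
      fit->  : ∀ {Y} → D ∋ Y → ∣ Y ∣ ℕ.< ∣ U ∣ → ∀ {p q r} → p < q → q < r → p ∈ U ∖ Y → q ∈ Y ∖ U → r ∈ U ∖ Y → ⊥
      fit-=  : ∀ {Y} → D ∋ Y → ∣ U ∣ ≡ ∣ Y ∣ → ∀ {p q r s} → p < q → q < r → r < s →
               p ∈ U ∖ Y → q ∈ Y ∖ U → r ∈ U ∖ Y → s ∈ Y ∖ U → ⊥
      fit-=′ : ∀ {Y} → D ∋ Y → ∣ U ∣ ≡ ∣ Y ∣ → ∀ {p q r s} → p < q → q < r → r < s →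
               p ∈ Y ∖ U → q ∈ U ∖ Y → r ∈ Y ∖ U → s ∈ U ∖ Y → ⊥
  open Fits public

  module _ {D : Coll n} (m : Max D) {U : Subset n} (fits : Fits D U) where
    private
      single : Coll n
      single S = does (≡-dec _≟ᵇ_ S U)

      single⁻ : ∀ {S} → single S ≡ true → S ≡ U
      single⁻ {S} e with ≡-dec _≟ᵇ_ S U
      ... | yes p = p

      single-U : single ∋ U
      single-U with ≡-dec _≟ᵇ_ U U in eq
      ... | yes _ = mem (cong does eq)
      ... | no ne = ⊥-elim (ne refl)

      D⁺ : Coll n
      D⁺ S = D S ∨ single S

      D⁺⁻ : ∀ {S} → D⁺ ∋ S → D ∋ S ⊎ S ≡ U
      D⁺⁻ {S} (mem p) with D S in eq
      ... | true  = inj₁ (mem eq)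
      ... | false = inj₂ (single⁻ p)

      ws⁺ : WS D⁺
      ws< ws⁺ x y l pq qr p q r with D⁺⁻ x | D⁺⁻ y
      ... | inj₁ x | inj₁ y = ws< (ws m) x y l pq qr p q r
      ... | inj₁ x | inj₂ refl = fit-> fits x l pq qr p q r
      ... | inj₂ refl | inj₁ y = fit-< fits y l pq qr p q r
      ... | inj₂ refl | inj₂ refl = ℕ.<-irrefl refl l
      ws= ws⁺ x y e pq qr rs p q r s with D⁺⁻ x | D⁺⁻ y
      ... | inj₁ x | inj₁ y = ws= (ws m) x y e pq qr rs p q r s
      ... | inj₁ x | inj₂ refl = fit-=′ fits x (sym e) pq qr rs p q r s
      ... | inj₂ refl | inj₁ y = fit-= fits y e pq qr rs p q r s
      ... | inj₂ refl | inj₂ refl = clash (proj₁ p) (proj₂ p)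

    -- Otherwise adding `U` would give a weakly separated collection of more than `M n` sets.
    Max-complete : D ∋ U
    Max-complete with ∋? D U
    ... | inj₁ p = p
    ... | inj₂ U∉ = ⊥-elim (ℕ.<-irrefl refl (ℕ.≤-trans
          (subst (suc (M n) ℕ.≤_) (sym (trans (card-⊎ D single λ { x (mem p) → ∌ x (subst (λ S → D S ≡ false) (sym (single⁻ p)) U∉) }) (ℕ.+-comm (card D) _)))
            (ℕ.+-mono-≤ (card-≥1 single single-U) (big m)))
          (card-≤M D⁺ ws⁺)))

open Collections

-- Edges `S`, `S ＋ a` between consecutive levels and their neighbours.

module Neighbours where

  private variable
    n : ℕ
    S X Y : Subset n
    a c x : Fin n

  -- Weights decrease from left to right, so `wt` drops whenever an element moves to the right. It
  -- is the measure that makes the walks along `next` terminate.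
  weight : Fin n → ℕ
  weight {suc n} zero    = suc n
  weight         (suc i) = weight i

  wt : Subset n → ℕ
  wt [] = 0
  wt {suc n} (true ∷ S)  = suc n + wt S
  wt         (false ∷ S) = wt S

  weight-≤ : (a : Fin n) → weight a ℕ.≤ n
  weight-≤ zero    = ℕ.≤-refl
  weight-≤ (suc a) = ℕ.m≤n⇒m≤1+n (weight-≤ a)

  weight-< : (a x : Fin n) → a < x → weight x ℕ.< weight a
  weight-< zero    (suc x) _       = s≤s (weight-≤ x)
  weight-< (suc a) (suc x) (s≤s l) = weight-< a x l

  wt-＋ : a ∉ S → wt (S ＋ a) ≡ weight a + wt S
  wt-＋ {S = _ ∷ _} here = refl
  wt-＋ {suc n} {suc a} {true ∷ S} (there p) = trans (cong (suc n +_) (wt-＋ p))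
    (trans (sym (ℕ.+-assoc (suc n) (weight a) (wt S)))
    (trans (cong (_+ wt S) (ℕ.+-comm (suc n) (weight a))) (ℕ.+-assoc (weight a) (suc n) (wt S))))
  wt-＋ {S = false ∷ S} (there p) = wt-＋ p

  wt-shift : a ∉ S → x ∉ S → a < x → wt (S ＋ x) ℕ.< wt (S ＋ a)
  wt-shift {a = a} {S} {x} a∉ x∉ l = subst₂ ℕ._<_ (sym (wt-＋ x∉)) (sym (wt-＋ a∉)) (ℕ.+-monoˡ-< (wt S) (weight-< a x l))

  wt-move : c ∈ S → a ∉ S → c < a → wt (S ＋ a － c) ℕ.< wt S
  wt-move {c = c} {S} {a} c∈ a∉ l = subst₂ ℕ._<_ (cong wt (upd-comm {S = S} {v = false} {w = true} (<⇒≢ l)))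
    (cong wt (－＋ c∈)) (wt-shift (∉－ S c) (out－ a∉) l)

  Initial : Subset n → Set
  Initial U = ∀ {x y} → x ∈ U → y ∉ U → x < y

  ∉∅ : (x : Fin n) → x ∉ replicate n false
  ∉∅ zero    = here
  ∉∅ (suc x) = there (∉∅ x)

  initial-step : ∀ h → h ℕ.< n → ∃[ U ] ∃[ a ] a ∉ U × ∣ U ∣ ≡ h × Initial {n} U × Initial (U ＋ a)
  initial-step {suc n} zero _ = replicate (suc n) false , zero , here , ∣⊥∣≡0 (suc n)
    , (λ {x} p _ → ⊥-elim (clash p (∉∅ x)))
    , λ { here (there _) → s≤s z≤n ; (there p) _ → ⊥-elim (clash p (∉∅ _)) }
  initial-step {suc n} (suc h) (s≤s l) with initial-step {n} h l
  ... | U , a , a∉ , e , f , g = true ∷ U , suc a , there a∉ , cong suc e , up f , up g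
    where
    up : ∀ {V : Subset n} → Initial V → Initial (true ∷ V)
    up f here (there q) = s≤s z≤n
    up f (there p) (there q) = s≤s (f p q)

  -- Each forbidden pattern needs an element of `U` to the right of a missing one, which an initial
  -- segment does not have. Two nested initial segments thus give every walk its first edge.
  initial-∋ : {D : Coll n} → Max D → ∀ {U} → Initial U → D ∋ U
  initial-∋ m f = Max-complete m record
    { fit-<  = λ _ _ pq _ p q _ → <-asym pq (f (proj₁ q) (proj₂ p))
    ; fit->  = λ _ _ _ qr _ q r → <-asym qr (f (proj₁ r) (proj₂ q))
    ; fit-=  = λ _ _ _ qr _ _ q r _ → <-asym qr (f (proj₁ r) (proj₂ q))
    ; fit-=′ = λ _ _ pq _ _ p q _ _ → <-asym pq (f (proj₁ q) (proj₂ p)) }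

  initial-≼ : Initial X → X ≼ Y
  initial-≼ f (p , _) (_ , q) = f p q

  find : {P : Fin n → Set} (P? : ∀ x → P x ⊎ ¬ P x) → ∃ P ⊎ (∀ x → ¬ P x)
  find {zero} P? = inj₂ λ ()
  find {suc n} P? with P? zero | find (λ x → P? (suc x))
  ... | inj₁ p | _ = inj₁ (zero , p)
  ... | inj₂ q | inj₁ (x , p) = inj₁ (suc x , p)
  ... | inj₂ q | inj₂ f = inj₂ λ { zero → q ; (suc x) → f x }

  _∧?_ : {P Q : Set} → P ⊎ ¬ P → Q ⊎ ¬ Q → (P × Q) ⊎ ¬ (P × Q)
  inj₁ p ∧? inj₁ q = inj₁ (p , q)
  inj₂ p ∧? _      = inj₂ (p ∘ proj₁)
  inj₁ _ ∧? inj₂ q = inj₂ (q ∘ proj₂)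

  <⊎ : (a b : Fin n) → a < b ⊎ ¬ (a < b)
  <⊎ a b with a <? b
  ... | yes p = inj₁ p
  ... | no  p = inj₂ p

  ∈⊎ : (x : Fin n) (S : Subset n) → x ∈ S ⊎ ¬ (x ∈ S)
  ∈⊎ x S = [ inj₁ , (λ q → inj₂ (flip clash q)) ]′ (∈? x S)

  ∉⊎ : (x : Fin n) (S : Subset n) → x ∉ S ⊎ ¬ (x ∉ S)
  ∉⊎ x S = [ (λ p → inj₂ (clash p)) , inj₁ ]′ (∈? x S)

  ¬∉⇒∈ : ¬ (x ∉ S) → x ∈ S
  ¬∉⇒∈ {x = x} {S} f = [ id , ⊥-elim ∘ f ]′ (∈? x S)

  ¬∈⇒∉ : ¬ (x ∈ S) → x ∉ S
  ¬∈⇒∉ {x = x} {S} f = [ ⊥-elim ∘ f , id ]′ (∈? x S)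

  -- `NotFirst` fails exactly when `S` consists of all elements before `a`, `NotLast` exactly when
  -- it consists of all elements after `a`. These are the two boundary edges between a pair of
  -- levels.
  NotFirst NotLast : Subset n → Fin n → Set
  NotFirst S a = (∃[ x ] x < a × x ∉ S) ⊎ (∃[ c ] a < c × c ∈ S)
  NotLast  S a = (∃[ x ] a < x × x ∉ S) ⊎ (∃[ c ] c < a × c ∈ S)

  notFirst? : (S : Subset n) (a : Fin n) → NotFirst S a ⊎ Initial (S ＋ a)
  notFirst? S a with find (λ x → <⊎ x a ∧? ∉⊎ x S) | find (λ c → <⊎ a c ∧? ∈⊎ c S)
  ... | inj₁ p | _      = inj₁ (inj₁ p)
  ... | inj₂ _ | inj₁ q = inj₁ (inj₂ q)
  ... | inj₂ f | inj₂ g = inj₂ ini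
    where
    hi : ∀ {y} → y ∉ S ＋ a → a < y
    hi {y} q with <-cmp a y
    ... | tri< l _ _ = l
    ... | tri≈ _ refl _ = ⊥-elim (clash (∈＋ S a) q)
    ... | tri> _ _ l = ⊥-elim (f y (l , out＋⁻ q))
    ini : Initial (S ＋ a)
    ini {x} {y} p q with in＋⁻ p | <-cmp x a
    ... | inj₁ refl | _ = hi q
    ... | inj₂ _ | tri< l _ _ = <-trans l (hi q)
    ... | inj₂ _ | tri≈ _ refl _ = hi q
    ... | inj₂ p | tri> _ _ l = ⊥-elim (g x (l , p))

  notLast? : (S : Subset n) (a : Fin n) → NotLast S a ⊎ ((∀ {Z} → Z ≼ S ＋ a) × (∀ {c} → c ∈ S → a < c ⊎ a ≡ c))
  notLast? S a with find (λ x → <⊎ a x ∧? ∉⊎ x S) | find (λ c → <⊎ c a ∧? ∈⊎ c S)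
  ... | inj₁ p | _      = inj₁ (inj₁ p)
  ... | inj₂ _ | inj₁ q = inj₁ (inj₂ q)
  ... | inj₂ f | inj₂ g = inj₂ ((λ { (_ , p) (q , _) → fin q p }) , up)
    where
    up : ∀ {c} → c ∈ S → a < c ⊎ a ≡ c
    up {c} p with <-cmp a c
    ... | tri< l _ _ = inj₁ l
    ... | tri≈ _ e _ = inj₂ e
    ... | tri> _ _ l = ⊥-elim (g c (l , p))
    lo : ∀ {y} → y ∉ S ＋ a → y < a
    lo {y} q with <-cmp a y
    ... | tri> _ _ l = l
    ... | tri≈ _ refl _ = ⊥-elim (clash (∈＋ S a) q)
    ... | tri< l _ _ = ⊥-elim (f y (l , out＋⁻ q))
    fin : ∀ {x y} → y ∈ S ＋ a → x ∉ S ＋ a → x < y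
    fin {x} {y} p q with in＋⁻ p | <-cmp a y
    ... | inj₁ refl | _ = lo q
    ... | inj₂ _ | tri< l _ _ = <-trans (lo q) l
    ... | inj₂ _ | tri≈ _ refl _ = lo q
    ... | inj₂ p | tri> _ _ l = ⊥-elim (g y (l , p))

  -- Adjacent edges share their lower end `S` or their upper end `S ＋ a`. The inequalities for the
  -- new label are opposite in the two cases, because adding an earlier element instead of `a` and
  -- dropping a later one instead of `a` both shift a set to the left.
  Prev Next : Coll n → Subset n → Fin n → Set
  Prev D S a = (∃[ x ] x < a × x ∉ S × D ∋ S ＋ x) ⊎ (∃[ c ] a < c × c ∈ S × D ∋ S ＋ a － c)
  Next D S a = (∃[ x ] a < x × x ∉ S × D ∋ S ＋ x) ⊎ (∃[ c ] c < a × c ∈ S × D ∋ S ＋ a － c)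

  ∋-subst : {D : Coll n} → X ≡ Y → D ∋ X → D ∋ Y
  ∋-subst refl p = p

  ∋∁ : {D : Coll n} → D ∋ X → D ∘ ∁ ∋ ∁ X
  ∋∁ {X = X} {D} (mem p) = mem (trans (cong D (∁∁ X)) p)

  ∣exch∣ : a ∉ S → c ∈ S → ∣ S ＋ a － c ∣ ≡ ∣ S ∣
  ∣exch∣ a∉ c∈ = ℕ.suc-injective (trans (∣－∣ (in＋ c∈)) (∣＋∣ a∉))

  -- Every mark X has a lower neighbour X - c that still contains the head: walk along next from the initial
  -- segments until the mark is met; the alternative that the walk jumps over the mark contradicts weak separation.
  module MarkStep {n : ℕ} {D : Coll (suc n)} (m : Max D)
    (next : ∀ {S : Subset n} {a : Fin n} → a ∉ S → shrink D ∋ S → shrink D ∋ S ＋ a → NotLast S a → Next (shrink D) S a) where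
    private
      w = ws m

    mark-lower′ : ∀ {X} → D ∋ true ∷ X → D ∋ false ∷ X → ∃ (_∈ X) → ∃[ c ] c ∈ X × shrink D ∋ X － c
    mark-lower′ {X} X₁ X₀ (c₀ , c₀∈) = start
      where
      -- The edge moves to the right while its upper end stays `≼ X`. Each move lowers one of the
      -- two weights and keeps the other, and `k` bounds their sum.
      walk : ∀ k {S a} → wt S + wt (S ＋ a) ℕ.< k → a ∉ S → shrink D ∋ S → shrink D ∋ S ＋ a →
             ∣ X ∣ ≡ suc ∣ S ∣ → S ＋ a ≼ X → ∃[ c ] c ∈ X × shrink D ∋ X － c
      walk (suc k) {S} {a} (s≤s l) a∉ S∈ T∈ e le with notLast? S a
      -- Every set is `≼` the upper end of the last edge, so here `X` is that upper end.
      ... | inj₂ (last , _) = a , ∋X , ∋-subst (trans (sym (＋－ a∉)) (cong (_－ a) T≡X)) S∈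
        where
        T≡X : S ＋ a ≡ X
        T≡X = ≼-antisym le last (trans (∣＋∣ a∉) (sym e))
        ∋X : a ∈ X
        ∋X = subst (a ∈_) T≡X (∈＋ S a)
      ... | inj₁ nl with next a∉ S∈ T∈ nl
      ... | inj₂ (c , c<a , c∈ , R∈) = walk k
              (ℕ.≤-trans (ℕ.+-mono-<-≤ (wt-move c∈ a∉ c<a) (ℕ.≤-reflexive (cong wt eq))) l)
              (∉－ _ c) R∈ (∋-subst (sym eq) T∈)
              (trans e (cong suc (sym (∣exch∣ a∉ c∈))))
              (subst (_≼ X) (sym eq) le)
        where
        eq : S ＋ a － c ＋ c ≡ S ＋ a
        eq = －＋ (in＋ c∈)
      ... | inj₁ (x , a<x , x∉ , R∈) with shrink⁻ R∈
      ... | inj₁ R₁ = walk k (ℕ.≤-trans (ℕ.+-monoʳ-< (wt S) (wt-shift a∉ x∉ a<x)) l) x∉ S∈ R∈ e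
                        (head-≼ w R₁ X₀ (trans (∣＋∣ x∉) (sym e)))
      ... | inj₂ R₀ with between a∉ x∉ e le (head-≼ w X₁ R₀ (trans e (sym (∣＋∣ x∉))))
      ... | one z z∉ refl _ _ = z , ∈＋ S z , ∋-subst (sym (＋－ z∉)) S∈
      ... | skip s s∈ refl a<s s<x = ⊥-elim ([ c₁ , c₂ ]′ (shrink⁻ S∈))
        where
        a∈X = oth (<⇒≢ a<s) (in＋ {a = x} (∈＋ S a))
        x∈X = oth (>⇒≢ s<x) (∈＋ (S ＋ a) x)
        s∉X = ∉－ (S ＋ a ＋ x) s
        c₁ : D ∋ true ∷ S → ⊥
        c₁ S₁ = ws= w S₁ X₀ (sym e) (s≤s z≤n) (s≤s a<s) (s≤s s<x)
          (here , here) (there a∈X , there a∉) (there s∈ , there s∉X) (there x∈X , there x∉)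
        c₂ : D ∋ false ∷ S → ⊥
        c₂ S₀ = ws< w S₀ X₁ (ℕ.≤-trans (ℕ.≤-reflexive (sym e)) (ℕ.n≤1+n _)) (s≤s a<s) (s≤s s<x)
          (there a∈X , there a∉) (there s∈ , there s∉X) (there x∈X , there x∉)

      start : ∃[ c ] c ∈ X × shrink D ∋ X － c
      start with initial-step ∣ X － c₀ ∣ (ℕ.≤-trans (ℕ.≤-reflexive (∣－∣ c₀∈)) (∣p∣≤n X))
      ... | U , a , a∉ , eU , f , g = walk _ ℕ.≤-refl a∉ (initial-∋ (Max-shrink m) f) (initial-∋ (Max-shrink m) g)
             (trans (sym (∣－∣ c₀∈)) (cong suc (sym eU))) (initial-≼ g)

    -- If the lower neighbour comes without the head, the mark `Y` one size below replaces it. An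
    -- element `y` of `Y` outside `X` would precede some `r` of the lower neighbour that `Y` misses,
    -- and `true ∷ X` would surround `y` by the head and `r`.
    mark-lower : ∀ {X} → D ∋ true ∷ X → D ∋ false ∷ X → ∃ (_∈ X) → ∃[ c ] c ∈ X × D ∋ true ∷ (X － c)
    mark-lower {X} X₁ X₀ ne with mark-lower′ X₁ X₀ ne
    ... | c , c∈ , R∈ with shrink⁻ R∈
    ... | inj₁ R₁ = c , c∈ , R₁
    ... | inj₂ R₀ with mark m (X － c)
    ... | Y , eY , Y₁ , Y₀ with ⊑? Y X
    ... | inj₁ Y⊑X = c′
      where
      sY : ∣ X ∣ ≡ suc ∣ Y ∣
      sY = trans (sym (∣－∣ c∈)) (cong suc (sym eY))
      c′ : ∃[ c ] c ∈ X × D ∋ true ∷ (X － c)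
      c′ with ⊑-suc Y⊑X sY
      ... | z , z∉ , refl = z , ∈＋ Y z , ∋-subst (cong (true ∷_) (sym (＋－ z∉))) Y₁
    ... | inj₂ (y , y∈ , y∉) = ⊥-elim bad
      where
      Y≼R : Y ≼ X － c
      Y≼R = head-≼ w Y₁ R₀ eY
      bad : ⊥
      bad with differ (X － c) Y (sym eY)
      ... | inj₁ refl = clash (in－⁻ y∈) y∉
      ... | inj₂ ((r , r∈ , r∉) , _) = ws< w Y₀ X₁ (ℕ.≤-trans (ℕ.≤-reflexive (trans (cong suc eY) (∣－∣ c∈))) (ℕ.n≤1+n _))
             (s≤s z≤n) (s≤s (Y≼R (y∈ , out－ y∉) (r∈ , r∉)))
             (here , here) (there y∈ , there y∉) (there (in－⁻ r∈) , there r∉)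

  module PrevStep {n : ℕ} {D : Coll (suc n)} (m : Max D) where
    private
      w = ws m

    -- A neighbour without the head would have the mark of its size squeezed between the given set
    -- and itself, which orders the two labels against `Prev`.
    prev-true : ∀ {S a} → a ∉ S → D ∋ true ∷ S → D ∋ true ∷ (S ＋ a) → Prev (shrink D) S a → Prev D (true ∷ S) (suc a)
    prev-true {S} {a} a∉ S₁ T₁ (inj₁ (x , x<a , x∉ , R∈)) with shrink⁻ R∈
    ... | inj₁ R₁ = inj₁ (suc x , s≤s x<a , there x∉ , R₁)
    ... | inj₂ R₀ with mark m (S ＋ a)
    ... | X , e , X₁ , X₀ with between a∉ x∉ (trans e (∣＋∣ a∉)) (head-≼ w T₁ X₀ (sym e))
                                 (head-≼ w X₁ R₀ (trans e (trans (∣＋∣ a∉) (sym (∣＋∣ x∉)))))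
    ... | one z _ _ lo hi = ⊥-elim (≤′≤′-absurd lo hi x<a)
    ... | skip s _ _ lo hi = ⊥-elim (<-asym (<-trans lo hi) x<a)
    prev-true {S} {a} a∉ S₁ T₁ (inj₂ (c , a<c , c∈ , R∈)) with shrink⁻ R∈
    ... | inj₁ R₁ = inj₂ (suc c , s≤s a<c , there c∈ , R₁)
    ... | inj₂ R₀ with mark m S
    ... | X , e , X₁ , X₀ with between⁻ (∈＋ S a) (in＋ c∈) (trans (cong suc e) (sym (∣＋∣ a∉)))
                                 (subst (_≼ X) (sym (＋－ a∉)) (head-≼ w S₁ X₀ (sym e)))
                                 (head-≼ w X₁ R₀ (trans e (sym (∣exch∣ a∉ c∈))))
    ... | one z _ _ lo hi = ⊥-elim (≤′≤′-absurd lo hi a<c)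
    ... | skip s _ _ lo hi = ⊥-elim (<-asym (<-trans lo hi) a<c)

    module _ {S : Subset n} {a : Fin n} (a∉ : a ∉ S) (S₀ : D ∋ false ∷ S) (T₀ : D ∋ false ∷ (S ＋ a)) where

      -- As `S ＋ a` is a mark, the mark `X` one size below lies inside it: an element outside would
      -- be surrounded by `true ∷ (S ＋ a)`. So either `X` is `S`, and the head is the new label, or
      -- `X` drops some `s` after `a`.
      prev-mark : D ∋ true ∷ (S ＋ a) → Prev D (false ∷ S) (suc a)
      prev-mark T₁ with mark m S
      ... | X , e , X₁ , X₀ with differ X S e
      ... | inj₁ refl = inj₁ (zero , s≤s z≤n , here , X₁)
      ... | inj₂ ((x , x∈ , x∉) , (s , s∈ , s∉)) with head-≼ w X₁ S₀ e {x} {s} (x∈ , x∉) (s∈ , s∉) | ⊑? X (S ＋ a)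
      ... | _ | inj₂ (p , p∈ , p∉) = ⊥-elim (ws< w X₀ T₁ (s≤s (ℕ.≤-trans (ℕ.≤-reflexive e) (ℕ.≤-trans (ℕ.n≤1+n _) (ℕ.≤-reflexive (sym (∣＋∣ a∉))))))
              (s≤s z≤n) (s≤s (head-≼ w X₁ S₀ e (p∈ , out＋⁻ p∉) (s∈ , s∉)))
              (here , here) (there p∈ , there p∉) (there (in＋ s∈) , there s∉))
      ... | x<s | inj₁ X⊑T with in＋⁻ (X⊑T x∈)
      ... | inj₂ x∈S = ⊥-elim (clash x∈S x∉)
      ... | inj₁ refl = inj₂ (suc s , s≤s x<s , there s∈ , ∋-subst (cong (false ∷_) X≡) X₀)
        where
        X≡ : X ≡ S ＋ a － s
        X≡ = ⊑-full (λ p → oth (∈∉⇒≢ p s∉) (X⊑T p)) (ℕ.≤-reflexive (trans (∣exch∣ a∉ s∈) (sym e)))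

      -- An edge that is first among the tails is not first in `D`, where the head comes before it;
      -- its upper end is then the mark. Otherwise a neighbour with the head squeezes the mark onto
      -- a neighbour on the same side or onto an end of the edge.
      prev-false : Prev (shrink D) S a ⊎ Initial (S ＋ a) → Prev D (false ∷ S) (suc a)
      prev-false (inj₂ ini) with mark m (S ＋ a)
      ... | X , e , X₁ , X₀ = prev-mark (∋-subst (cong (true ∷_) (≼-antisym (head-≼ w X₁ T₀ e) (initial-≼ ini) e)) X₁)
      prev-false (inj₁ (inj₁ (x , x<a , x∉ , R∈))) with shrink⁻ R∈
      ... | inj₂ R₀ = inj₁ (suc x , s≤s x<a , there x∉ , R₀)
      ... | inj₁ R₁ with mark m (S ＋ a)
      ... | X , e , X₁ , X₀ with between x∉ a∉ (trans e (∣＋∣ a∉))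
                                   (head-≼ w R₁ X₀ (trans (∣＋∣ x∉) (sym (trans e (∣＋∣ a∉))))) (head-≼ w X₁ T₀ e)
      ... | one z z∉ refl _ (inj₁ refl) = prev-mark X₁
      ... | one z z∉ refl _ (inj₂ z<a) = inj₁ (suc z , s≤s z<a , there z∉ , X₀)
      ... | skip s s∈ refl x<s s<a = ⊥-elim (ws< w S₀ X₁ (s≤s (ℕ.≤-trans (ℕ.n≤1+n _) (ℕ.≤-reflexive (sym (trans e (∣＋∣ a∉))))))
              (s≤s x<s) (s≤s s<a)
              (there (oth (<⇒≢ x<s) (in＋ {a = a} (∈＋ S x))) , there x∉)
              (there s∈ , there (∉－ (S ＋ x ＋ a) s))
              (there (oth (>⇒≢ s<a) (∈＋ (S ＋ x) a)) , there a∉))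
      prev-false (inj₁ (inj₂ (c , a<c , c∈ , R∈))) with shrink⁻ R∈
      ... | inj₂ R₀ = inj₂ (suc c , s≤s a<c , there c∈ , R₀)
      ... | inj₁ R₁ with mark m S
      ... | X , e , X₁ , X₀ with between⁻ (in＋ c∈) (∈＋ S a) (trans (cong suc e) (sym (∣＋∣ a∉)))
                                   (head-≼ w R₁ X₀ (trans (∣exch∣ a∉ c∈) (sym e)))
                                   (subst (X ≼_) (sym (＋－ a∉)) (head-≼ w X₁ S₀ e))
      ... | one z z∈ refl (inj₁ refl) _ = inj₁ (zero , s≤s z≤n , here , ∋-subst (cong (true ∷_) (＋－ a∉)) X₁)
      ... | one z z∈ refl (inj₂ a<z) _ = inj₂ (suc z , s≤s a<z , there (unoth (>⇒≢ a<z) z∈) , X₀)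
      ... | skip z z∉ refl a<z z<c = ⊥-elim (ws= w X₁ T₀ (trans (cong suc e) (sym (∣＋∣ a∉)))
              (s≤s z≤n) (s≤s a<z) (s≤s z<c) (here , here)
              (there (∈＋ S a) , there (oth (<⇒≢ a<z) (out－ (∉－ (S ＋ a) a))))
              (there (∈＋ (S ＋ a － a － c) z) , there z∉)
              (there (in＋ c∈) , there (oth (>⇒≢ z<c) (∉－ (S ＋ a － a) c))))

  mutual
    prev : ∀ n {D : Coll n} → Max D → ∀ {S a} → a ∉ S → D ∋ S → D ∋ S ＋ a → NotFirst S a → Prev D S a
    -- This edge joins the two copies of a mark and collapses when the head is deleted, so `prev`
    -- for `shrink D` says nothing about it; `mark-lower` takes over, using `next` on one element
    -- fewer.
    prev (suc n) {D} m {false ∷ S} {zero} here S₀ S₁ nf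
      with MarkStep.mark-lower m (next n (Max-shrink m)) S₁ S₀ (ne nf)
      where
      ne : NotFirst (false ∷ S) zero → ∃ (_∈ S)
      ne (inj₂ (suc c , _ , there c∈)) = c , c∈
    ... | c , c∈ , R∈ = inj₂ (suc c , s≤s z≤n , there c∈ , R∈)
    prev (suc n) {D} m {true ∷ S} {suc a} (there a∉) S₁ T₁ nf =
      PrevStep.prev-true m a∉ S₁ T₁ (prev n (Max-shrink m) a∉ (shrink₁ S₁) (shrink₁ T₁) (nf′ nf))
      where
      nf′ : NotFirst (true ∷ S) (suc a) → NotFirst S a
      nf′ (inj₁ (suc x , s≤s l , there p)) = inj₁ (x , l , p)
      nf′ (inj₂ (suc c , s≤s l , there p)) = inj₂ (c , l , p)
    prev (suc n) {D} m {false ∷ S} {suc a} (there a∉) S₀ T₀ nf = PrevStep.prev-false m a∉ S₀ T₀ ih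
      where
      ih : Prev (shrink D) S a ⊎ Initial (S ＋ a)
      ih with notFirst? S a
      ... | inj₁ nf′ = inj₁ (prev n (Max-shrink m) a∉ (shrink₀ S₀) (shrink₀ T₀) nf′)
      ... | inj₂ ini = inj₂ ini

    -- Complementation turns the edge upside down, keeps its label and exchanges adding `x` with
    -- dropping `x`, so `Prev` of the complement is `Next`.
    next : ∀ n {D : Coll n} → Max D → ∀ {S a} → a ∉ S → D ∋ S → D ∋ S ＋ a → NotLast S a → Next D S a
    next n {D} m {S} {a} a∉ S∈ T∈ nl = res (prev n (Max-∁ m) (∁⁺ (∈＋ S a)) (∋∁ T∈) (∋-subst (sym eq) (∋∁ S∈)) (nf nl))
      where
      eq : ∁ (S ＋ a) ＋ a ≡ ∁ S
      eq = trans (cong (_＋ a) (∁-upd {S = S} {a})) (－＋ (∁⁺ a∉))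
      nf : NotLast S a → NotFirst (∁ (S ＋ a)) a
      nf (inj₁ (x , l , p)) = inj₂ (x , l , ∁⁺ (oth (>⇒≢ l) p))
      nf (inj₂ (c , l , p)) = inj₁ (c , l , ∁⁺ (in＋ p))
      un : ∀ {X Y} → X ≡ ∁ Y → D ∘ ∁ ∋ X → D ∋ Y
      un {Y = Y} refl (mem p) = mem (trans (cong D (sym (∁∁ Y))) p)
      res : Prev (D ∘ ∁) (∁ (S ＋ a)) a → Next D S a
      res (inj₁ (x , l , p , R)) = inj₂ (x , l , unoth (<⇒≢ l) (∁⁻ p) , un (sym ∁-upd) R)
      res (inj₂ (c , l , p , R)) = inj₁ (c , l , out＋⁻ (∁⁻ p) , un (trans (cong (_－ c) eq) (sym ∁-upd)) R)

  mark-lower : ∀ {D : Coll (suc n)} → Max D → ∀ {X} → D ∋ true ∷ X → D ∋ false ∷ X → ∃ (_∈ X) →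
               ∃[ c ] c ∈ X × D ∋ true ∷ (X － c)
  mark-lower {n} m = MarkStep.mark-lower m (next n (Max-shrink m))

open Neighbours

-- The cell on one side of a pair `K ＋ a`, `K ＋ b`.

module OuterSides where

  private variable
    n : ℕ
    K : Subset n
    a b c : Fin n

  -- Third vertices on one side of the pair: sets above `K` whose label lies outside the interval
  -- from `a` to `b`, and sets below `K ＋ a ＋ b` that drop an element inside it. `K` itself stands
  -- for a label before all others, since `true ∷ K` becomes `K` when the head is deleted.
  Outer : Coll n → Subset n → Fin n → Fin n → Set
  Outer D K a b = (∃[ x ] (x < a ⊎ b < x) × x ∉ K × D ∋ K ＋ x)
                ⊎ D ∋ K
                ⊎ (∃[ c ] a < c × c < b × c ∈ K × D ∋ K ＋ a ＋ b － c)

  module OuterStep {n : ℕ} {D : Coll (suc n)} (m : Max D) where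
    private
      w  = ws m
      w′ = WS-shrink w

    ∣＋∣≡ : a ∉ K → b ∉ K → ∣ K ＋ a ∣ ≡ ∣ K ＋ b ∣
    ∣＋∣≡ a∉ b∉ = trans (∣＋∣ a∉) (sym (∣＋∣ b∉))

    ∣＋－∣ : a ∉ K → c ∈ K → ℕ.suc ∣ K ＋ a － c ∣ ≡ ℕ.suc ∣ K ∣
    ∣＋－∣ a∉ c∈ = cong suc (∣exch∣ a∉ c∈)

    -- The tails `K` and `K ＋ b` of this pair form an inclusion edge, so `next` takes the place of
    -- the induction hypothesis.
    outer-zero : ∀ {K b} → b ∉ K → D ∋ true ∷ K → D ∋ false ∷ (K ＋ b) → Outer D (false ∷ K) zero (suc b)
    outer-zero {K} {b} b∉ K₁ T₀ with mark m K
    ... | X , e , X₁ , X₀ with notLast? K b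
    -- On the last edge the mark of this size cannot lie after `K`, so it is `K`, and its copy
    -- without the head is the third vertex.
    ... | inj₂ (last , up) = inj₂ (inj₁ (∋-subst (cong (false ∷_) (≼-antisym X≼K (head-≼ w K₁ X₀ (sym e)) e)) X₀))
      where
      X≼K : X ≼ K
      X≼K {x} {k} (p , p′) (q , q′) with x ≟ b | up q
      ... | no ne | _ = last (p , oth ne p′) (in＋ q , q′)
      ... | yes refl | inj₁ l = l
      ... | yes refl | inj₂ refl = ⊥-elim (clash q b∉)
    ... | inj₁ nl with next n (Max-shrink m) b∉ (shrink₁ K₁) (shrink₀ T₀) nl
    ... | inj₁ (x , b<x , x∉ , R∈) with shrink⁻ R∈
    ... | inj₂ R₀ = inj₁ (suc x , inj₂ (s≤s b<x) , there x∉ , R₀)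
    ... | inj₁ R₁ with mark m (K ＋ b)
    ... | Z , e′ , Z₁ , Z₀ with between x∉ b∉ (trans e′ (∣＋∣ b∉)) (head-≼ w R₁ Z₀ (trans (∣＋∣≡ x∉ b∉) (sym e′))) (head-≼ w Z₁ T₀ e′)
    ... | one _ _ _ lo hi = ⊥-elim (≤′≤′-absurd lo hi b<x)
    ... | skip _ _ _ lo hi = ⊥-elim (<-asym (<-trans lo hi) b<x)
    outer-zero {K} {b} b∉ K₁ T₀ | X , e , X₁ , X₀ | inj₁ nl | inj₂ (c , c<b , c∈ , R∈) with shrink⁻ R∈
    ... | inj₁ R₁ = inj₂ (inj₂ (suc c , s≤s z≤n , s≤s c<b , there c∈ , R₁))
    ... | inj₂ R₀ with between⁻ (∈＋ K b) (in＋ c∈) (trans (cong suc e) (sym (∣＋∣ b∉)))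
                         (subst (_≼ X) (sym (＋－ b∉)) (head-≼ w K₁ X₀ (sym e)))
                         (head-≼ w X₁ R₀ (trans e (sym (∣exch∣ b∉ c∈))))
    ... | one z z∈ refl _ (inj₁ refl) = inj₂ (inj₁ (∋-subst (cong (false ∷_) (＋－ b∉)) X₀))
    ... | one z z∈ refl _ (inj₂ z<b) = inj₂ (inj₂ (suc z , s≤s z≤n , s≤s z<b , there (unoth (<⇒≢ z<b) z∈) , X₁))
    ... | skip z z∉ refl c<z z<b = ⊥-elim (ws= w X₁ T₀ (trans (cong suc e) (sym (∣＋∣ b∉)))
            (s≤s z≤n) (s≤s c<z) (s≤s z<b) (here , here)
            (there (in＋ c∈) , there (oth (<⇒≢ c<z) (out－ (∉－ (K ＋ b) c))))
            (there (∈＋ (K ＋ b － c － b) z) , there z∉)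
            (there (∈＋ K b) , there (oth (>⇒≢ z<b) (∉－ (K ＋ b － c) b))))

    module _ {K : Subset n} {a b : Fin n} (a∉ : a ∉ K) (b∉ : b ∉ K) (a<b : a < b) where

      private
        exch-b : c ∈ K → K ＋ a － c ＋ b ≡ K ＋ a ＋ b － c
        exch-b c∈ = upd-comm (∈∉⇒≢ c∈ b∉)
        exch-a : c ∈ K → K ＋ b － c ＋ a ≡ K ＋ a ＋ b － c
        exch-a {c = c} c∈ = trans (upd-comm (∈∉⇒≢ c∈ a∉)) (cong (_－ c) (upd-comm (>⇒≢ a<b)))

      -- A third vertex with the head is replaced by the mark squeezed between it and `K ＋ a` or
      -- `K ＋ b`. If the mark is `K ＋ a` itself, its lower neighbour from `mark-lower` can only drop
      -- `a`, which yields `true ∷ K`, the label of the head.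
      outer-false : D ∋ false ∷ (K ＋ a) → D ∋ false ∷ (K ＋ b) → Outer (shrink D) K a b → Outer D (false ∷ K) (suc a) (suc b)
      outer-false A₀ B₀ o with mark m (K ＋ a)
      outer-false A₀ B₀ (inj₁ (x , side , x∉ , R∈)) | X , e , X₁ , X₀ with shrink⁻ R∈ | side
      ... | inj₂ R₀ | inj₁ l = inj₁ (suc x , inj₁ (s≤s l) , there x∉ , R₀)
      ... | inj₂ R₀ | inj₂ l = inj₁ (suc x , inj₂ (s≤s l) , there x∉ , R₀)
      ... | inj₁ R₁ | inj₂ b<x with between x∉ b∉ (trans e (∣＋∣ a∉)) (head-≼ w R₁ X₀ (trans (∣＋∣≡ x∉ a∉) (sym e))) (head-≼ w X₁ B₀ (trans e (∣＋∣≡ a∉ b∉)))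
      ... | one _ _ _ lo hi = ⊥-elim (≤′≤′-absurd lo hi b<x)
      ... | skip _ _ _ lo hi = ⊥-elim (<-asym (<-trans lo hi) b<x)
      outer-false A₀ B₀ (inj₁ (x , side , x∉ , R∈)) | X , e , X₁ , X₀ | inj₁ R₁ | inj₁ x<a
        with between x∉ a∉ (trans e (∣＋∣ a∉)) (head-≼ w R₁ X₀ (trans (∣＋∣≡ x∉ a∉) (sym e))) (head-≼ w X₁ A₀ e)
      ... | one z z∉ refl _ (inj₂ z<a) = inj₁ (suc z , inj₁ (s≤s z<a) , there z∉ , X₀)
      ... | skip s s∈ refl x<s s<a = ⊥-elim (ws< w B₀ X₁ (s≤s (ℕ.≤-reflexive (trans (∣＋∣≡ b∉ a∉) (sym e))))
              (s≤s x<s) (s≤s s<a)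
              (there (oth (<⇒≢ x<s) (in＋ {a = a} (∈＋ K x))) , there (oth (<⇒≢ (<-trans x<a a<b)) x∉))
              (there (in＋ s∈) , there (∉－ (K ＋ x ＋ a) s))
              (there (oth (>⇒≢ s<a) (∈＋ (K ＋ x) a)) , there (oth (<⇒≢ a<b) a∉)))
      ... | one z z∉ refl _ (inj₁ refl) with mark-lower m X₁ X₀ (a , ∈＋ K a)
      ... | c , c∈ , L₁ with c ≟ a
      ... | yes refl = inj₁ (zero , inj₁ (s≤s z≤n) , here , ∋-subst (cong (true ∷_) (＋－ a∉)) L₁)
      ... | no c≢a with <-cmp c a
      ... | tri≈ _ c≡a _ = ⊥-elim (c≢a c≡a)
      ... | tri> _ _ a<c = ⊥-elim (ws< w′ (shrink₁ L₁) R∈ (ℕ.≤-reflexive (trans (∣＋－∣ a∉ (unoth c≢a c∈)) (sym (∣＋∣ x∉)))) x<a a<c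
              (∈＋ K x , out－ (oth (<⇒≢ x<a) x∉))
              (oth (<⇒≢ a<c) (∈＋ K a) , oth (>⇒≢ x<a) a∉)
              (in＋ (unoth c≢a c∈) , ∉－ (K ＋ a) c))
      ... | tri< c<a _ _ = ⊥-elim (ws= w L₁ B₀ (trans (∣＋－∣ a∉ (unoth c≢a c∈)) (sym (∣＋∣ b∉)))
              (s≤s z≤n) (s≤s c<a) (s≤s a<b) (here , here)
              (there (in＋ (unoth c≢a c∈)) , there (∉－ (K ＋ a) c))
              (there (oth (>⇒≢ c<a) (∈＋ K a)) , there (oth (<⇒≢ a<b) a∉))
              (there (∈＋ K b) , there (out－ (oth (>⇒≢ a<b) b∉))))
      outer-false A₀ B₀ (inj₂ (inj₁ K∈)) | _ with shrink⁻ K∈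
      ... | inj₁ K₁ = inj₁ (zero , inj₁ (s≤s z≤n) , here , K₁)
      ... | inj₂ K₀ = inj₂ (inj₁ K₀)
      outer-false A₀ B₀ (inj₂ (inj₂ (c , a<c , c<b , c∈ , R∈))) | X , e , X₁ , X₀ with shrink⁻ R∈
      ... | inj₂ R₀ = inj₂ (inj₂ (suc c , s≤s a<c , s≤s c<b , there c∈ , R₀))
      ... | inj₁ R₁ with between {S = K ＋ a － c} {Z = X} (oth (∉∈⇒≢ b∉ c∈) (oth (>⇒≢ a<b) b∉)) (∉－ (K ＋ a) c)
                           (trans e (sym (∣－∣ (in＋ c∈))))
                           (head-≼ w (∋-subst (cong (true ∷_) (sym (exch-b c∈))) R₁) X₀
                              (trans (∣＋∣ (oth (∉∈⇒≢ b∉ c∈) (oth (>⇒≢ a<b) b∉))) (trans (∣－∣ (in＋ c∈)) (sym e))))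
                           (subst (X ≼_) (sym (－＋ (in＋ c∈))) (head-≼ w X₁ A₀ e))
      ... | one _ _ _ lo hi = ⊥-elim (≤′≤′-absurd lo hi c<b)
      ... | skip _ _ _ lo hi = ⊥-elim (<-asym (<-trans lo hi) c<b)

      -- Here the mark comes after the given sets, and a mark `K ＋ b` leads to `true ∷ K`. If `K`
      -- occurs without the head, the mark `Y` of its size is `K`: some `y` of `Y` outside `K` would
      -- differ from `a` or from `b`, and the corresponding given set would surround it.
      outer-true : D ∋ true ∷ (K ＋ a) → D ∋ true ∷ (K ＋ b) → Outer (shrink D) K a b → Outer D (true ∷ K) (suc a) (suc b)
      outer-true A₁ B₁ o with mark m (K ＋ a)
      outer-true A₁ B₁ (inj₁ (x , side , x∉ , R∈)) | X , e , X₁ , X₀ with shrink⁻ R∈ | side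
      ... | inj₁ R₁ | inj₁ l = inj₁ (suc x , inj₁ (s≤s l) , there x∉ , R₁)
      ... | inj₁ R₁ | inj₂ l = inj₁ (suc x , inj₂ (s≤s l) , there x∉ , R₁)
      ... | inj₂ R₀ | inj₁ x<a with between a∉ x∉ (trans e (∣＋∣ a∉)) (head-≼ w A₁ X₀ (sym e)) (head-≼ w X₁ R₀ (trans e (∣＋∣≡ a∉ x∉)))
      ... | one _ _ _ lo hi = ⊥-elim (≤′≤′-absurd lo hi x<a)
      ... | skip _ _ _ lo hi = ⊥-elim (<-asym (<-trans lo hi) x<a)
      outer-true A₁ B₁ (inj₁ (x , side , x∉ , R∈)) | X , e , X₁ , X₀ | inj₂ R₀ | inj₂ b<x
        with between b∉ x∉ (trans e (∣＋∣ a∉)) (head-≼ w B₁ X₀ (trans (∣＋∣≡ b∉ a∉) (sym e))) (head-≼ w X₁ R₀ (trans e (∣＋∣≡ a∉ x∉)))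
      ... | one z z∉ refl (inj₂ b<z) _ = inj₁ (suc z , inj₂ (s≤s b<z) , there z∉ , X₁)
      ... | skip s s∈ refl b<s s<x = ⊥-elim (ws< w X₀ A₁ (s≤s (ℕ.≤-reflexive e))
              (s≤s z≤n) (s≤s b<s) (here , here)
              (there (oth (<⇒≢ b<s) (in＋ {a = x} (∈＋ K b))) , there (oth (>⇒≢ a<b) b∉))
              (there (in＋ s∈) , there (∉－ (K ＋ b ＋ x) s)))
      ... | one z z∉ refl (inj₁ refl) _ with mark-lower m X₁ X₀ (b , ∈＋ K b)
      ... | c , c∈ , L₁ with c ≟ b
      ... | yes refl = inj₂ (inj₁ (∋-subst (cong (true ∷_) (＋－ b∉)) L₁))
      ... | no c≢b with <-cmp c b
      ... | tri≈ _ c≡b _ = ⊥-elim (c≢b c≡b)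
      ... | tri> _ _ b<c = ⊥-elim (ws< w′ (shrink₁ L₁) (shrink₁ A₁) (ℕ.≤-reflexive (trans (∣＋－∣ b∉ (unoth c≢b c∈)) (sym (∣＋∣ a∉)))) a<b b<c
              (∈＋ K a , out－ (oth (<⇒≢ a<b) a∉))
              (oth (<⇒≢ b<c) (∈＋ K b) , oth (>⇒≢ a<b) b∉)
              (in＋ (unoth c≢b c∈) , ∉－ (K ＋ b) c))
      ... | tri< c<b _ _ = ⊥-elim (ws= w L₁ R₀ (trans (∣＋－∣ b∉ (unoth c≢b c∈)) (sym (∣＋∣ x∉)))
              (s≤s z≤n) (s≤s c<b) (s≤s b<x) (here , here)
              (there (in＋ (unoth c≢b c∈)) , there (∉－ (K ＋ b) c))
              (there (oth (>⇒≢ c<b) (∈＋ K b)) , there (oth (<⇒≢ b<x) b∉))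
              (there (∈＋ K x) , there (out－ (oth (>⇒≢ b<x) x∉))))
      outer-true A₁ B₁ (inj₂ (inj₁ K∈)) | _ with shrink⁻ K∈
      ... | inj₁ K₁ = inj₂ (inj₁ K₁)
      ... | inj₂ K₀ with mark m K
      ... | Y , eY , Y₁ , Y₀ with differ Y K eY
      ... | inj₁ refl = inj₂ (inj₁ Y₁)
      ... | inj₂ ((y , y∈ , y∉) , (k , k∈ , k∉)) = ⊥-elim bad
        where
        y<k : y < k
        y<k = head-≼ w Y₁ K₀ eY (y∈ , y∉) (k∈ , k∉)
        hit : ∀ {d} → d ∉ K → D ∋ true ∷ (K ＋ d) → y ≢ d → ⊥
        hit {d} d∉ Z₁ y≢d = ws< w Y₀ Z₁ (s≤s (ℕ.≤-trans (ℕ.≤-reflexive eY) (ℕ.≤-trans (ℕ.n≤1+n _) (ℕ.≤-reflexive (sym (∣＋∣ d∉))))))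
          (s≤s z≤n) (s≤s y<k) (here , here) (there y∈ , there (oth y≢d y∉)) (there (in＋ k∈) , there k∉)
        bad : ⊥
        bad with y ≟ a
        ... | no ne = hit a∉ A₁ ne
        ... | yes refl = hit b∉ B₁ (<⇒≢ a<b)
      outer-true A₁ B₁ (inj₂ (inj₂ (c , a<c , c<b , c∈ , R∈))) | X , e , X₁ , X₀ with shrink⁻ R∈
      ... | inj₁ R₁ = inj₂ (inj₂ (suc c , s≤s a<c , s≤s c<b , there c∈ , R₁))
      ... | inj₂ R₀ with between {S = K ＋ b － c} {Z = X} (∉－ (K ＋ b) c) (oth (∉∈⇒≢ a∉ c∈) (oth (<⇒≢ a<b) a∉))
                           (trans e (trans (∣＋∣≡ a∉ b∉) (sym (∣－∣ (in＋ c∈)))))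
                           (subst (_≼ X) (sym (－＋ (in＋ c∈))) (head-≼ w B₁ X₀ (trans (∣＋∣≡ b∉ a∉) (sym e))))
                           (head-≼ w X₁ (∋-subst (cong (false ∷_) (sym (exch-a c∈))) R₀)
                              (trans e (trans (∣＋∣≡ a∉ b∉) (trans (sym (∣－∣ (in＋ c∈))) (sym (∣＋∣ (oth (∉∈⇒≢ a∉ c∈) (oth (<⇒≢ a<b) a∉))))))))
      ... | one _ _ _ lo hi = ⊥-elim (≤′≤′-absurd lo hi a<c)
      ... | skip _ _ _ lo hi = ⊥-elim (<-asym (<-trans lo hi) a<c)

  outer : ∀ n {D : Coll n} → Max D → ∀ {K a b} → a ∉ K → b ∉ K → a < b → D ∋ K ＋ a → D ∋ K ＋ b → Outer D K a b
  outer (suc n) m {false ∷ K} {zero} {suc b} here (there b∉) _ A B = OuterStep.outer-zero m b∉ A B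
  outer (suc n) m {false ∷ K} {suc a} {suc b} (there a∉) (there b∉) (s≤s l) A B =
    OuterStep.outer-false m a∉ b∉ l A B (outer n (Max-shrink m) a∉ b∉ l (shrink₀ A) (shrink₀ B))
  outer (suc n) m {true ∷ K} {suc a} {suc b} (there a∉) (there b∉) (s≤s l) A B =
    OuterStep.outer-true m a∉ b∉ l A B (outer n (Max-shrink m) a∉ b∉ l (shrink₁ A) (shrink₁ B))

open OuterSides

-- From a set containing 010 to a hexagon on the levels `h` and `h + 1`.

module Hexagons where

  private variable
    n : ℕ
    Z : Subset n

  largest : {P : Fin n → Set} (P? : ∀ x → P x ⊎ ¬ P x) → ∃ P → ∃[ x ] P x × (∀ {y} → x < y → P y → ⊥)
  largest {suc n} {P} P? (x₀ , p₀) with find (λ x → P? (suc x))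
  ... | inj₁ w with largest (λ x → P? (suc x)) w
  ... | x , p , f = suc x , p , λ { {suc y} (s≤s l) q → f l q }
  largest {suc n} {P} P? (zero , p₀) | inj₂ f = zero , p₀ , λ { {suc y} _ q → f y q }
  largest {suc n} {P} P? (suc x , p₀) | inj₂ f = ⊥-elim (f x p₀)

  ∋⊎ : (D : Coll n) (S : Subset n) → D ∋ S ⊎ ¬ (D ∋ S)
  ∋⊎ D S = [ inj₁ , (λ q → inj₂ (flip ∌ q)) ]′ (∋? D S)

  No010 : Subset n → Set
  No010 Z = ∀ {p q r} → p < q → q < r → p ∉ Z → q ∈ Z → r ∉ Z → ⊥

  -- The missing corner is `K ＋ i ＋ k`. After complementation, with the head as fourth element,
  -- `K ＋ j` becomes the set to be exchanged, the missing corner its replacement, and the other four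
  -- sets the frame of the flip.
  record Hex {n} (D : Coll n) (h : ℕ) : Set where
    constructor hex
    field
      K : Subset n
      i j k : Fin n
      i<j : i < j
      j<k : j < k
      i∉ : i ∉ K
      j∉ : j ∉ K
      k∉ : k ∉ K
      size : suc ∣ K ∣ ≡ h
      Ki : D ∋ K ＋ i
      Kj : D ∋ K ＋ j
      Kk : D ∋ K ＋ k
      Kij : D ∋ K ＋ i ＋ j
      Kjk : D ∋ K ＋ j ＋ k

  module Hexagon {n : ℕ} {D : Coll n} (m : Max D) (h : ℕ) (low : ∀ {Z : Subset n} → D ∋ Z → ∣ Z ∣ ℕ.< h → No010 Z) where
    private
      w = ws m

      label? : ∀ S x → (x ∉ S × D ∋ S ＋ x) ⊎ ¬ (x ∉ S × D ∋ S ＋ x)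
      label? S x = ∉⊎ x S ∧? ∋⊎ D (S ＋ x)

      drop? : ∀ S k c → (c < k × c ∈ S × D ∋ S ＋ k － c) ⊎ ¬ (c < k × c ∈ S × D ∋ S ＋ k － c)
      drop? S k c = <⊎ c k ∧? (∈⊎ c S ∧? ∋⊎ D (S ＋ k － c))

    -- If the last upper neighbour S + k′ of S = K + j does not close the hexagon, then outer, applied to the two
    -- lower neighbours S and S + k′ - e of S + k′, yields the same configuration with j replaced by k′ > e.
    from-config : ∀ f {K i j k} → wt (K ＋ j) ℕ.< f → i < j → j < k → i ∉ K → j ∉ K → k ∉ K → suc ∣ K ∣ ≡ h →
                  D ∋ K ＋ i → D ∋ K ＋ j → D ∋ K ＋ k → D ∋ K ＋ i ＋ j → Hex D h
    from-config (suc f) {K} {i} {j} {k} (s≤s fuel) i<j j<k i∉ j∉ k∉ sz Ki Kj Kk Kij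
      with largest (label? (K ＋ j)) (i , oth (<⇒≢ i<j) i∉ , ∋-subst (upd-comm (<⇒≢ i<j)) Kij)
    ... | k′ , (k′∉S , T∈) , k′max with <-cmp k′ k
    ... | tri≈ _ refl _ = hex K i j k i<j j<k i∉ j∉ k∉ sz Ki Kj Kk Kij T∈
    ... | tri> _ _ k<k′ = ⊥-elim (ws< w Kk T∈ (ℕ.≤-reflexive (trans (cong suc (trans (∣＋∣ k∉) (sym (∣＋∣ j∉)))) (sym (∣＋∣ k′∉S))))
          j<k k<k′ (in＋ (∈＋ K j) , oth (<⇒≢ j<k) j∉) (∈＋ K k , oth (<⇒≢ k<k′) (oth (>⇒≢ j<k) k∉))
          (∈＋ (K ＋ j) k′ , oth (>⇒≢ k<k′) (out＋⁻ k′∉S)))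
    ... | tri< k′<k _ _ with next n m k′∉S Kj T∈ (inj₁ (k , k′<k , oth (>⇒≢ j<k) k∉))
    ... | inj₁ (x , k′<x , x∉ , R∈) = ⊥-elim (k′max k′<x (x∉ , R∈))
    -- Taking `e` largest excludes the alternative of `outer` that drops an element between `e` and
    -- `k′`.
    ... | inj₂ d with largest (drop? (K ＋ j) k′) d
    ... | e , (e<k′ , e∈S , S₊∈) , emax with e ≟ j
    ... | yes refl = hex K i j k′ i<j e<k′ i∉ j∉ (out＋⁻ k′∉S) sz Ki Kj
          (∋-subst (trans (upd-comm (>⇒≢ e<k′)) (cong (_＋ k′) (＋－ j∉))) S₊∈) Kij T∈
    ... | no e≢j = result
      where
      S = K ＋ j
      K₂ = S － e
      k′∉K = out＋⁻ k′∉S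
      e∈K = unoth e≢j e∈S
      k′≢j = ∉∈⇒≢ k′∉S (∈＋ K j)
      j∈S₊ : ∀ {x} → j ∈ K₂ ＋ x
      j∈S₊ = in＋ (oth (e≢j ∘ sym) (∈＋ K j))
      sz₂ : ∣ K₂ ∣ ≡ ∣ K ∣
      sz₂ = ∣exch∣ j∉ e∈K
      K₂＋e : K₂ ＋ e ≡ S
      K₂＋e = －＋ e∈S
      k∉K₂ : k ∉ K₂
      k∉K₂ = out－ (oth (>⇒≢ j<k) k∉)
      k′∉K₂ : k′ ∉ K₂
      k′∉K₂ = out－ k′∉S
      K₂k′ : D ∋ K₂ ＋ k′
      K₂k′ = ∋-subst (upd-comm (>⇒≢ e<k′)) S₊∈
      e<j : e < j
      e<j with <-cmp e j
      ... | tri< l _ _ = l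
      ... | tri≈ _ e≡j _ = ⊥-elim (e≢j e≡j)
      ... | tri> _ _ j<e = ⊥-elim (ws= w K₂k′ Kk (trans (∣＋∣ k′∉K₂) (trans (cong suc sz₂) (sym (∣＋∣ k∉))))
            j<e e<k′ k′<k
            (j∈S₊ , oth (<⇒≢ j<k) j∉)
            (in＋ e∈K , oth (<⇒≢ e<k′) (∉－ S e))
            (∈＋ K₂ k′ , oth (<⇒≢ k′<k) k′∉K)
            (∈＋ K k , oth (>⇒≢ k′<k) k∉K₂))
      result : Hex D h
      result with outer n m (∉－ S e) k′∉K₂ e<k′ (∋-subst (sym K₂＋e) Kj) K₂k′
      ... | inj₂ (inj₁ K₂∈) = ⊥-elim (low K₂∈ (ℕ.≤-reflexive (trans (cong suc sz₂) sz)) e<j j<k (∉－ S e) (oth (e≢j ∘ sym) (∈＋ K j)) k∉K₂)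
      ... | inj₂ (inj₂ (c , e<c , c<k′ , c∈ , R∈)) = ⊥-elim (emax e<c (c<k′ , in－⁻ c∈ , ∋-subst (cong (λ V → V ＋ k′ － c) K₂＋e) R∈))
      ... | inj₁ (x , inj₂ k′<x , x∉ , R∈) = from-config f
              (ℕ.≤-trans (subst (λ V → wt (K₂ ＋ k′) ℕ.< wt V) K₂＋e (wt-shift (∉－ S e) k′∉K₂ e<k′)) fuel)
              e<k′ k′<x (∉－ S e) k′∉K₂ x∉ (trans (cong suc sz₂) sz)
              (∋-subst (sym K₂＋e) Kj) K₂k′ R∈ (∋-subst (cong (_＋ k′) (sym K₂＋e)) T∈)
      ... | inj₁ (x , inj₁ x<e , x∉ , R∈) = ⊥-elim (ws= w R∈ Kk (trans (∣＋∣ x∉) (trans (cong suc sz₂) (sym (∣＋∣ k∉))))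
              x<e e<j j<k
              (∈＋ K₂ x , oth (<⇒≢ (<-trans x<e (<-trans e<j j<k))) (out＋⁻ (unoth (<⇒≢ x<e) x∉)))
              (in＋ e∈K , oth (>⇒≢ x<e) (∉－ S e))
              (j∈S₊ , oth (<⇒≢ j<k) j∉)
              (∈＋ K k , oth (>⇒≢ (<-trans x<e (<-trans e<j j<k))) k∉K₂))

    -- Against sets of at least its size, a violation would put 010 into `Z`; against smaller sets,
    -- it would put 010 into a set covered by `low`.
    coint-∋ : No010 Z → ∣ Z ∣ ≡ h → D ∋ Z
    coint-∋ co e = Max-complete m record
      { fit-<  = λ _ _ pq qr p q r → co pq qr (proj₂ p) (proj₁ q) (proj₂ r)
      ; fit->  = λ Y∈ l pq qr p q r → low Y∈ (ℕ.≤-trans l (ℕ.≤-reflexive e)) pq qr (proj₂ p) (proj₁ q) (proj₂ r)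
      ; fit-=  = λ _ _ _ qr rs _ q r s → co qr rs (proj₂ q) (proj₁ r) (proj₂ s)
      ; fit-=′ = λ _ _ pq qr _ p q r _ → co pq qr (proj₂ p) (proj₁ q) (proj₂ r) }

    module _ {Y : Subset n} (Y∈ : D ∋ Y) (szY : ∣ Y ∣ ≡ h) {a₀ b₀ c₀ : Fin n} (a<b : a₀ < b₀) (b<c : b₀ < c₀)
             (a∉ : a₀ ∉ Y) (b∈ : b₀ ∈ Y) (c∉ : c₀ ∉ Y) (first : ∀ {x : Fin n} → x < a₀ → x ∈ Y) where

      private
        -- Here `T` consists of everything up to `a₀` and everything from `k′` on. The pattern at
        -- `b₀` and `c₀` keeps `Y` from being `T － a₀`, so counting yields `t` in `T` after `a₀`
        -- outside `Y` and `y` of `Y` in the gap before `k′`; then `T` surrounds `y` by `a₀` and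
        -- `t`.
        blocked : ∀ {S k′} → No010 S → ∣ S ∣ ≡ h → k′ ∉ S → D ∋ S ＋ k′ → a₀ ∈ S → a₀ < k′ →
                  (∀ {x} → k′ < x → x ∈ S) → (∀ {x} → a₀ < x → x < k′ → x ∉ S) → ⊥
        blocked {S} {k′} co sz k′∉ T∈ a∈ a<k′ hi mid = bad
          where
          T = S ＋ k′
          lo : ∀ {x} → x < a₀ → x ∈ S
          lo {x} l with ∈? x S
          ... | inj₁ p = p
          ... | inj₂ q = ⊥-elim (co l a<k′ q a∈ k′∉)
          above : ∀ {x} → x ∈ T → a₀ < x → k′ ≤′ x
          above {x} p l with <-cmp k′ x
          ... | tri< l′ _ _ = inj₂ l′
          ... | tri≈ _ e _ = inj₁ e
          ... | tri> _ ne l′ = ⊥-elim (clash (unoth (ne ∘ sym) p) (mid l l′))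
          szT : suc ∣ T － a₀ ∣ ≡ suc h
          szT = trans (∣－∣ (in＋ a∈)) (trans (∣＋∣ k′∉) (cong suc sz))
          bad : ⊥
          bad with ⊑? (T － a₀) Y
          ... | inj₁ sub = clash (subst (c₀ ∈_) eq c∈) c∉
            where
            eq : T － a₀ ≡ Y
            eq = ⊑-full sub (ℕ.≤-reflexive (trans szY (sym (ℕ.suc-injective szT))))
            k<c : k′ < c₀
            k<c with above (in－⁻ (subst (b₀ ∈_) (sym eq) b∈)) a<b
            ... | inj₁ refl = b<c
            ... | inj₂ l = <-trans l b<c
            c∈ : c₀ ∈ T － a₀
            c∈ = oth (>⇒≢ (<-trans a<b b<c)) (in＋ (hi k<c))
          ... | inj₂ (t , t∈ , t∉) with <-cmp t a₀ | ⊑? Y T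
          ... | tri< l _ _ | _ = clash (first l) t∉
          ... | tri≈ _ refl _ | _ = clash t∈ (∉－ T t)
          ... | tri> _ _ a<t | inj₁ sub = ℕ.<-irrefl refl (ℕ.≤-trans (ℕ.≤-reflexive (trans (∣－∣ t∈) (trans (ℕ.suc-injective szT) (sym szY)))) (⊑-size sub′))
            where
            sub′ : Y ⊑ T － a₀ － t
            sub′ p = oth (∈∉⇒≢ p t∉) (oth (∈∉⇒≢ p a∉) (sub p))
          ... | tri> _ _ a<t | inj₂ (y , y∈ , y∉) with <-cmp y a₀ | <-cmp y k′
          ... | tri< l _ _ | _ = clash (in＋ (lo l)) y∉
          ... | tri≈ _ refl _ | _ = clash y∈ a∉
          ... | tri> _ _ _ | tri≈ _ refl _ = clash (∈＋ S k′) y∉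
          ... | tri> _ _ _ | tri> _ _ l = clash (in＋ (hi l)) y∉
          ... | tri> _ _ a<y | tri< y<k _ _ = ws< w Y∈ T∈ (ℕ.≤-reflexive (trans (cong suc (trans szY (sym sz))) (sym (∣＋∣ k′∉)))) a<y y<t
                (in＋ a∈ , a∉) (y∈ , y∉) (in－⁻ t∈ , t∉)
            where
            y<t : y < t
            y<t with above (in－⁻ t∈) a<t
            ... | inj₁ refl = y<k
            ... | inj₂ l = <-trans y<k l

        -- A walk through co-intervals of size `h` that contain `a₀`. If something is missing after
        -- the largest label `k′`, a hexagon can be started here; if not, exchanging the last
        -- element before `k′` for `k′` gives another co-interval of smaller weight. The walk could
        -- get stuck only when that element is `a₀`, which `blocked` excludes.
        from-coint : ∀ f {S a} → wt S ℕ.< f → No010 S → ∣ S ∣ ≡ h → D ∋ S → a ∉ S → D ∋ S ＋ a → a₀ ∈ S → a₀ < a → Hex D h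
        from-coint (suc f) {S} {a} (s≤s fuel) co sz S∈ a∉S Sa∈ a₀∈ a₀<a with largest (label? S) (a , a∉S , Sa∈)
        ... | k′ , (k′∉ , T∈) , k′max = go (find λ g → <⊎ k′ g ∧? ∉⊎ g S)
          where
          a₀<k′ : a₀ < k′
          a₀<k′ with <-cmp k′ a
          ... | tri< l _ _ = ⊥-elim (k′max l (a∉S , Sa∈))
          ... | tri≈ _ refl _ = a₀<a
          ... | tri> _ _ l = <-trans a₀<a l

          gap : ∃[ g ] (k′ < g × g ∉ S) → Hex D h
          gap g₀ with largest (λ g → <⊎ k′ g ∧? ∉⊎ g S) g₀ | next n m k′∉ S∈ T∈ (inj₁ g₀)
          ... | _ | inj₁ (x , k′<x , x∉ , R∈) = ⊥-elim (k′max k′<x (x∉ , R∈))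
          ... | g , (k′<g , g∉) , gmax | inj₂ d with largest (drop? S k′) d
          -- An element of `S` between `e` and `k′` puts 010 into `S － e`, which is then not in `D`,
          -- so `outer` must supply a third label. Without such an element, moving `e` to the last
          -- missing position `g` leaves a co-interval, and `coint-∋` supplies that label.
          ... | e , (e<k′ , e∈ , S₊∈) , emax with find (λ p → <⊎ e p ∧? (<⊎ p k′ ∧? ∈⊎ p S))
          ... | inj₁ (p , e<p , p<k′ , p∈) = res
            where
            K = S － e
            Ke : D ∋ K ＋ e
            Ke = ∋-subst (sym (－＋ e∈)) S∈
            Kk : D ∋ K ＋ k′
            Kk = ∋-subst (upd-comm (>⇒≢ e<k′)) S₊∈
            szK : suc ∣ K ∣ ≡ h
            szK = trans (∣－∣ e∈) sz
            res : Hex D h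
            res with outer n m (∉－ S e) (out－ k′∉) e<k′ Ke Kk
            ... | inj₂ (inj₁ K∈) = ⊥-elim (low K∈ (ℕ.≤-reflexive szK) e<p p<k′ (∉－ S e) (oth (>⇒≢ e<p) p∈) (out－ k′∉))
            ... | inj₂ (inj₂ (c , e<c , c<k′ , c∈ , R∈)) = ⊥-elim (emax e<c (c<k′ , in－⁻ c∈ , ∋-subst (cong (λ V → V ＋ k′ － c) (－＋ e∈)) R∈))
            ... | inj₁ (x , inj₁ x<e , x∉ , R∈) = ⊥-elim (co x<e e<k′ (unoth (<⇒≢ x<e) x∉) e∈ k′∉)
            ... | inj₁ (x , inj₂ k′<x , x∉ , R∈) = from-config _ ℕ.≤-refl e<k′ k′<x (∉－ S e) (out－ k′∉) x∉ szK Ke Kk R∈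
                    (∋-subst (cong (_＋ k′) (sym (－＋ e∈))) T∈)
          ... | inj₂ none = from-config _ ℕ.≤-refl e<k′ k′<g (∉－ S e) (out－ k′∉) (out－ g∉) (trans (∣－∣ e∈) sz)
                  (∋-subst (sym (－＋ e∈)) S∈) (∋-subst (upd-comm (>⇒≢ e<k′)) S₊∈)
                  (coint-∋ co′ (trans (∣＋∣ (out－ g∉)) (trans (∣－∣ e∈) sz)))
                  (∋-subst (cong (_＋ k′) (sym (－＋ e∈))) T∈)
            where
            co′ : No010 (S － e ＋ g)
            co′ {u} {v} {t} u<v v<t u∉ v∈ t∉ with in＋⁻ v∈
            ... | inj₁ refl = gmax v<t (<-trans k′<g v<t , unoth (>⇒≢ (<-trans e<k′ (<-trans k′<g v<t))) (out＋⁻ t∉))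
            ... | inj₂ v∈K with t ≟ e | u ≟ e
            ... | yes refl | _ = co u<v (<-trans v<t e<k′) (unoth (<⇒≢ (<-trans u<v v<t)) (out＋⁻ u∉)) (in－⁻ v∈K) k′∉
            ... | no t≢e | no u≢e = co u<v v<t (unoth u≢e (out＋⁻ u∉)) (in－⁻ v∈K) (unoth t≢e (out＋⁻ t∉))
            ... | no t≢e | yes refl with <-cmp v k′
            ... | tri< l _ _ = none v (u<v , l , in－⁻ v∈K)
            ... | tri≈ _ refl _ = clash (in－⁻ v∈K) k′∉
            ... | tri> _ _ l = co l v<t k′∉ (in－⁻ v∈K) (unoth t≢e (out＋⁻ t∉))

          full : (∀ g → ¬ (k′ < g × g ∉ S)) → Hex D h
          full nog with largest (λ p → <⊎ p k′ ∧? ∈⊎ p S) (a₀ , a₀<k′ , a₀∈)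
          ... | p , (p<k′ , p∈) , pmax = res (<-cmp a₀ p)
            where
            hi : ∀ {x} → k′ < x → x ∈ S
            hi {x} l = ¬∉⇒∈ λ q → nog x (l , q)
            mid : ∀ {x} → p < x → x < k′ → x ∉ S
            mid l l′ = ¬∈⇒∉ λ q → pmax l (l′ , q)
            T = S ＋ k′
            co₂ : No010 (T － p)
            co₂ {u} {v} {t} u<v v<t u∉ v∈ t∉ with t ≟ p
            ... | yes refl = co u<v (<-trans v<t p<k′) (out＋⁻ (unoth (<⇒≢ (<-trans u<v v<t)) u∉))
                               (unoth (<⇒≢ (<-trans v<t p<k′)) (in－⁻ v∈)) k′∉
            ... | no t≢p = fin
              where
              t∉T = unoth t≢p t∉
              t<k : t < k′
              t<k with <-cmp t k′
              ... | tri< l _ _ = l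
              ... | tri≈ _ refl _ = ⊥-elim (clash (∈＋ S k′) t∉T)
              ... | tri> _ _ l = ⊥-elim (clash (in＋ (hi l)) t∉T)
              v∈S : v ∈ S
              v∈S = unoth (<⇒≢ (<-trans v<t t<k)) (in－⁻ v∈)
              fin : ⊥
              fin with u ≟ p
              ... | yes refl = clash v∈S (mid u<v (<-trans v<t t<k))
              ... | no u≢p = co u<v v<t (out＋⁻ (unoth u≢p u∉)) v∈S (out＋⁻ t∉T)
            res : _ → Hex D h
            res (tri≈ _ refl _) = ⊥-elim (blocked co sz k′∉ T∈ a₀∈ a₀<k′ hi mid)
            res (tri> _ _ p<a) = ⊥-elim (pmax p<a (a₀<k′ , a₀∈))
            res (tri< a₀<p _ _) = from-coint f (ℕ.≤-trans (wt-move p∈ k′∉ p<k′) fuel) co₂ sz₂ (coint-∋ co₂ sz₂)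
                (∉－ T p) (∋-subst (sym (－＋ (in＋ p∈))) T∈) (oth (<⇒≢ a₀<p) (in＋ a₀∈)) a₀<p
              where
              sz₂ = trans (∣exch∣ k′∉ p∈) sz

          go : ∃[ g ] (k′ < g × g ∉ S) ⊎ (∀ g → ¬ (k′ < g × g ∉ S)) → Hex D h
          go (inj₁ g₀) = gap g₀
          go (inj₂ nog) = full nog

      hexagon : Hex D h
      hexagon with initial-step h (ℕ.≤-trans (ℕ.≤-reflexive (trans (cong suc (sym szY)) (sym (∣＋∣ a∉)))) (∣p∣≤n (Y ＋ a₀)))
      ... | U , a , a∉U , sz , f , g = from-coint _ ℕ.≤-refl (λ pq _ p q _ → <-asym pq (f q p)) sz
              (initial-∋ m f) a∉U (initial-∋ m g) a₀∈ (f a₀∈ a∉U)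
        where
        a₀∈ : a₀ ∈ U
        a₀∈ with ∈? a₀ U
        ... | inj₁ p = p
        -- An initial segment without `a₀` would be contained in `Y`, hence equal to it by size,
        -- although `Y` contains `b₀` after `a₀`.
        ... | inj₂ q = ⊥-elim (<-asym a<b (f (subst (b₀ ∈_) (sym eq) b∈) q))
          where
          eq : U ≡ Y
          eq = ⊑-full (λ p → first (f p q)) (ℕ.≤-reflexive (trans szY (sym sz)))

open Hexagons

-- Pattern avoidance and the completion of a level to a maximum collection.

module Patterns where

  private variable
    n N h k : ℕ
    c : Bool
    S T : Subset n

  -- avoids c k S: there are no k positions of S, from left to right, carrying the alternating bits c, not c, c, …
  avoids : Bool → ℕ → Coll n
  avoids c zero    S       = false
  avoids c (suc k) []      = true
  avoids c (suc k) (b ∷ S) = if does (b ≟ᵇ c) then avoids (not c) k S else avoids c (suc k) S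

  data Chain {n} (S : Subset n) : Bool → ℕ → Fin n → Set where
    end  : ∀ {p} → S [ p ]= c → Chain S c 1 p
    step : ∀ {p q} → S [ p ]= c → p < q → Chain S (not c) k q → Chain S c (suc k) p

  private
    chain-tail : ∀ {b p} → Chain (b ∷ S) c k (suc p) → Chain S c k p
    chain-tail (end (there x)) = end x
    chain-tail (step {q = suc q} (there x) (s≤s l) ch) = step x l (chain-tail ch)

    chain-∷ : ∀ {b p} → Chain S c k p → Chain (b ∷ S) c k (suc p)
    chain-∷ (end x) = end (there x)
    chain-∷ (step x l ch) = step (there x) (s≤s l) (chain-∷ ch)

  avoids-sound : ∀ c k {p} (S : Subset n) → avoids c k S ≡ true → Chain S c k p → ⊥
  avoids-sound c (suc k) {zero} (b ∷ S) e ch with b ≟ᵇ c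
  avoids-sound c (suc zero) {zero} (b ∷ S) () ch | yes refl
  avoids-sound c (suc (suc k)) {zero} (b ∷ S) e (step {q = suc q} here _ ch) | yes refl = avoids-sound (not c) (suc k) S e (chain-tail ch)
  avoids-sound c (suc k) {zero} (b ∷ S) e (end here) | no ne = ne refl
  avoids-sound c (suc k) {zero} (b ∷ S) e (step here _ _) | no ne = ne refl
  avoids-sound c (suc k) {suc p} (b ∷ S) e ch with b ≟ᵇ c
  avoids-sound c (suc k) {suc p} (b ∷ S) e ch | no _ = avoids-sound c (suc k) S e (chain-tail ch)
  avoids-sound c (suc (suc k)) {suc p} (b ∷ S) e ch | yes refl with chain-tail ch
  ... | step _ _ ch′ = avoids-sound (not c) (suc k) S e ch′

  avoids-complete : ∀ c k (S : Subset n) → avoids c (suc k) S ≡ false → ∃ (Chain S c (suc k))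
  avoids-complete c k (b ∷ S) e with b ≟ᵇ c
  avoids-complete c zero (b ∷ S) e | yes refl = zero , end here
  avoids-complete c (suc k) (b ∷ S) e | yes refl with avoids-complete (not c) k S e
  ... | p , ch = zero , step here (s≤s z≤n) (chain-∷ ch)
  avoids-complete c k (b ∷ S) e | no _ with avoids-complete c k S e
  ... | p , ch = suc p , chain-∷ ch

  avoids-suc : ∀ c k (S : Subset n) → avoids c k S ≡ true → avoids c (suc k) S ≡ true
  avoids-suc c (suc k) [] e = refl
  avoids-suc c (suc k) (b ∷ S) e with b ≟ᵇ c
  ... | yes _ = avoids-suc (not c) k S e
  ... | no _  = avoids-suc c (suc k) S e

  avoids-not : ∀ c k (S : Subset n) → avoids (not c) k S ≡ true → avoids c (suc k) S ≡ true
  avoids-not c (suc k) [] e = refl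
  avoids-not false (suc k) (true ∷ S) e = avoids-suc false (suc k) S (avoids-suc false k S e)
  avoids-not false (suc k) (false ∷ S) e = e
  avoids-not true (suc k) (true ∷ S) e = e
  avoids-not true (suc k) (false ∷ S) e = avoids-suc true (suc k) S (avoids-suc true k S e)

  avoids-const : ∀ c k n → avoids (not c) (suc k) (replicate n c) ≡ true
  avoids-const c     k zero = refl
  avoids-const true  k (suc n) = avoids-const true k n
  avoids-const false k (suc n) = avoids-const false k n

  -- The patterns 010, 101 and 0101; as words, co-intervals are 1*0*1*, intervals are 0*1*0* and
  -- members of IS are 1*0*1*0*.
  coint interval isᵇ : Coll n
  coint    = avoids false 3
  interval = avoids true 3
  isᵇ      = avoids false 4

  coint-no010 : coint S ≡ true → No010 S
  coint-no010 {S = S} e pq qr p q r = avoids-sound false 3 S e (step p pq (step q qr (end r)))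

  No101 : Subset n → Set
  No101 Z = ∀ {p q r} → p < q → q < r → p ∈ Z → q ∉ Z → r ∈ Z → ⊥

  interval-no101 : interval S ≡ true → No101 S
  interval-no101 {S = S} e pq qr p q r = avoids-sound true 3 S e (step p pq (step q qr (end r)))

  is-no0101 : isᵇ S ≡ true → ∀ {p q r s} → p < q → q < r → r < s → p ∉ S → q ∈ S → r ∉ S → s ∈ S → ⊥
  is-no0101 {S = S} e pq qr rs p q r s = avoids-sound false 4 S e (step p pq (step q qr (step r rs (end s))))

  bySize : Coll n → Coll n → Coll n → ℕ → Coll n
  bySize f g k h S with ℕ.<-cmp ∣ S ∣ h
  ... | tri< _ _ _ = f S
  ... | tri≈ _ _ _ = g S
  ... | tri> _ _ _ = k S

  module _ (f g k : Coll n) (h : ℕ) where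
    bySize< : ∣ S ∣ ℕ.< h → f S ≡ true → bySize f g k h ∋ S
    bySize< {S} l e = mem lem
      where
      lem : bySize f g k h S ≡ true
      lem with ℕ.<-cmp ∣ S ∣ h
      ... | tri< _ _ _ = e
      ... | tri≈ ¬l _ _ = ⊥-elim (¬l l)
      ... | tri> ¬l _ _ = ⊥-elim (¬l l)

    bySize≡ : ∣ S ∣ ≡ h → g S ≡ true → bySize f g k h ∋ S
    bySize≡ {S} l e = mem lem
      where
      lem : bySize f g k h S ≡ true
      lem with ℕ.<-cmp ∣ S ∣ h
      ... | tri< _ ¬l _ = ⊥-elim (¬l l)
      ... | tri≈ _ _ _ = e
      ... | tri> _ ¬l _ = ⊥-elim (¬l l)

    bySize> : h ℕ.< ∣ S ∣ → k S ≡ true → bySize f g k h ∋ S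
    bySize> {S} l e = mem lem
      where
      lem : bySize f g k h S ≡ true
      lem with ℕ.<-cmp ∣ S ∣ h
      ... | tri< _ _ ¬l = ⊥-elim (¬l l)
      ... | tri≈ _ _ ¬l = ⊥-elim (¬l l)
      ... | tri> _ _ _ = e

    bySize⁻ : bySize f g k h ∋ S → (∣ S ∣ ℕ.< h × f S ≡ true) ⊎ (∣ S ∣ ≡ h × g S ≡ true) ⊎ (h ℕ.< ∣ S ∣ × k S ≡ true)
    bySize⁻ {S} (mem e) with ℕ.<-cmp ∣ S ∣ h
    ... | tri< l _ _ = inj₁ (l , e)
    ... | tri≈ _ l _ = inj₂ (inj₁ (l , e))
    ... | tri> _ _ l = inj₂ (inj₂ (l , e))

  final-of-size : ∀ k → k ℕ.≤ n → Σ[ F ∈ Subset n ] ∣ F ∣ ≡ k × avoids true 2 F ≡ true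
  final-of-size {zero} zero _ = [] , refl , refl
  final-of-size {suc n} k k≤n with ℕ.m≤n⇒m<n∨m≡n k≤n
  ... | inj₂ refl = replicate (suc n) true , ∣⊤∣≡n (suc n) , avoids-const true 0 n
  ... | inj₁ (s≤s l) with final-of-size {n} k l
  ... | F , e , p = false ∷ F , e , p

  initial-of-size : ∀ k → k ℕ.≤ n → Σ[ F ∈ Subset n ] ∣ F ∣ ≡ k × avoids false 2 F ≡ true
  initial-of-size {n} zero _ = replicate n false , ∣⊥∣≡0 n , avoids-not false 1 (replicate n false) (avoids-const false 0 n)
  initial-of-size {suc n} (suc k) (s≤s l) with initial-of-size {n} k l
  ... | F , e , p = true ∷ F , cong suc e , p

  empty-avoids : ∀ k (S : Subset n) → ∣ S ∣ ≡ 0 → avoids true (suc k) S ≡ true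
  empty-avoids k [] e = refl
  empty-avoids k (false ∷ S) e = empty-avoids k S e

  -- The tails of IS completed to all sizes; this collection attains the bound M.
  base : ℕ → Coll n
  base = bySize coint isᵇ interval

  -- A leading 1 does not affect patterns that begin with 0, and a leading 0 turns avoidance of 0101
  -- into avoidance of 101 for the tail. Hence the intervals of size `h + 1` fit into the middle
  -- level of `base (suc h)`.
  base-⊆-shrink : ∀ h {S : Subset n} → base h ∋ S → shrink (base (suc h)) ∋ S
  base-⊆-shrink h {S} p with bySize⁻ coint isᵇ interval h p
  ... | inj₁ (l , e) = shrink₁ (bySize< coint isᵇ interval (suc h) {true ∷ S} (s≤s l) e)
  ... | inj₂ (inj₁ (l , e)) = shrink₁ (bySize≡ coint isᵇ interval (suc h) {true ∷ S} (cong suc l) e)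
  ... | inj₂ (inj₂ (l , e)) with ℕ.m≤n⇒m<n∨m≡n l
  ... | inj₁ l′ = shrink₀ (bySize> coint isᵇ interval (suc h) {false ∷ S} l′ e)
  ... | inj₂ l′ = shrink₀ (bySize≡ coint isᵇ interval (suc h) {false ∷ S} (sym l′) e)

  base0-⊆-shrink : {S : Subset n} → base 0 ∋ S → shrink (base 0) ∋ S
  base0-⊆-shrink {S = S} p with bySize⁻ coint isᵇ interval 0 p
  ... | inj₂ (inj₁ (l , e)) = shrink₀ (bySize≡ coint isᵇ interval 0 {false ∷ S} l (empty-avoids 2 S l))
  ... | inj₂ (inj₂ (l , e)) = shrink₀ (bySize> coint isᵇ interval 0 {false ∷ S} l e)

  -- Final segments serve below the middle level and initial segments from it on: with either bit in
  -- front they stay in the class prescribed for the resulting size.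
  base-common : ∀ h k → k ℕ.≤ n → ∃[ F ] ∣ F ∣ ≡ k × common {n} (base h) ∋ F
  base-common {n} h k k≤n with ℕ.<-cmp k h
  ... | tri< k<h _ _ with final-of-size {n} k k≤n
  ... | F , refl , p = F , refl , mem (cong₂ _∧_ (get up) (get (bySize< coint isᵇ interval h {false ∷ F} k<h p)))
    where
    up : base h ∋ true ∷ F
    up with ℕ.m≤n⇒m<n∨m≡n k<h
    ... | inj₁ l = bySize< coint isᵇ interval h {true ∷ F} l (avoids-not false 2 F p)
    ... | inj₂ l = bySize≡ coint isᵇ interval h {true ∷ F} l (avoids-suc false 3 F (avoids-not false 2 F p))
  base-common {n} h k k≤n | tri≈ _ refl _ with initial-of-size {n} k k≤n
  ... | F , refl , p = F , refl , mem (cong₂ _∧_ (get (bySize> coint isᵇ interval h {true ∷ F} ℕ.≤-refl p))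
                                                (get (bySize≡ coint isᵇ interval h {false ∷ F} refl (avoids-not true 2 F p))))
  base-common {n} h k k≤n | tri> _ _ h<k with initial-of-size {n} k k≤n
  ... | F , refl , p = F , refl , mem (cong₂ _∧_ (get (bySize> coint isᵇ interval h {true ∷ F} (ℕ.m≤n⇒m≤1+n h<k) p))
                                                (get (bySize> coint isᵇ interval h {false ∷ F} h<k (avoids-not true 2 F p))))

  base-card : ∀ n h → M n ℕ.≤ card {n} (base h)
  base-card zero zero = s≤s z≤n
  base-card zero (suc h) = s≤s z≤n
  base-card (suc n) h = subst (M (suc n) ℕ.≤_) (sym (card-∨∧ {n} (base h ∘ (true ∷_)) (base h ∘ (false ∷_))))
    (ℕ.+-mono-≤ (sub h) (card-perSize-≥ {n} (common (base h)) (base-common h)))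
    where
    sub : ∀ h → M n ℕ.≤ card (shrink {n} (base h))
    sub zero    = ℕ.≤-trans (base-card n 0) (card-mono {n} (base 0) (shrink (base 0)) base0-⊆-shrink)
    sub (suc h) = ℕ.≤-trans (base-card n h) (card-mono {n} (base h) (shrink (base (suc h))) (base-⊆-shrink h))

  record Level {n} (m : ℕ) (C : Coll n) : Set where
    field
      level-ws : WS C
      level-size : ∀ {S} → C ∋ S → ∣ S ∣ ≡ m
  open Level public

  IS : ℕ → Coll n
  IS m S = isᵇ S ∧ (∣ S ∣ ≡ᵇ m)

  IS⁻ : ∀ {m} {S : Subset n} → IS m ∋ S → isᵇ S ≡ true × ∣ S ∣ ≡ m
  IS⁻ {S = S} (mem p) = let e , s = ∧⁻ {isᵇ S} p in e , ≡ᵇ⁻ s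

  IS-level : ∀ m → Level {n} m (IS m)
  level-size (IS-level m) p = proj₂ (IS⁻ p)
  ws< (level-ws (IS-level m)) {X} {Y} x y l = ⊥-elim (ℕ.<-irrefl (trans (proj₂ (IS⁻ x)) (sym (proj₂ (IS⁻ y)))) l)
  ws= (level-ws (IS-level m)) {X} {Y} x y _ pq qr rs p q r s =
    is-no0101 {S = Y} (proj₁ (IS⁻ y)) pq qr rs (proj₂ p) (proj₁ q) (proj₂ r) (proj₁ s)

  -- The sizes `h` and `suc h` stay empty, as they are taken by the tails of `C`.
  fill : ℕ → Coll n
  fill h = bySize coint (const false) (bySize (const false) (const false) interval (suc h)) h

  fill⁻ : ∀ {h} {S : Subset n} → fill h ∋ S → (∣ S ∣ ℕ.< h × coint S ≡ true) ⊎ (suc h ℕ.< ∣ S ∣ × interval S ≡ true)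
  fill⁻ {h = h} {S} p with bySize⁻ coint (const false) (bySize (const false) (const false) interval (suc h)) h {S} p
  ... | inj₁ q = inj₁ q
  ... | inj₂ (inj₂ (_ , q)) with bySize⁻ (const false) (const false) interval (suc h) {S} (mem q)
  ... | inj₂ (inj₂ r) = inj₂ r

  fill-small : ∀ {h} (S : Subset n) → ∣ S ∣ ℕ.< h → coint S ≡ true → fill h ∋ S
  fill-small {h = h} S l e =
    bySize< coint (const false) (bySize (const false) (const false) interval (suc h)) h {S} l e

  fill-large : ∀ {h} (S : Subset n) → suc h ℕ.< ∣ S ∣ → interval S ≡ true → fill h ∋ S
  fill-large {h = h} S l e =
    bySize> coint (const false) (bySize (const false) (const false) interval (suc h)) h {S} (ℕ.<-trans ℕ.≤-refl l)
      (get (bySize> (const false) (const false) interval (suc h) {S} l e))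

  completion : ℕ → Coll (suc n) → Coll n
  completion h C S = fill h S ∨ shrink C S

  ∨⁻ : ∀ {u v} → u ∨ v ≡ true → u ≡ true ⊎ v ≡ true
  ∨⁻ {true} _ = inj₁ refl
  ∨⁻ {false} e = inj₂ e

  ∨⁺₁ : ∀ {u v} → u ≡ true → u ∨ v ≡ true
  ∨⁺₁ refl = refl

  ∨⁺₂ : ∀ {u v} → v ≡ true → u ∨ v ≡ true
  ∨⁺₂ {true} _ = refl
  ∨⁺₂ {false} e = e

  module Completion {N h : ℕ} (C : Coll (suc N)) (lv : Level (suc h) C) where

    data Kind (S : Subset N) : Set where
      small : ∣ S ∣ ℕ.< h → No010 S → Kind S
      low   : ∣ S ∣ ≡ h → C ∋ true ∷ S → Kind S
      high  : ∣ S ∣ ≡ suc h → C ∋ false ∷ S → Kind S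
      large : suc h ℕ.< ∣ S ∣ → No101 S → Kind S

    kind : ∀ {S} → completion h C ∋ S → Kind S
    kind {S} (mem p) with ∨⁻ {fill h S} p
    ... | inj₂ q with shrink⁻ {D = C} (mem q)
    ... | inj₁ r = low (ℕ.suc-injective (level-size lv r)) r
    ... | inj₂ r = high (level-size lv r) r
    kind {S} (mem p) | inj₁ q with fill⁻ {h = h} {S} (mem q)
    ... | inj₁ (l , e) = small l (coint-no010 {S = S} e)
    ... | inj₂ (l , e) = large l (interval-no101 {S = S} e)

    low∋ : ∀ {S} → C ∋ true ∷ S → completion h C ∋ S
    low∋ {S} p = mem (∨⁺₂ {fill h S} (get (shrink₁ p)))

    high∋ : ∀ {S} → C ∋ false ∷ S → completion h C ∋ S
    high∋ {S} p = mem (∨⁺₂ {fill h S} (get (shrink₀ p)))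

    private
      w = level-ws lv
      absurd : ∀ {i j k} → i ≡ k → j ≡ k → i ℕ.< j → ⊥
      absurd refl refl l = ℕ.<-irrefl refl l

    -- The two tail levels are compared through `C`, where the sets have equal size and the head
    -- begins the alternation. In every other possible violation an added set would contain its own
    -- forbidden pattern.
    completion-ws : WS (completion h C)
    ws< completion-ws x y l pq qr p q r with kind x | kind y
    ... | small _ f | _ = f pq qr (proj₂ p) (proj₁ q) (proj₂ r)
    ... | _ | large _ f = f pq qr (proj₁ p) (proj₂ q) (proj₁ r)
    ... | low e x′ | low e′ y′ = absurd e e′ l
    ... | high e x′ | high e′ y′ = absurd e e′ l
    ... | low e x′ | high e′ y′ = ws= w x′ y′ (trans (cong suc e) (sym e′)) (s≤s z≤n) (s≤s pq) (s≤s qr) (here , here)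
          (there (proj₁ p) , there (proj₂ p)) (there (proj₁ q) , there (proj₂ q)) (there (proj₁ r) , there (proj₂ r))
    ... | high e x′ | low e′ y′ = ℕ.<-asym l (ℕ.≤-reflexive (trans (cong suc e′) (sym e)))
    ... | low e _ | small l′ _ = ℕ.<-asym l (subst (_ ℕ.<_) (sym e) l′)
    ... | high e _ | small l′ _ = ℕ.<-asym l (subst (_ ℕ.<_) (sym e) (ℕ.m≤n⇒m≤1+n l′))
    ... | large l″ _ | small l′ _ = ℕ.<-asym l (ℕ.<-trans l′ (ℕ.<-trans ℕ.≤-refl l″))
    ... | large l″ _ | low e _ = ℕ.<-asym l (subst (ℕ._< _) (sym e) (ℕ.<-trans ℕ.≤-refl l″))
    ... | large l″ _ | high e _ = ℕ.<-asym l (subst (ℕ._< _) (sym e) l″)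
    ws= completion-ws {X} {Y} x y e pq qr rs p q r s with kind x | kind y
    ... | small _ f | _ = f qr rs (proj₂ q) (proj₁ r) (proj₂ s)
    ... | _ | small _ f = f pq qr (proj₂ p) (proj₁ q) (proj₂ r)
    ... | large _ f | _ = f pq qr (proj₁ p) (proj₂ q) (proj₁ r)
    ... | _ | large _ f = f qr rs (proj₁ q) (proj₂ r) (proj₁ s)
    ... | low _ x′ | low _ y′ = ws= w x′ y′ (cong suc e) (s≤s pq) (s≤s qr) (s≤s rs)
          (there (proj₁ p) , there (proj₂ p)) (there (proj₁ q) , there (proj₂ q)) (there (proj₁ r) , there (proj₂ r)) (there (proj₁ s) , there (proj₂ s))
    ... | high _ x′ | high _ y′ = ws= w x′ y′ e (s≤s pq) (s≤s qr) (s≤s rs)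
          (there (proj₁ p) , there (proj₂ p)) (there (proj₁ q) , there (proj₂ q)) (there (proj₁ r) , there (proj₂ r)) (there (proj₁ s) , there (proj₂ s))
    ... | low e₁ _ | high e₂ _ = ℕ.1+n≢n (trans (sym e₂) (trans (sym e) e₁))
    ... | high e₁ _ | low e₂ _ = ℕ.1+n≢n (trans (sym e₁) (trans e e₂))

    completion-card : card (completion h C) ≡ card (fill {N} h) + card C
    completion-card = trans (card-⊎ (fill h) (shrink C) disj)
      (cong (card {N} (fill h) +_) (trans (sym (ℕ.+-identityʳ _)) (trans (cong (card (shrink C) +_) (sym (card-∅ (common C) none)))
        (sym (card-shrink w)))))
      where
      disj : ∀ {S} → fill h ∋ S → shrink C ∋ S → ⊥
      disj p q with fill⁻ {h = h} p | shrink⁻ q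
      ... | inj₁ (l , _) | inj₁ r = ℕ.<-irrefl (ℕ.suc-injective (level-size lv r)) l
      ... | inj₁ (l , _) | inj₂ r = ℕ.<-irrefl (level-size lv r) (ℕ.m≤n⇒m≤1+n l)
      ... | inj₂ (l , _) | inj₁ r = ℕ.<-irrefl (sym (ℕ.suc-injective (level-size lv r))) (ℕ.<-trans ℕ.≤-refl l)
      ... | inj₂ (l , _) | inj₂ r = ℕ.<-irrefl (sym (level-size lv r)) l
      none : ∀ S → common C S ≡ false
      none S with common C S in eq
      ... | false = refl
      ... | true = let p , q = ∧⁻ {C (true ∷ S)} eq in
                   ⊥-elim (ℕ.1+n≢n (trans (level-size lv {true ∷ S} (mem p)) (sym (level-size lv {false ∷ S} (mem q)))))

  base-⊆-completion : ∀ h {S : Subset N} → base h ∋ S → completion h (IS (suc h)) ∋ S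
  base-⊆-completion h {S} p with bySize⁻ coint isᵇ interval h p
  ... | inj₁ (l , e) = mem (∨⁺₁ (get (fill-small {h = h} S l e)))
  ... | inj₂ (inj₁ (l , e)) = Completion.low∋ (IS (suc h)) (IS-level _) (mem (cong₂ _∧_ e (≡ᵇ⁺ l)))
  ... | inj₂ (inj₂ (l , e)) with ℕ.m≤n⇒m<n∨m≡n l
  ... | inj₁ l′ = mem (∨⁺₁ (get (fill-large {h = h} S l′ e)))
  ... | inj₂ l′ = Completion.high∋ (IS (suc h)) (IS-level _) (mem (cong₂ _∧_ e (≡ᵇ⁺ (sym l′))))

  completion-max : (C : Coll (suc N)) → Level (suc h) C → card (IS {suc N} (suc h)) ℕ.≤ card C → Max (completion h C)
  completion-max {N} {h} C lv big = mkMax (Completion.completion-ws C lv)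
    (ℕ.≤-trans (base-card N h)
    (ℕ.≤-trans (card-mono {N} (base h) (completion h (IS (suc h))) (base-⊆-completion h))
    (subst₂ ℕ._≤_ (sym (Completion.completion-card {N} (IS (suc h)) (IS-level _))) (sym (Completion.completion-card C lv))
      (ℕ.+-monoʳ-≤ (card {N} (fill h)) big))))

open Patterns

-- Existence of a lowering flip, by induction on the ground set.

module FlipExistence where

  private variable
    n N : ℕ

  record Flip {n} (C : Coll n) : Set where
    constructor mkFlip
    field
      i j k l : Fin n
      X : Subset n
      i<j : i < j
      j<k : j < k
      k<l : k < l
      i∉ : i ∉ X
      j∉ : j ∉ X
      k∉ : k ∉ X
      l∉ : l ∉ X
      Xij : C ∋ X ＋ i ＋ j
      Xkl : C ∋ X ＋ k ＋ l
      Xil : C ∋ X ＋ i ＋ l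
      Xjk : C ∋ X ＋ j ＋ k
      Xjl : C ∋ X ＋ j ＋ l

  first-missing : (S : Subset n) {p : Fin n} → p ∉ S → ∃[ a ] a ∉ S × (∀ {x} → x < a → x ∈ S) × a ≤′ p
  first-missing (false ∷ S) {zero}  _ = zero , here , (λ ()) , inj₁ refl
  first-missing (false ∷ S) {suc p} _ = zero , here , (λ ()) , inj₂ (s≤s z≤n)
  first-missing (true ∷ S) {suc p} (there q) with first-missing S q
  ... | a , a∉ , f , le = suc a , there a∉ , f′ , le′ le
    where
    f′ : ∀ {x} → x < suc a → x ∈ true ∷ S
    f′ {zero} _ = here
    f′ {suc x} (s≤s l) = there (f l)
    le′ : a ≤′ p → suc a ≤′ suc p
    le′ (inj₁ refl) = inj₁ refl
    le′ (inj₂ l) = inj₂ (s≤s l)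

  -- In the complement the 101 of `T` becomes 010, and the sets below the level of `∁ T` are
  -- complements of added intervals, as `Hexagon` demands. The lower corners of the hexagon come
  -- from sets of `C` without the head, the upper ones from sets with it.
  flip-at-head : ∀ {h} (C : Coll (suc N)) → Level (suc h) C → card (IS {suc N} (suc h)) ℕ.≤ card C →
                 ∀ {T p q r} → C ∋ false ∷ T → p < q → q < r → p ∈ T → q ∉ T → r ∈ T → Flip C
  flip-at-head {N} {h} C lv big {T} T∈ p<q q<r p∈ q∉ r∈ with first-missing (∁ T) (∁⁺ p∈)
  ... | a , a∉ , first , a≤p = build (hexagon Y∈ refl (a<q a≤p) q<r a∉ (∁⁺ q∉) (∁⁺ r∈) first)
    where
    open Completion C lv
    D = completion h C
    m = Max-∁ {D = D} (completion-max C lv big)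
    szT : ∣ T ∣ ≡ suc h
    szT = level-size lv T∈
    a<q : a ≤′ _ → a < _
    a<q (inj₁ refl) = p<q
    a<q (inj₂ l) = <-trans l p<q
    low-levels : ∀ {Z} → D ∘ ∁ ∋ Z → ∣ Z ∣ ℕ.< ∣ ∁ T ∣ → No010 Z
    low-levels {Z} (mem z) l = go (kind {∁ Z} (mem z))
      where
      big′ : suc h ℕ.< ∣ ∁ Z ∣
      big′ = subst (ℕ._< ∣ ∁ Z ∣) (trans (cong ∣_∣ (∁∁ T)) szT) (∣∁∣-< Z (∁ T) l)
      go : Kind (∁ Z) → No010 Z
      go (small l′ _) = ⊥-elim (ℕ.<-asym big′ (ℕ.m≤n⇒m≤1+n l′))
      go (low e _) = ⊥-elim (ℕ.<-asym big′ (ℕ.≤-reflexive (trans (cong suc e) refl)))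
      go (high e _) = ⊥-elim (ℕ.<-irrefl (sym e) big′)
      go (large _ f) pq qr p q r = f pq qr (∁⁺ p) (∁⁺ q) (∁⁺ r)
    open Hexagon {D = D ∘ ∁} m ∣ ∁ T ∣ low-levels
    Y∈ : D ∘ ∁ ∋ ∁ T
    Y∈ = ∋∁ (high∋ T∈)
    lower : ∀ {X} → D ∘ ∁ ∋ X → ∣ X ∣ ≡ ∣ ∁ T ∣ → C ∋ false ∷ ∁ X
    lower {X} (mem x) e = go (kind {∁ X} (mem x))
      where
      sz : ∣ ∁ X ∣ ≡ suc h
      sz = trans (∣∁∣-≡ X (∁ T) e) (trans (cong ∣_∣ (∁∁ T)) szT)
      go : Kind (∁ X) → C ∋ false ∷ ∁ X
      go (small l _) = ⊥-elim (ℕ.<-irrefl sz (ℕ.m≤n⇒m≤1+n l))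
      go (low e′ _) = ⊥-elim (ℕ.1+n≢n (trans (sym sz) e′))
      go (high _ p) = p
      go (large l _) = ⊥-elim (ℕ.<-irrefl (sym sz) l)
    upper : ∀ {X} → D ∘ ∁ ∋ X → ∣ X ∣ ≡ suc ∣ ∁ T ∣ → C ∋ true ∷ ∁ X
    upper {X} (mem x) e = go (kind {∁ X} (mem x))
      where
      sz : ∣ ∁ X ∣ ≡ h
      sz = ℕ.suc-injective (trans (ℕ.+-cancelʳ-≡ ∣ ∁ T ∣ _ _
        (trans (sym (ℕ.+-suc ∣ ∁ X ∣ ∣ ∁ T ∣)) (trans (cong (∣ ∁ X ∣ +_) (sym e)) (trans (∣∁∣ X)
        (trans (sym (∣∁∣ (∁ T))) (cong (_+ ∣ ∁ T ∣) (cong ∣_∣ (∁∁ T)))))))) szT)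
      go : Kind (∁ X) → C ∋ true ∷ ∁ X
      go (small l _) = ⊥-elim (ℕ.<-irrefl sz l)
      go (low _ p) = p
      go (high e′ _) = ⊥-elim (ℕ.1+n≢n (trans (sym e′) sz))
      go (large l _) = ⊥-elim (ℕ.<-irrefl (sym sz) (ℕ.<-trans ℕ.≤-refl l))
    build : Hex (D ∘ ∁) ∣ ∁ T ∣ → Flip C
    build (hex K i j k i<j j<k i∉ j∉ k∉ size Ki Kj Kk Kij Kjk) =
      mkFlip zero (suc i) (suc j) (suc k) (false ∷ X) (s≤s z≤n) (s≤s i<j) (s≤s j<k)
        here (there i∉X) (there j∉X) (there (∉－ (V － i － j) k))
        (∋-subst (cong (true ∷_) (trans ∁jk (sym X＋i))) (upper Kjk (trans (∣＋∣ (oth (>⇒≢ j<k) k∉)) (cong suc (trans (∣＋∣ j∉) size)))))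
        (∋-subst (cong (false ∷_) (trans ∁-upd (sym X＋j＋k))) (lower Ki (trans (∣＋∣ i∉) size)))
        (∋-subst (cong (true ∷_) (trans ∁ij (sym X＋k))) (upper Kij (trans (∣＋∣ (oth (>⇒≢ i<j) j∉)) (cong suc (trans (∣＋∣ i∉) size)))))
        (∋-subst (cong (false ∷_) (trans ∁-upd (sym X＋i＋j))) (lower Kk (trans (∣＋∣ k∉) size)))
        (∋-subst (cong (false ∷_) (trans ∁-upd (sym X＋i＋k))) (lower Kj (trans (∣＋∣ j∉) size)))
      where
      i≢j = <⇒≢ i<j
      j≢k = <⇒≢ j<k
      i≢k = <⇒≢ (<-trans i<j j<k)
      V = ∁ K
      X = V － i － j － k
      i∉X : i ∉ X
      i∉X = out－ (out－ (∉－ V i))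
      j∉X : j ∉ X
      j∉X = out－ (∉－ (V － i) j)
      ∁ij : ∁ (K ＋ i ＋ j) ≡ V － i － j
      ∁ij = trans ∁-upd (cong (_－ j) ∁-upd)
      ∁jk : ∁ (K ＋ j ＋ k) ≡ V － j － k
      ∁jk = trans ∁-upd (cong (_－ k) ∁-upd)
      X＋k : X ＋ k ≡ V － i － j
      X＋k = －＋ (oth (j≢k ∘ sym) (oth (i≢k ∘ sym) (∁⁺ k∉)))
      X＋j : X ＋ j ≡ V － i － k
      X＋j = trans (cong (_＋ j) (upd-comm j≢k)) (－＋ (oth j≢k (oth (i≢j ∘ sym) (∁⁺ j∉))))
      X＋i : X ＋ i ≡ V － j － k
      X＋i = trans (cong (_＋ i) (trans (cong (_－ k) (upd-comm i≢j)) (upd-comm i≢k))) (－＋ (oth i≢k (oth i≢j (∁⁺ i∉))))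
      X＋j＋k : X ＋ j ＋ k ≡ V － i
      X＋j＋k = trans (cong (_＋ k) X＋j) (－＋ (oth (i≢k ∘ sym) (∁⁺ k∉)))
      X＋i＋j : X ＋ i ＋ j ≡ V － k
      X＋i＋j = trans (cong (_＋ j) (trans X＋i (upd-comm j≢k))) (－＋ (oth j≢k (∁⁺ j∉)))
      X＋i＋k : X ＋ i ＋ k ≡ V － j
      X＋i＋k = trans (cong (_＋ k) X＋i) (－＋ (oth (j≢k ∘ sym) (∁⁺ k∉)))

  Largest : ∀ {n} → ℕ → Coll n → Set
  Largest {n} m C = ∀ (E : Coll n) → Level m E → card E ℕ.≤ card C

  not-false : ∀ {b} → not b ≡ true → b ≡ false
  not-false {false} _ = refl

  -- An interval alternates with no set, so any competitor `E` of `C₁`, given the head, can be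
  -- joined by all intervals without the head. As `C` has at most those intervals without the head,
  -- `E` cannot exceed `C₁`.
  module Deletion {N m : ℕ} (C : Coll (suc N)) (lv : Level (suc m) C) (top : Largest (suc m) C)
                  (ints : ∀ {T : Subset N} → C ∋ false ∷ T → interval T ≡ true) where

    C₁ : Coll N
    C₁ = C ∘ (true ∷_)

    C₁-level : Level m C₁
    level-size C₁-level {S} (mem p) = ℕ.suc-injective (level-size lv {true ∷ S} (mem p))
    ws< (level-ws C₁-level) (mem x) (mem y) l pq qr (p , p′) (q , q′) (r , r′) =
      ws< (level-ws lv) (mem x) (mem y) (s≤s l) (s≤s pq) (s≤s qr) (there p , there p′) (there q , there q′) (there r , there r′)
    ws= (level-ws C₁-level) (mem x) (mem y) e pq qr rs (p , p′) (q , q′) (r , r′) (s , s′) =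
      ws= (level-ws lv) (mem x) (mem y) (cong suc e) (s≤s pq) (s≤s qr) (s≤s rs)
        (there p , there p′) (there q , there q′) (there r , there r′) (there s , there s′)

    private
      Int : Coll N
      Int S = interval S ∧ (∣ S ∣ ≡ᵇ suc m)

      Int⁻ : ∀ {S} → Int S ≡ true → interval S ≡ true × ∣ S ∣ ≡ suc m
      Int⁻ {S} p = let e , s = ∧⁻ {interval S} p in e , ≡ᵇ⁻ s

      module _ (E : Coll N) (lE : Level m E) where
        G : Coll (suc N)
        G (true ∷ S)  = E S
        G (false ∷ S) = Int S

        G-size : ∀ {S} → G ∋ S → ∣ S ∣ ≡ suc m
        G-size {true ∷ S} (mem p) = cong suc (level-size lE (mem p))
        G-size {false ∷ S} (mem p) = proj₂ (Int⁻ {S} p)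

        G-level : Level (suc m) G
        level-size G-level = G-size
        ws< (level-ws G-level) x y l = ⊥-elim (ℕ.<-irrefl (trans (G-size x) (sym (G-size y))) l)
        ws= (level-ws G-level) {true ∷ X} {true ∷ Y} (mem x) (mem y) e {suc _} {suc _} {suc _} {suc _} (s≤s pq) (s≤s qr) (s≤s rs)
          (there p , there p′) (there q , there q′) (there r , there r′) (there s , there s′) =
          ws= (level-ws lE) (mem x) (mem y) (ℕ.suc-injective e) pq qr rs (p , p′) (q , q′) (r , r′) (s , s′)
        ws= (level-ws G-level) {true ∷ X} {true ∷ Y} x y e {zero} _ _ _ (_ , ())
        ws= (level-ws G-level) {false ∷ X} {Y} (mem x) _ e {suc _} {suc _} {suc _} (s≤s pq) (s≤s qr) _
          (there p , _) (_ , there q′) (there r , _) _ = interval-no101 {S = X} (proj₁ (Int⁻ {X} x)) pq qr p q′ r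
        ws= (level-ws G-level) {true ∷ X} {false ∷ Y} _ (mem y) e {_} {suc _} {suc _} {suc _} _ (s≤s qr) (s≤s rs)
          _ (there q , _) (_ , there r′) (there s , _) = interval-no101 {S = Y} (proj₁ (Int⁻ {Y} y)) qr rs q r′ s

    C₁-largest : Largest m C₁
    C₁-largest E lE = ℕ.+-cancelʳ-≤ (card Int) _ _ (ℕ.≤-trans (top (G E lE) (G-level E lE))
      (ℕ.+-monoʳ-≤ (card C₁) (card-mono (C ∘ (false ∷_)) Int λ { {S} (mem p) →
        mem (cong₂ _∧_ (ints {S} (mem p)) (≡ᵇ⁺ (level-size lv {false ∷ S} (mem p)))) })))

  flip-exists : ∀ {n m} (C : Coll n) → Level m C → Largest m C → ∀ {S} → C ∋ S → isᵇ S ≡ false → Flip C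
  flip-exists {zero} C lv top {[]} S∈ ()
  flip-exists {suc N} {m} C lv top {S} S∈ e with search (λ T → C (false ∷ T) ∧ not (interval T))
  flip-exists {suc N} {m} C lv top {S} S∈ e | inj₁ (T , mem p) with ∧⁻ {C (false ∷ T)} p
  ... | T∈ , ni with avoids-complete true 2 T (not-false ni)
  flip-exists {suc N} {suc h} C lv top {S} S∈ e | inj₁ (T , mem p) | T∈ , ni | _ , step p∈ pq (step q∉ qr (end r∈)) =
    flip-at-head C lv (top (IS (suc h)) (IS-level _)) (mem T∈) pq qr p∈ q∉ r∈
  flip-exists {suc N} {zero} C lv top {S} S∈ e | inj₁ (T , mem p) | T∈ , ni | _ , step p∈ pq (step q∉ qr (end r∈))
    with () ← trans (∣－∣ p∈) (level-size lv {false ∷ T} (mem T∈))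
  flip-exists {suc N} {m} C lv top {false ∷ S} (mem S∈) e | inj₂ none
    with () ← trans (sym (none S)) (cong₂ _∧_ S∈ (cong not e))
  flip-exists {suc N} {zero} C lv top {true ∷ S} S∈ e | inj₂ none with () ← level-size lv S∈
  flip-exists {suc N} {suc m} C lv top {true ∷ S} (mem S∈) e | inj₂ none
    with flip-exists (Deletion.C₁ C lv top ints) (Deletion.C₁-level C lv top ints) (Deletion.C₁-largest C lv top ints) {S} (mem S∈) e
    where
    ints : ∀ {T} → C ∋ false ∷ T → interval T ≡ true
    ints {T} (mem p) with interval T in eq
    ... | true = refl
    ... | false with () ← trans (sym (none T)) (cong₂ _∧_ p (cong not eq))
  ... | mkFlip i j k l X i<j j<k k<l i∉ j∉ k∉ l∉ (mem ij) (mem kl) (mem il) (mem jk) (mem jl) =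
    mkFlip (suc i) (suc j) (suc k) (suc l) (true ∷ X) (s≤s i<j) (s≤s j<k) (s≤s k<l) (there i∉) (there j∉) (there k∉) (there l∉)
      (mem ij) (mem kl) (mem il) (mem jk) (mem jl)

open FlipExistence

-- Weak separation as absence of alternation, and its preservation under flips.

module Noncrossing where

  private variable
    n : ℕ

  Noncross : Subset n → Subset n → Set
  Noncross X Y = ∀ {p q r s} → p < q → q < r → r < s → p ∈ X ∖ Y → q ∈ Y ∖ X → r ∈ X ∖ Y → s ∈ Y ∖ X → ⊥

  ─⁺ : {X Y : Subset n} {x : Fin n} → x ∈ X ∖ Y → x ∈ X ─ Y
  ─⁺ (p , q) = x∈p∧x∉q⇒x∈p─q p (flip clash q)

  ─⁻ : {X Y : Subset n} {x : Fin n} → x ∈ X ─ Y → x ∈ X ∖ Y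
  ─⁻ {X = X} {Y} {x} p = p─q⊆p X Y p , out X Y p
    where
    out : ∀ {n} (X Y : Subset n) {x} → x ∈ X ─ Y → x ∉ Y
    out (true ∷ X) (false ∷ Y) here = here
    out (_ ∷ X) (true ∷ Y) (there p) = there (out X Y p)
    out (_ ∷ X) (false ∷ Y) (there p) = there (out X Y p)

  private
    ≺-< : {X Y : Subset n} → X ≺ Y → ∀ {x y} → x ∈ X ∖ Y → y ∈ Y ∖ X → x < y
    ≺-< (_ , f) p q = f _ _ (─⁺ p) (─⁺ q)

    ▷-split : {X Y : Subset n} → X ▷ Y → ∀ {y} → y ∈ Y ∖ X → (∀ {x} → x ∈ X ∖ Y → y < x) ⊎ (∀ {x} → x ∈ X ∖ Y → x < y)
    ▷-split {n} {X} {Y} (Y₁ , Y₂ , eq , _ , _ , _ , _ , (_ , f) , (_ , g)) {y} (y∈ , y∉)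
      with x∈p∪q⁻ Y₁ Y₂ (subst (y ∈_) (sym eq) (─⁺ (y∈ , y∉)))
    ... | inj₁ p = inj₁ λ q → f _ _ (x∈p∧x∉q⇒x∈p─q p λ r → clash (proj₁ (─⁻ r)) y∉)
                                    (x∈p∧x∉q⇒x∈p─q (─⁺ q) λ r → clash (Y⊆ (x∈p∪q⁺ (inj₁ r))) (proj₂ q))
      where
      Y⊆ : ∀ {x} → x ∈ Y₁ ∪ Y₂ → x ∈ Y
      Y⊆ r = proj₁ (─⁻ {X = Y} {X} (subst (_ ∈_) eq r))
    ... | inj₂ p = inj₂ λ q → g _ _ (x∈p∧x∉q⇒x∈p─q (─⁺ q) λ r → clash (Y⊆ (x∈p∪q⁺ (inj₂ r))) (proj₂ q))
                                    (x∈p∧x∉q⇒x∈p─q p λ r → clash (proj₁ (─⁻ r)) y∉)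
      where
      Y⊆ : ∀ {x} → x ∈ Y₁ ∪ Y₂ → x ∈ Y
      Y⊆ r = proj₁ (─⁻ {X = Y} {X} (subst (_ ∈_) eq r))

  ws⇒noncross : {X Y : Subset n} → WeaklySeparated X Y → Noncross X Y
  ws⇒noncross (inj₁ X≺Y) pq qr rs p q r s = <-asym qr (≺-< X≺Y r q)
  ws⇒noncross (inj₂ (inj₁ Y≺X)) pq qr rs p q r s = <-asym pq (≺-< Y≺X q p)
  ws⇒noncross (inj₂ (inj₂ (inj₁ (X▷Y , _)))) pq qr rs p q r s with ▷-split X▷Y q
  ... | inj₁ f = <-asym pq (f p)
  ... | inj₂ f = <-asym qr (f r)
  ws⇒noncross (inj₂ (inj₂ (inj₂ (Y▷X , _)))) pq qr rs p q r s with ▷-split Y▷X r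
  ... | inj₁ f = <-asym qr (f q)
  ... | inj₂ f = <-asym rs (f s)

  module _ (X Y : Subset n) where
    private
      ∈∖? : ∀ x → (x ∈ X ∖ Y) ⊎ ¬ (x ∈ X ∖ Y)
      ∈∖? x = ∈⊎ x X ∧? ∉⊎ x Y

      sel : (P : Fin n → Set) → (∀ x → P x ⊎ ¬ P x) → Subset n
      sel P P? = tabulate λ x → [ (λ _ → true) , (λ _ → false) ]′ (P? x)

      sel⁺ : ∀ {P} P? {x} → P x → x ∈ sel P P?
      sel⁺ P? {x} p = lookup⇒[]= x _ (trans (lookup∘tabulate _ x) (lem (P? x)))
        where
        lem : ∀ d → [ (λ _ → true) , (λ _ → false) ]′ d ≡ true
        lem (inj₁ _) = refl
        lem (inj₂ q) = ⊥-elim (q p)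

      sel⁻ : ∀ {P} P? {x} → x ∈ sel P P? → P x
      sel⁻ {P} P? {x} p = lem (P? x) (trans (sym (lookup∘tabulate _ x)) ([]=⇒lookup p))
        where
        lem : ∀ d → [ (λ _ → true) , (λ _ → false) ]′ d ≡ true → P x
        lem (inj₁ q) _ = q

    -- The bipartition cuts the elements of `Y` outside `X` at `x`. An element of `X` outside `Y` on
    -- the wrong side of a member of either part would complete an alternation with `x` and the
    -- witness on the other side.
    surround : Noncross X Y → Noncross Y X →
               ∀ {y x z} → y < x → x < z → y ∈ Y ∖ X → x ∈ X ∖ Y → z ∈ Y ∖ X → X ▷ Y
    surround nc nc′ {y} {x} {z} yx xz y∈ x∈ z∈ =
      Y₁ , Y₂ , ⊆-antisym sub sup , disj , (y , sel⁺ L? (yx , y∈)) , (z , sel⁺ R? (xz , z∈)) , (x , ─⁺ x∈) ,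
      ((x , x∈p∧x∉q⇒x∈p─q (─⁺ x∈) λ p → <⇒≢ (proj₁ (sel⁻ L? p)) refl) , lo) ,
      ((z , x∈p∧x∉q⇒x∈p─q (sel⁺ R? (xz , z∈)) λ p → clash (proj₁ (─⁻ p)) (proj₂ z∈)) , hi)
      where
      L R : Fin n → Set
      L v = v < x × v ∈ Y ∖ X
      R v = x < v × v ∈ Y ∖ X
      L? : ∀ v → L v ⊎ ¬ L v
      L? v = <⊎ v x ∧? (∈⊎ v Y ∧? ∉⊎ v X)
      R? : ∀ v → R v ⊎ ¬ R v
      R? v = <⊎ x v ∧? (∈⊎ v Y ∧? ∉⊎ v X)
      Y₁ Y₂ : Subset n
      Y₁ = sel L L?
      Y₂ = sel R R?
      sub : ∀ {v} → v ∈ Y₁ ∪ Y₂ → v ∈ Y ─ X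
      sub p with x∈p∪q⁻ Y₁ Y₂ p
      ... | inj₁ q = ─⁺ (proj₂ (sel⁻ L? q))
      ... | inj₂ q = ─⁺ (proj₂ (sel⁻ R? q))
      sup : ∀ {v} → v ∈ Y ─ X → v ∈ Y₁ ∪ Y₂
      sup {v} p with <-cmp v x
      ... | tri< l _ _ = x∈p∪q⁺ (inj₁ (sel⁺ L? (l , ─⁻ p)))
      ... | tri≈ _ refl _ = ⊥-elim (clash (proj₁ (─⁻ {X = Y} {X} p)) (proj₂ x∈))
      ... | tri> _ _ l = x∈p∪q⁺ (inj₂ (sel⁺ R? (l , ─⁻ p)))
      disj : Empty (Y₁ ∩ Y₂)
      disj (v , p) = let p₁ , p₂ = x∈p∩q⁻ Y₁ Y₂ p in <-asym (proj₁ (sel⁻ L? p₁)) (proj₁ (sel⁻ R? p₂))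
      lo : ∀ i j → i ∈ Y₁ ─ (X ─ Y) → j ∈ (X ─ Y) ─ Y₁ → i < j
      lo i j p q with sel⁻ L? (proj₁ (─⁻ {X = Y₁} {X ─ Y} p)) | ─⁻ {X = X} {Y} (proj₁ (─⁻ {X = X ─ Y} {Y₁} q)) | <-cmp i j
      ... | _ | _ | tri< l _ _ = l
      ... | _ , i∈ | j∈ | tri≈ _ refl _ = ⊥-elim (clash (proj₁ i∈) (proj₂ j∈))
      ... | i<x , i∈ | j∈ | tri> _ _ l = ⊥-elim (nc l i<x xz j∈ i∈ x∈ z∈)
      hi : ∀ i j → i ∈ (X ─ Y) ─ Y₂ → j ∈ Y₂ ─ (X ─ Y) → i < j
      hi i j p q with ─⁻ {X = X} {Y} (proj₁ (─⁻ {X = X ─ Y} {Y₂} p)) | sel⁻ R? (proj₁ (─⁻ {X = Y₂} {X ─ Y} q)) | <-cmp i j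
      ... | _ | _ | tri< l _ _ = l
      ... | i∈ | _ , j∈ | tri≈ _ refl _ = ⊥-elim (clash (proj₁ j∈) (proj₂ i∈))
      ... | i∈ | x<j , j∈ | tri> _ _ l = ⊥-elim (nc′ yx x<j l y∈ x∈ j∈ i∈)

    surrounded? : (∃[ y ] ∃[ x ] ∃[ z ] y < x × x < z × y ∈ Y ∖ X × x ∈ X ∖ Y × z ∈ Y ∖ X)
                ⊎ (∀ {y x z} → y < x → x < z → y ∈ Y ∖ X → x ∈ X ∖ Y → z ∈ Y ∖ X → ⊥)
    surrounded? with find (λ x → ∈∖? x ∧? (find′ (λ y → <⊎ y x ∧? (∈⊎ y Y ∧? ∉⊎ y X)) ∧? find′ (λ z → <⊎ x z ∧? (∈⊎ z Y ∧? ∉⊎ z X))))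
      where
      find′ : {P : Fin n → Set} (P? : ∀ x → P x ⊎ ¬ P x) → ∃ P ⊎ ¬ ∃ P
      find′ P? = [ inj₁ , (λ f → inj₂ λ { (x , p) → f x p }) ]′ (find P?)
    ... | inj₁ (x , x∈ , (y , yx , y∈) , (z , xz , z∈)) = inj₁ (y , x , z , yx , xz , y∈ , x∈ , z∈)
    ... | inj₂ f = inj₂ λ {y} {x} {z} yx xz y∈ x∈ z∈ → f x (x∈ , (y , yx , y∈) , (z , xz , z∈))

  -- Equal sizes satisfy both size conditions. If neither set surrounds an element of the other, the
  -- order of one pair `x₀`, `y₀` decides the order of all pairs.
  noncross⇒ws : {X Y : Subset n} → ∣ X ∣ ≡ ∣ Y ∣ → X ≢ Y → Noncross X Y → Noncross Y X → WeaklySeparated X Y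
  noncross⇒ws {X = X} {Y} e ne nc nc′ with surrounded? X Y | surrounded? Y X
  ... | inj₁ (_ , _ , _ , yx , xz , y∈ , x∈ , z∈) | _ =
    inj₂ (inj₂ (inj₁ (surround X Y nc nc′ yx xz y∈ x∈ z∈ , ℕ.≤-reflexive (sym e))))
  ... | inj₂ _ | inj₁ (_ , _ , _ , yx , xz , y∈ , x∈ , z∈) =
    inj₂ (inj₂ (inj₂ (surround Y X nc′ nc yx xz y∈ x∈ z∈ , ℕ.≤-reflexive e)))
  ... | inj₂ f | inj₂ g with differ X Y e
  ... | inj₁ eq = ⊥-elim (ne eq)
  ... | inj₂ ((x₀ , x₀∈) , (y₀ , y₀∈)) with <-cmp x₀ y₀
  ... | tri≈ _ refl _ = ⊥-elim (clash (proj₁ x₀∈) (proj₂ y₀∈))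
  ... | tri< x₀<y₀ _ _ = inj₁ ((y₀ , ─⁺ y₀∈) , λ i j p q → lem (─⁻ p) (─⁻ q))
    where
    lem : ∀ {x y} → x ∈ X ∖ Y → y ∈ Y ∖ X → x < y
    lem {x} {y} x∈ y∈ with <-cmp x y
    ... | tri< l _ _ = l
    ... | tri≈ _ refl _ = ⊥-elim (clash (proj₁ x∈) (proj₂ y∈))
    ... | tri> _ _ y<x with <-cmp x₀ y
    ... | tri< l _ _ = ⊥-elim (g l y<x x₀∈ y∈ x∈)
    ... | tri≈ _ refl _ = ⊥-elim (clash (proj₁ x₀∈) (proj₂ y∈))
    ... | tri> _ _ l = ⊥-elim (f l x₀<y₀ y∈ x₀∈ y₀∈)
  ... | tri> _ _ y₀<x₀ = inj₂ (inj₁ ((x₀ , ─⁺ x₀∈) , λ i j p q → lem (─⁻ p) (─⁻ q)))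
    where
    lem : ∀ {y x} → y ∈ Y ∖ X → x ∈ X ∖ Y → y < x
    lem {y} {x} y∈ x∈ with <-cmp y x
    ... | tri< l _ _ = l
    ... | tri≈ _ refl _ = ⊥-elim (clash (proj₁ x∈) (proj₂ y∈))
    ... | tri> _ _ x<y with <-cmp y₀ x
    ... | tri< l _ _ = ⊥-elim (f l x<y y₀∈ x∈ y∈)
    ... | tri≈ _ refl _ = ⊥-elim (clash (proj₁ x∈) (proj₂ y₀∈))
    ... | tri> _ _ l = ⊥-elim (g l y₀<x₀ x∈ y₀∈ x₀∈)

  Outside : Fin n → Fin n → Fin n → Set
  Outside a b x = x < a ⊎ b < x

  -- Noncrossing in both directions, in a form that does not depend on where the cyclic order is cut.
  Sep : Subset n → Subset n → Set
  Sep A Z = ∀ {a b p q} → a < p → p < b → Outside a b q → a ∈ A ∖ Z → b ∈ A ∖ Z → p ∈ Z ∖ A → q ∈ Z ∖ A → ⊥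

  toSep : {A Z : Subset n} → Noncross A Z → Noncross Z A → Sep A Z
  toSep nc nc′ ap pb (inj₁ qa) a b p q = nc′ qa ap pb q a p b
  toSep nc nc′ ap pb (inj₂ bq) a b p q = nc ap pb bq a p b q

  fromSep : {A Z : Subset n} → Sep A Z → Noncross A Z × Noncross Z A
  fromSep f = (λ pq qr rs p q r s → f pq qr (inj₂ rs) p r q s) , (λ pq qr rs p q r s → f qr rs (inj₁ pq) q s r p)

  Sep-sym : {A Z : Subset n} → Sep A Z → Sep Z A
  Sep-sym f = let nc , nc′ = fromSep f in toSep nc′ nc

  inside? : {a b x : Fin n} → x ≢ a → x ≢ b → (a < x × x < b) ⊎ Outside a b x
  inside? {a = a} {b} {x} x≢a x≢b with <-cmp x a | <-cmp x b
  ... | tri< l _ _ | _ = inj₂ (inj₁ l)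
  ... | tri≈ _ e _ | _ = ⊥-elim (x≢a e)
  ... | tri> _ _ _ | tri≈ _ e _ = ⊥-elim (x≢b e)
  ... | tri> _ _ _ | tri> _ _ l = inj₂ (inj₂ l)
  ... | tri> _ _ l | tri< l′ _ _ = inj₁ (l , l′)

  module FlipSep {n : ℕ} {X Z : Subset n} {i j k l : Fin n} (i<j : i < j) (j<k : j < k) (k<l : k < l)
    (i∉ : i ∉ X) (j∉ : j ∉ X) (k∉ : k ∉ X) (l∉ : l ∉ X)
    (size : ∣ Z ∣ ≡ ∣ X ＋ j ＋ l ∣) (Z≢ : Z ≢ X ＋ j ＋ l)
    (ij : Sep (X ＋ i ＋ j) Z) (kl : Sep (X ＋ k ＋ l) Z) (il : Sep (X ＋ i ＋ l) Z) (jk : Sep (X ＋ j ＋ k) Z) where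
    private
      i<k = <-trans i<j j<k
      j<l = <-trans j<k k<l
      i<l = <-trans i<k k<l

      l₁ : ∀ {a b} → a ∈ X ＋ a ＋ b
      l₁ {a} = in＋ (∈＋ X a)
      l₂ : ∀ {a b} → b ∈ X ＋ a ＋ b
      l₂ {a} {b} = ∈＋ (X ＋ a) b
      l₃ : ∀ {x a b} → x ∈ X → x ∈ X ＋ a ＋ b
      l₃ = in＋ ∘ in＋
      out : ∀ {x a b} → x ∉ X → x ≢ a → x ≢ b → x ∉ X ＋ a ＋ b
      out p q r = oth r (oth q p)
      cases : ∀ {x a b} → x ∈ X ＋ a ＋ b → x ≡ b ⊎ x ≡ a ⊎ x ∈ X
      cases p = [ inj₁ , inj₂ ∘ in＋⁻ ]′ (in＋⁻ p)

      i∉jk = out i∉ (<⇒≢ i<j) (<⇒≢ i<k)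
      i∉kl = out i∉ (<⇒≢ i<k) (<⇒≢ i<l)
      j∉il = out j∉ (>⇒≢ i<j) (<⇒≢ j<l)
      j∉kl = out j∉ (<⇒≢ j<k) (<⇒≢ j<l)
      k∉ij = out k∉ (>⇒≢ i<k) (>⇒≢ j<k)
      k∉il = out k∉ (>⇒≢ i<k) (<⇒≢ k<l)
      l∉ij = out l∉ (>⇒≢ i<l) (>⇒≢ j<l)
      l∉jk = out l∉ (>⇒≢ j<l) (>⇒≢ k<l)

      -- A difference between `Z` and `X ＋ j ＋ l` would consist of some `z` in `Z` and some `x` in
      -- `X`. Wherever they lie, `x` and one of `i`, `k` alternate with `z` and one of `j`, `l`, and
      -- some frame set contains the first two and neither of the others.
      other : j ∈ Z → l ∈ Z → i ∉ Z → k ∉ Z → ⊥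
      other j∈ l∈ i∉Z k∉Z with differ Z (X ＋ j ＋ l) size
      ... | inj₁ e = Z≢ e
      ... | inj₂ ((z , z∈ , z∉) , (x , x∈ , x∉)) with cases x∈
      ... | inj₁ refl = clash l∈ x∉
      ... | inj₂ (inj₁ refl) = clash j∈ x∉
      ... | inj₂ (inj₂ x∈X) = go (<-cmp z i) (<-cmp z k)
        where
        z∉X : z ∉ X
        z∉X = out＋⁻ (out＋⁻ z∉)
        z≢i = ∈∉⇒≢ z∈ i∉Z
        z≢k = ∈∉⇒≢ z∈ k∉Z
        z≢j = ∉∈⇒≢ z∉ l₁
        z≢l = ∉∈⇒≢ z∉ l₂
        x≢z = ∉∈⇒≢ x∉ z∈
        x≢j = ∉∈⇒≢ x∉ j∈
        x≢l = ∉∈⇒≢ x∉ l∈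
        go : _ → _ → ⊥
        go (tri≈ _ e _) _ = z≢i e
        go _ (tri≈ _ e _) = z≢k e
        go (tri< z<i _ _) _ with inside? x≢z x≢j
        ... | inj₁ (zx , xj) = Sep-sym kl zx xj (inj₂ j<k) (z∈ , out z∉X z≢k z≢l) (j∈ , j∉kl) (l₃ x∈X , x∉) (l₁ , k∉Z)
        ... | inj₂ o = Sep-sym il z<i i<j o (z∈ , out z∉X z≢i z≢l) (j∈ , j∉il) (l₁ , i∉Z) (l₃ x∈X , x∉)
        go (tri> _ _ i<z) (tri< z<k _ _) with inside? x≢z x≢l
        ... | inj₁ (zx , xl) = Sep-sym ij zx xl (inj₁ i<z) (z∈ , out z∉X z≢i z≢j) (l∈ , l∉ij) (l₃ x∈X , x∉) (l₁ , i∉Z)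
        ... | inj₂ o = Sep-sym jk z<k k<l o (z∈ , out z∉X z≢j z≢k) (l∈ , l∉jk) (l₂ , k∉Z) (l₃ x∈X , x∉)
        go (tri> _ _ i<z) (tri> _ _ k<z) with inside? x≢j x≢z
        ... | inj₁ (jx , xz) = Sep-sym il jx xz (inj₁ i<j) (j∈ , j∉il) (z∈ , out z∉X z≢i z≢l) (l₃ x∈X , x∉) (l₁ , i∉Z)
        ... | inj₂ o = Sep-sym kl j<k k<z o (j∈ , j∉kl) (z∈ , out z∉X z≢k z≢l) (l₁ , k∉Z) (l₃ x∈X , x∉)

      -- If `j` is missing from `Z`, it can replace `k` or `i` as one end around `p`. If `j` is
      -- present and `l` missing, `j` replaces `p` and `l` becomes an end. With both present, only
      -- `other` remains.
      caseU : i ∉ Z → k ∉ Z → ∀ {p q} → i < p → p < k → Outside i k q → p ∈ Z ∖ (X ＋ i ＋ k) → q ∈ Z ∖ (X ＋ i ＋ k) → ⊥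
      caseU i∉Z k∉Z {p} {q} ip pk oq (p∈ , p∉) (q∈ , q∉) with ∈? j Z | ∈? l Z
      ... | inj₁ j∈ | inj₁ l∈ = other j∈ l∈ i∉Z k∉Z
      ... | inj₂ j∉Z | _ = no-j (<-cmp p j)
        where
        q≢j = ∈∉⇒≢ q∈ j∉Z
        oij : Outside i k q → Outside i j q
        oij (inj₁ o) = inj₁ o
        oij (inj₂ o) = inj₂ (<-trans j<k o)
        ojk : Outside i k q → Outside j k q
        ojk (inj₁ o) = inj₁ (<-trans o i<j)
        ojk (inj₂ o) = inj₂ o
        no-j : _ → ⊥
        no-j (tri≈ _ refl _) = clash p∈ j∉Z
        no-j (tri< pj ne _) = ij ip pj (oij oq) (l₁ , i∉Z) (l₂ , j∉Z) (p∈ , oth ne (out＋⁻ p∉)) (q∈ , oth q≢j (out＋⁻ q∉))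
        no-j (tri> _ ne jp) = jk jp pk (ojk oq) (l₁ , j∉Z) (l₂ , k∉Z)
          (p∈ , out (out＋⁻ (out＋⁻ p∉)) ne (∉∈⇒≢ p∉ l₂)) (q∈ , out (out＋⁻ (out＋⁻ q∉)) q≢j (∉∈⇒≢ q∉ l₂))
      ... | inj₁ j∈ | inj₂ l∉Z with inside? {a = k} {l} {q} (∉∈⇒≢ q∉ l₂) (∈∉⇒≢ q∈ l∉Z) | oq
      ... | inj₁ (kq , ql) | _ = kl kq ql (inj₁ j<k) (l₁ , k∉Z) (l₂ , l∉Z)
              (q∈ , out (out＋⁻ (out＋⁻ q∉)) (∉∈⇒≢ q∉ l₂) (∈∉⇒≢ q∈ l∉Z)) (j∈ , j∉kl)
      ... | inj₂ (inj₁ qk) | inj₂ kq = <-asym qk kq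
      ... | inj₂ (inj₂ lq) | _ = il i<j j<l (inj₂ lq) (l₁ , i∉Z) (l₂ , l∉Z) (j∈ , j∉il) (q∈ , oth (∈∉⇒≢ q∈ l∉Z) (out＋⁻ q∉))
      ... | inj₂ (inj₁ qk) | inj₁ qi = il i<j j<l (inj₁ qi) (l₁ , i∉Z) (l₂ , l∉Z) (j∈ , j∉il) (q∈ , oth (∈∉⇒≢ q∈ l∉Z) (out＋⁻ q∉))

      caseV : j ∈ Z → l ∈ Z → ∀ {u v} → j < u → u < l → Outside j l v → u ∈ (X ＋ i ＋ k) ∖ Z → v ∈ (X ＋ i ＋ k) ∖ Z → ⊥
      caseV j∈ l∈ {u} {v} ju ul ov (u∈ , u∉) (v∈ , v∉) with ∈? k Z | ∈? i Z
      ... | inj₂ k∉Z | inj₂ i∉Z = other j∈ l∈ i∉Z k∉Z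
      ... | inj₁ k∈ | _ = with-k (<-cmp u k)
        where
        v∈i : v ∈ X ＋ i
        v∈i = unoth (∉∈⇒≢ v∉ k∈) v∈
        u∈i : u ∈ X ＋ i
        u∈i = unoth (∉∈⇒≢ u∉ k∈) u∈
        ojk : Outside j l v → Outside j k v
        ojk (inj₁ o) = inj₁ o
        ojk (inj₂ o) = inj₂ (<-trans k<l o)
        okl : Outside j l v → Outside k l v
        okl (inj₁ o) = inj₁ (<-trans o j<k)
        okl (inj₂ o) = inj₂ o
        with-k : _ → ⊥
        with-k (tri≈ _ refl _) = clash k∈ u∉
        with-k (tri< uk _ _) = Sep-sym il ju uk (ojk ov) (j∈ , j∉il) (k∈ , k∉il) (in＋ u∈i , u∉) (in＋ v∈i , v∉)
        with-k (tri> _ _ ku) = Sep-sym ij ku ul (okl ov) (k∈ , k∉ij) (l∈ , l∉ij) (in＋ u∈i , u∉) (in＋ v∈i , v∉)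
      ... | inj₂ k∉Z | inj₁ i∈ = with-i (<-cmp v i) ov
        where
        v≢k : Outside j l v → v ≢ k
        v≢k (inj₁ o) = <⇒≢ (<-trans o j<k)
        v≢k (inj₂ o) = >⇒≢ (<-trans k<l o)
        v∈X : v ∈ X
        v∈X = unoth (∉∈⇒≢ v∉ i∈) (unoth (v≢k ov) v∈)
        with-i : _ → Outside j l v → ⊥
        with-i (tri≈ _ refl _) _ = clash i∈ v∉
        with-i (tri< vi _ _) _ = Sep-sym jk i<k k<l (inj₁ vi) (i∈ , i∉jk) (l∈ , l∉jk) (l₂ , k∉Z) (l₃ v∈X , v∉)
        with-i (tri> _ _ iv) (inj₂ lv) = Sep-sym jk i<k k<l (inj₂ lv) (i∈ , i∉jk) (l∈ , l∉jk) (l₂ , k∉Z) (l₃ v∈X , v∉)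
        with-i (tri> _ _ iv) (inj₁ vj) = Sep-sym kl iv vj (inj₂ j<k) (i∈ , i∉kl) (j∈ , j∉kl) (l₃ v∈X , v∉) (l₁ , k∉Z)

    -- If `a` and `b` avoid `k`, both lie in `X ＋ i`, and `X ＋ i ＋ j` or `X ＋ i ＋ l` shows the same
    -- alternation unless `p` and `q` are `j` and `l`; likewise if they avoid `i`. There remain `i`,
    -- `k` on one side (`caseU`) or `j`, `l` on the other (`caseV`).
    flip-sep : Sep (X ＋ i ＋ k) Z
    flip-sep {a} {b} {p} {q} ap pb oq (a∈ , a∉) (b∈ , b∉) (p∈ , p∉) (q∈ , q∉) = main
      where
      p≢k = ∉∈⇒≢ p∉ l₂
      q≢k = ∉∈⇒≢ q∉ l₂
      hitJL : (p ≡ j ⊎ q ≡ j) → (p ≡ l ⊎ q ≡ l) → ⊥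
      hitJL (inj₁ refl) (inj₁ e) = <⇒≢ j<l e
      hitJL (inj₂ refl) (inj₂ e) = <⇒≢ j<l e
      hitJL (inj₁ refl) (inj₂ refl) = [ (λ la → <-asym (<-trans ap j<l) la)
                                      , (λ bl → caseV p∈ q∈ pb bl (inj₁ ap) (b∈ , b∉) (a∈ , a∉)) ]′ oq
      hitJL (inj₂ refl) (inj₁ refl) = [ (λ ja → caseV q∈ p∈ ja ap (inj₂ pb) (a∈ , a∉) (b∈ , b∉))
                                      , (λ bj → <-asym (<-trans pb bj) j<l) ]′ oq
      eq? : ∀ c → (p ≡ c ⊎ q ≡ c) ⊎ (p ≢ c × q ≢ c)
      eq? c with p ≟ c | q ≟ c
      ... | yes e | _ = inj₁ (inj₁ e)
      ... | no _ | yes e = inj₁ (inj₂ e)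
      ... | no f | no g = inj₂ (f , g)
      noK : a ≢ k → b ≢ k → ⊥
      noK a≢k b≢k with eq? j | eq? l
      ... | inj₁ e | inj₁ e′ = hitJL e e′
      ... | inj₂ (f , g) | _ = ij ap pb oq (in＋ (unoth a≢k a∈) , a∉) (in＋ (unoth b≢k b∈) , b∉) (p∈ , oth f (out＋⁻ p∉)) (q∈ , oth g (out＋⁻ q∉))
      ... | inj₁ _ | inj₂ (f , g) = il ap pb oq (in＋ (unoth a≢k a∈) , a∉) (in＋ (unoth b≢k b∈) , b∉) (p∈ , oth f (out＋⁻ p∉)) (q∈ , oth g (out＋⁻ q∉))
      toJK : ∀ {x} → x ≢ i → x ∈ X ＋ i ＋ k → x ∈ X ＋ j ＋ k
      toJK x≢i x∈ with cases x∈
      ... | inj₁ refl = l₂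
      ... | inj₂ (inj₁ e) = ⊥-elim (x≢i e)
      ... | inj₂ (inj₂ x∈X) = l₃ x∈X
      toKL : ∀ {x} → x ≢ i → x ∈ X ＋ i ＋ k → x ∈ X ＋ k ＋ l
      toKL x≢i x∈ with cases x∈
      ... | inj₁ refl = l₁
      ... | inj₂ (inj₁ e) = ⊥-elim (x≢i e)
      ... | inj₂ (inj₂ x∈X) = l₃ x∈X
      noI : a ≢ i → b ≢ i → ⊥
      noI a≢i b≢i with eq? j | eq? l
      ... | inj₁ e | inj₁ e′ = hitJL e e′
      ... | inj₂ (f , g) | _ = jk ap pb oq (toJK a≢i a∈ , a∉) (toJK b≢i b∈ , b∉)
              (p∈ , out (out＋⁻ (out＋⁻ p∉)) f p≢k) (q∈ , out (out＋⁻ (out＋⁻ q∉)) g q≢k)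
      ... | inj₁ _ | inj₂ (f , g) = kl ap pb oq (toKL a≢i a∈ , a∉) (toKL b≢i b∈ , b∉)
              (p∈ , out (out＋⁻ (out＋⁻ p∉)) p≢k f) (q∈ , out (out＋⁻ (out＋⁻ q∉)) q≢k g)
      main : ⊥
      main with a ≟ i | b ≟ k | a ≟ k | b ≟ i
      ... | yes refl | yes refl | _ | _ = caseU a∉ b∉ ap pb oq (p∈ , p∉) (q∈ , q∉)
      ... | yes refl | no b≢k | _ | _ = noK (<⇒≢ i<k) b≢k
      ... | no a≢i | _ | _ | no b≢i = noI a≢i b≢i
      ... | no a≢i | _ | no a≢k | yes refl = noK a≢k (<⇒≢ i<k)
      ... | no a≢i | _ | yes refl | yes refl = <-asym (<-trans ap pb) i<k

open Noncrossing

-- Passage between lists and predicates, and IS in terms of ranks.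

open import Data.List.Base as List using ([]; _∷_; length; _++_)
open import Data.List.Properties using (length-map; length-++)
import Data.List.Membership.Propositional as LM
import Data.List.Membership.Propositional.Properties as LM
import Data.List.Membership.DecPropositional as DecMem
open import Data.List.Relation.Unary.All as All using (All; []; _∷_)
open import Data.List.Relation.Unary.AllPairs using ([]; _∷_)
open import Data.List.Relation.Unary.Any using (here; there)
open import Data.List.Relation.Unary.Unique.Propositional using (Unique)
import Data.List.Relation.Unary.Unique.Propositional.Properties as Unique
open import Data.Nat.ListAction using (sum)
open import Function.Bundles using (_⇔_; mk⇔; Equivalence)
open import Relation.Binary.Construct.Closure.ReflexiveTransitive using (Star; ε; _◅_; _◅◅_)

open Equivalence using (to; from)

private variable
  n m : ℕ

_≟ˢ_ : (S T : Subset n) → Dec (S ≡ T)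
_≟ˢ_ = ≡-dec _≟ᵇ_

open module DecMemSubset {n} = DecMem (_≟ˢ_ {n}) using () renaming (_∈?_ to _∈ᴸ?_)

memᵇ : Collection n → Coll n
memᵇ C S = does (S ∈ᴸ? C)

mem⁺ : {C : Collection n} {S : Subset n} → S LM.∈ C → memᵇ C ∋ S
mem⁺ {C = C} {S} p = mem lem
  where
  lem : memᵇ C S ≡ true
  lem with S ∈ᴸ? C
  ... | yes _ = refl
  ... | no ¬p = ⊥-elim (¬p p)

mem⁻ : (C : Collection n) {S : Subset n} → memᵇ C ∋ S → S LM.∈ C
mem⁻ C {S} (mem e) with S ∈ᴸ? C
... | yes p = p

length-≤-card : (C : Collection n) → Unique C → length C ℕ.≤ card (memᵇ C)
length-≤-card [] _ = z≤n
length-≤-card (S ∷ C) (S∉ ∷ u) = ℕ.≤-trans (ℕ.+-mono-≤ (card-≥1 (memᵇ (S ∷ [])) {S} (mem⁺ {C = S ∷ []} (here refl))) (length-≤-card C u))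
  (ℕ.≤-trans (ℕ.≤-reflexive (sym (card-⊎ (memᵇ (S ∷ [])) (memᵇ C) disj)))
             (card-mono (λ T → memᵇ (S ∷ []) T ∨ memᵇ C T) (memᵇ (S ∷ C)) sub))
  where
  disj : ∀ {T} → memᵇ (S ∷ []) ∋ T → memᵇ C ∋ T → ⊥
  disj p q with mem⁻ (S ∷ []) p
  ... | here refl = All.lookup S∉ (mem⁻ C q) refl
  sub : ∀ {T} → (λ T → memᵇ (S ∷ []) T ∨ memᵇ C T) ∋ T → memᵇ (S ∷ C) ∋ T
  sub {T} (mem p) with ∨⁻ {memᵇ (S ∷ []) T} p
  ... | inj₁ q = case mem⁻ (S ∷ []) {T} (mem q) of λ { (here refl) → mem⁺ {C = S ∷ C} (here refl) }
  ... | inj₂ q = mem⁺ (there (mem⁻ C {T} (mem q)))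

-- Turns a competitor given as a predicate into one of the lists over which maximality quantifies.
listing : Coll n → Collection n
listing {zero}  D = if D [] then [] ∷ [] else []
listing {suc n} D = List.map (true ∷_) (listing (D ∘ (true ∷_))) ++ List.map (false ∷_) (listing (D ∘ (false ∷_)))

length-listing : (D : Coll n) → length (listing D) ≡ card D
length-listing {zero} D with D []
... | true  = refl
... | false = refl
length-listing {suc n} D = trans (length-++ (List.map (true ∷_) (listing (D ∘ (true ∷_)))))
  (cong₂ _+_ (trans (length-map (true ∷_) (listing (D ∘ (true ∷_)))) (length-listing (D ∘ (true ∷_))))
             (trans (length-map (false ∷_) (listing (D ∘ (false ∷_)))) (length-listing (D ∘ (false ∷_)))))

listing⁻ : (D : Coll n) {S : Subset n} → S LM.∈ listing D → D ∋ S
listing⁻ {zero} D {[]} p with D [] in e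
... | true = mem e
listing⁻ {suc n} D p with LM.∈-++⁻ (List.map (true ∷_) (listing (D ∘ (true ∷_)))) p
... | inj₁ q with LM.∈-map⁻ (true ∷_) q
... | R , r , refl = mem (get (listing⁻ (D ∘ (true ∷_)) r))
listing⁻ {suc n} D p | inj₂ q with LM.∈-map⁻ (false ∷_) q
... | R , r , refl = mem (get (listing⁻ (D ∘ (false ∷_)) r))

listing-unique : (D : Coll n) → Unique (listing D)
listing-unique {zero} D with D []
... | true  = [] ∷ []
... | false = []
listing-unique {suc n} D = Unique.++⁺ (Unique.map⁺ ∷-injectiveʳ (listing-unique (D ∘ (true ∷_))))
  (Unique.map⁺ ∷-injectiveʳ (listing-unique (D ∘ (false ∷_)))) disj
  where
  disj : ∀ {S} → ¬ (S LM.∈ List.map (true ∷_) (listing (D ∘ (true ∷_))) × S LM.∈ List.map (false ∷_) (listing (D ∘ (false ∷_))))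
  disj (p , q) with LM.∈-map⁻ (true ∷_) p | LM.∈-map⁻ (false ∷_) q
  ... | _ , _ , refl | _ , _ , ()

mkWS : {C : Collection n} → Unique C → (∀ {S} → S LM.∈ C → ∣ S ∣ ≡ m) →
       (∀ {X Y} → X LM.∈ C → Y LM.∈ C → Noncross X Y) → WSCollection n m C
mkWS u sz nc = u , All.tabulate sz , λ X Y X∈ Y∈ X≢Y →
  noncross⇒ws (trans (sz X∈) (sym (sz Y∈))) X≢Y (nc X∈ Y∈) (nc Y∈ X∈)

coll-size : {C : Collection n} → WSCollection n m C → ∀ {S} → S LM.∈ C → ∣ S ∣ ≡ m
coll-size (_ , sz , _) = All.lookup sz

coll-noncross : {C : Collection n} → WSCollection n m C → ∀ {X Y} → X LM.∈ C → Y LM.∈ C → Noncross X Y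
coll-noncross (_ , _ , f) {X} {Y} X∈ Y∈ with X ≟ˢ Y
... | yes refl = λ _ _ _ p _ _ _ → clash (proj₁ p) (proj₂ p)
... | no X≢Y  = ws⇒noncross (f X Y X∈ Y∈ X≢Y)

coll-level : {C : Collection n} → WSCollection n m C → Level m (memᵇ C)
level-size (coll-level {C = C} wc) p = coll-size wc (mem⁻ C p)
ws< (level-ws (coll-level {C = C} wc)) x y l = ⊥-elim (ℕ.<-irrefl (trans (coll-size wc (mem⁻ C x)) (sym (coll-size wc (mem⁻ C y)))) l)
ws= (level-ws (coll-level {C = C} wc)) x y _ = coll-noncross wc (mem⁻ C x) (mem⁻ C y)

level-coll : {E : Coll n} → Level m E → WSCollection n m (listing E)
level-coll {E = E} lv = mkWS (listing-unique E) (λ p → level-size lv (listing⁻ E p))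
  (λ x y → let x′ = listing⁻ E x ; y′ = listing⁻ E y in
    ws= (level-ws lv) x′ y′ (trans (level-size lv x′) (sym (level-size lv y′))))

coll-largest : {C : Collection n} → MaxWSCollection n m C → Largest m (memᵇ C)
coll-largest {C = C} (wc , max) E lv = ℕ.≤-trans (ℕ.≤-reflexive (sym (length-listing E)))
  (ℕ.≤-trans (max (listing E) (level-coll lv)) (length-≤-card C (proj₁ wc)))

initial-rank : (S : Subset n) → avoids false 2 S ≡ true →
               Σ[ p ∈ ℕ ] p ℕ.≤ n × (∀ x → (x ∈ S) ⇔ (rank x ℕ.≤ p))
initial-rank [] e = 0 , z≤n , λ ()
initial-rank (true ∷ S) e with initial-rank S e
... | p , le , f = suc p , s≤s le , λ
  { zero → mk⇔ (λ _ → s≤s z≤n) (λ _ → here)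
  ; (suc x) → mk⇔ (λ { (there q) → s≤s (to (f x) q) }) (λ { (s≤s l) → there (from (f x) l) }) }
initial-rank (false ∷ S) e = 0 , z≤n , λ
  { zero → mk⇔ (λ ()) (λ ())
  ; (suc x) → mk⇔ (λ { (there q) → ⊥-elim (avoids-sound true 1 S e (end q)) }) (λ ()) }

interval-rank : (S : Subset n) → interval S ≡ true → IsInterval S
interval-rank [] e = 1 , 0 , s≤s z≤n , z≤n , λ ()
interval-rank (true ∷ S) e with initial-rank S e
... | p , le , f = 1 , suc p , s≤s z≤n , s≤s le , λ
  { zero → mk⇔ (λ _ → s≤s z≤n , s≤s z≤n) (λ _ → here)
  ; (suc x) → mk⇔ (λ { (there q) → s≤s z≤n , s≤s (to (f x) q) }) (λ { (_ , s≤s l) → there (from (f x) l) }) }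
interval-rank (false ∷ S) e with interval-rank S e
... | p , q , 1≤p , le , f = suc p , suc q , s≤s z≤n , s≤s le , λ
  { zero → mk⇔ (λ ()) (λ { (s≤s l , _) → ⊥-elim (ℕ.<-irrefl refl (ℕ.≤-trans 1≤p l)) })
  ; (suc x) → mk⇔ (λ { (there r) → let u , v = to (f x) r in s≤s u , s≤s v })
                  (λ { (s≤s u , s≤s v) → there (from (f x) (u , v)) }) }

cons-interval : {S : Subset n} → IsInterval S → IsInterval (true ∷ S) ⊎ IsWrapped (true ∷ S)
cons-interval {S = S} (zero , q , () , _)
cons-interval {S = S} (suc zero , q , _ , le , f) = inj₁ (1 , suc q , s≤s z≤n , s≤s le , λ
  { zero → mk⇔ (λ _ → s≤s z≤n , s≤s z≤n) (λ _ → here)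
  ; (suc x) → mk⇔ (λ { (there r) → s≤s z≤n , s≤s (proj₂ (to (f x) r)) }) (λ { (_ , s≤s v) → there (from (f x) (s≤s z≤n , v)) }) })
cons-interval {S = S} (suc (suc p) , q , _ , le , f) with suc (suc p) ℕ.≤? q
... | yes p≤q = inj₂ (1 , suc (suc (suc p)) , suc q , s≤s z≤n , s≤s p≤q , s≤s (s≤s (s≤s z≤n)) , s≤s le , λ
  { zero → mk⇔ (λ _ → inj₁ (s≤s z≤n)) (λ _ → here)
  ; (suc x) → mk⇔ (λ { (there r) → let u , v = to (f x) r in inj₂ (s≤s u , s≤s v) })
                  (λ { (inj₁ (s≤s ())) ; (inj₂ (s≤s u , s≤s v)) → there (from (f x) (u , v)) }) })
-- The given interval is empty, so the new set is the first element alone; `IsWrapped` requires a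
-- nonempty second part.
... | no p≰q = inj₁ (1 , 1 , s≤s z≤n , s≤s z≤n , λ
  { zero → mk⇔ (λ _ → s≤s z≤n , s≤s z≤n) (λ _ → here)
  ; (suc x) → mk⇔ (λ { (there r) → let u , v = to (f x) r in ⊥-elim (p≰q (ℕ.≤-trans u v)) }) (λ { (_ , s≤s ()) }) })

is-rank : (S : Subset n) → isᵇ S ≡ true → IsInterval S ⊎ IsWrapped S
is-rank [] e = inj₁ (1 , 0 , s≤s z≤n , z≤n , λ ())
is-rank (false ∷ S) e = inj₁ (interval-rank (false ∷ S) e)
is-rank (true ∷ S) e with is-rank S e
... | inj₁ int = cons-interval int
... | inj₂ (p , q , r , 1≤p , q≤r , pq , le , f) = inj₂ (suc p , suc q , suc r , s≤s z≤n , s≤s q≤r , s≤s pq , s≤s le , λ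
  { zero → mk⇔ (λ _ → inj₁ (s≤s z≤n)) (λ _ → here)
  ; (suc x) → mk⇔ (λ { (there t) → [ inj₁ ∘ s≤s , (λ { (u , v) → inj₂ (s≤s u , s≤s v) }) ]′ (to (f x) t) })
                  (λ { (inj₁ (s≤s u)) → there (from (f x) (inj₁ u)) ; (inj₂ (s≤s u , s≤s v)) → there (from (f x) (inj₂ (u , v))) }) })

rank-is : (S : Subset n) → IsInterval S ⊎ IsWrapped S → isᵇ S ≡ true
rank-is S w with isᵇ S in e
... | true = refl
... | false with avoids-complete false 3 S e
... | _ , step p∉ pq (step q∈ qr (step r∉ rs (end s∈))) = ⊥-elim (bad w)
  where
  rank-< : ∀ {x y : Fin n} → x < y → rank x ℕ.≤ rank y
  rank-< l = ℕ.≤-trans (ℕ.n≤1+n _) (s≤s l)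
  bad : IsInterval S ⊎ IsWrapped S → ⊥
  bad (inj₁ (_ , _ , _ , _ , f)) =
    clash (from (f _) (ℕ.≤-trans (proj₁ (to (f _) q∈)) (rank-< qr) , ℕ.≤-trans (rank-< rs) (proj₂ (to (f _) s∈)))) r∉
  bad (inj₂ (_ , _ , _ , _ , _ , _ , _ , f)) with to (f _) q∈ | to (f _) s∈
  ... | inj₁ u | _ = clash (from (f _) (inj₁ (ℕ.≤-trans (rank-< pq) u))) p∉
  ... | inj₂ _ | inj₁ u = clash (from (f _) (inj₁ (ℕ.≤-trans (rank-< rs) u))) r∉
  ... | inj₂ (u , _) | inj₂ (_ , v) = clash (from (f _) (inj₂ (ℕ.≤-trans u (rank-< qr) , ℕ.≤-trans (rank-< rs) v))) r∉

max-complete : {C : Collection n} → MaxWSCollection n m C → ∀ {S} → ∣ S ∣ ≡ m →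
               (∀ {Y} → Y LM.∈ C → Noncross S Y × Noncross Y S) → S LM.∈ C
max-complete {n} {m} {C} (wc , max) {S} sz nc with S ∈ᴸ? C
... | yes p = p
... | no S∉ = ⊥-elim (ℕ.<-irrefl refl (max (S ∷ C) (mkWS
      (All.tabulate (λ p e → S∉ (subst (LM._∈ C) (sym e) p)) ∷ proj₁ wc) sz′ nc′)))
  where
  sz′ : ∀ {T} → T LM.∈ S ∷ C → ∣ T ∣ ≡ m
  sz′ (here refl) = sz
  sz′ (there p) = coll-size wc p
  nc′ : ∀ {X Y} → X LM.∈ S ∷ C → Y LM.∈ S ∷ C → Noncross X Y
  nc′ (here refl) (here refl) _ _ _ p _ _ _ = clash (proj₁ p) (proj₂ p)
  nc′ (here refl) (there y) = proj₁ (nc y)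
  nc′ (there x) (here refl) = proj₂ (nc x)
  nc′ (there x) (there y) = coll-noncross wc x y

-- Two sets without 0101 never alternate, so by maximality no member of IS can be missing from `C`.
equalsIS : {C : Collection n} → MaxWSCollection n m C → (∀ {S} → S LM.∈ C → isᵇ S ≡ true) → EqualsIS n m C
equalsIS {n} {m} {C} mx@(wc , _) f S = mk⇔ (λ p → coll-size wc p , is-rank S (f p))
  (λ { (sz , w) → max-complete mx sz λ y →
      (λ pq qr rs p q r s → is-no0101 {S = _} (f y) pq qr rs (proj₂ p) (proj₁ q) (proj₂ r) (proj₁ s)) ,
      (λ pq qr rs p q r s → is-no0101 {S = S} (rank-is S w) pq qr rs (proj₂ p) (proj₁ q) (proj₂ r) (proj₁ s)) })

is-or-flip : {C : Collection n} → MaxWSCollection n m C → EqualsIS n m C ⊎ Flip (memᵇ C)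
is-or-flip {C = C} mx@(wc , _) with search (λ S → memᵇ C S ∧ not (isᵇ S))
... | inj₁ (S , mem p) = let p₁ , p₂ = ∧⁻ {memᵇ C S} p in
      inj₂ (flip-exists (memᵇ C) (coll-level wc) (coll-largest mx) {S} (mem p₁) (not-false p₂))
... | inj₂ none = inj₁ (equalsIS mx all-is)
  where
  all-is : ∀ {S} → S LM.∈ C → isᵇ S ≡ true
  all-is {S} p with isᵇ S in e
  ... | true = refl
  ... | false with () ← trans (sym (none S)) (cong₂ _∧_ (get (mem⁺ p)) (cong not e))

-- Lowering flips of lists and the descent to IS.

∪-singleton : (X : Subset n) (a : Fin n) → X ∪ ⁅ a ⁆ ≡ X ＋ a
∪-singleton (true ∷ X) zero = cong (true ∷_) (∪-identityʳ X)
∪-singleton (false ∷ X) zero = cong (true ∷_) (∪-identityʳ X)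
∪-singleton (true ∷ X) (suc a) = cong (true ∷_) (∪-singleton X a)
∪-singleton (false ∷ X) (suc a) = cong (false ∷_) (∪-singleton X a)

∪₂-＋ : (X : Subset n) (a b : Fin n) → X ∪₂ a , b ≡ X ＋ a ＋ b
∪₂-＋ X a b = trans (sym (∪-assoc X ⁅ a ⁆ ⁅ b ⁆)) (trans (∪-singleton (X ∪ ⁅ a ⁆) b) (cong (_＋ b) (∪-singleton X a)))

-- Each element is counted once for every position before it, so this is the sum of the zero-based
-- positions.
ht : Subset n → ℕ
ht []      = 0
ht (b ∷ S) = ∣ S ∣ + ht S

ht-＋ : {a : Fin n} {S : Subset n} → a ∉ S → ht (S ＋ a) ≡ toℕ a + ht S
ht-＋ here = refl
ht-＋ {a = suc a} {b ∷ S} (there p) = trans (cong₂ _+_ (∣＋∣ p) (ht-＋ p))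
  (cong suc (trans (sym (ℕ.+-assoc ∣ S ∣ (toℕ a) (ht S))) (trans (cong (_+ ht S) (ℕ.+-comm ∣ S ∣ (toℕ a))) (ℕ.+-assoc (toℕ a) ∣ S ∣ (ht S)))))

potential : Collection n → ℕ
potential C = sum (List.map ht C)

-- A transposition rather than a one-way substitution: being injective on all subsets, it keeps a
-- mapped list free of duplicates.
module Exchange {n : ℕ} (Y Y′ : Subset n) where
  exch : Subset n → Subset n
  exch S with S ≟ˢ Y | S ≟ˢ Y′
  ... | yes _ | _ = Y′
  ... | no _ | yes _ = Y
  ... | no _ | no _ = S

  exch-Y : exch Y ≡ Y′
  exch-Y with Y ≟ˢ Y
  ... | yes _ = refl
  ... | no ne = ⊥-elim (ne refl)

  exch-other : ∀ {S} → S ≢ Y → S ≢ Y′ → exch S ≡ S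
  exch-other {S} f g with S ≟ˢ Y | S ≟ˢ Y′
  ... | yes e | _ = ⊥-elim (f e)
  ... | no _ | yes e = ⊥-elim (g e)
  ... | no _ | no _ = refl

  exch-injective : ∀ {S T} → exch S ≡ exch T → S ≡ T
  exch-injective {S} {T} e with S ≟ˢ Y | S ≟ˢ Y′ | T ≟ˢ Y | T ≟ˢ Y′
  ... | yes refl | _ | yes refl | _ = refl
  ... | yes refl | _ | no ne | yes refl = sym e
  ... | yes refl | _ | no _ | no ne = ⊥-elim (ne (sym e))
  ... | no _ | yes refl | yes refl | _ = sym e
  ... | no _ | yes refl | no _ | yes refl = refl
  ... | no _ | yes refl | no ne | no _ = ⊥-elim (ne (sym e))
  ... | no _ | no ne | yes refl | _ = ⊥-elim (ne e)
  ... | no ne | no _ | no _ | yes refl = ⊥-elim (ne e)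
  ... | no _ | no _ | no _ | no _ = e

  potential-≤ : ht Y′ ℕ.≤ ht Y → (C : Collection n) → ¬ (Y′ LM.∈ C) → potential (List.map exch C) ℕ.≤ potential C
  potential-≤ le [] _ = z≤n
  potential-≤ le (S ∷ C) Y′∉ = ℕ.+-mono-≤ hd (potential-≤ le C (Y′∉ ∘ there))
    where
    hd : ht (exch S) ℕ.≤ ht S
    hd with S ≟ˢ Y | S ≟ˢ Y′
    ... | yes refl | _ = le
    ... | no _ | yes refl = ⊥-elim (Y′∉ (here refl))
    ... | no _ | no _ = ℕ.≤-refl

  potential-< : ht Y′ ℕ.< ht Y → (C : Collection n) → ¬ (Y′ LM.∈ C) → Y LM.∈ C → potential (List.map exch C) ℕ.< potential C
  potential-< l (S ∷ C) Y′∉ (here refl) =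
    ℕ.+-mono-<-≤ (subst (λ V → ht V ℕ.< ht Y) (sym exch-Y) l) (potential-≤ (ℕ.<⇒≤ l) C (Y′∉ ∘ there))
  potential-< l (S ∷ C) Y′∉ (there p) = ℕ.+-mono-≤-< hd (potential-< l C (Y′∉ ∘ there) p)
    where
    hd : ht (exch S) ℕ.≤ ht S
    hd with S ≟ˢ Y | S ≟ˢ Y′
    ... | yes refl | _ = ℕ.<⇒≤ l
    ... | no _ | yes refl = ⊥-elim (Y′∉ (here refl))
    ... | no _ | no _ = ℕ.≤-refl

module Lower {n m : ℕ} {C : Collection n} (mx : MaxWSCollection n m C) (F : Flip (memᵇ C)) where
  open Flip F
  private
    wc = proj₁ mx
    Y  = X ∪₂ j , l
    Y′ = X ∪₂ i , k
    i<k = <-trans i<j j<k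
    j<l = <-trans j<k k<l
    i<l = <-trans i<k k<l

    member : ∀ {a b} → memᵇ C ∋ X ＋ a ＋ b → (X ∪₂ a , b) LM.∈ C
    member {a} {b} p = subst (LM._∈ C) (sym (∪₂-＋ X a b)) (mem⁻ C p)

    ∣∪₂∣ : ∀ {a b} → a < b → a ∉ X → b ∉ X → ∣ X ∪₂ a , b ∣ ≡ suc (suc ∣ X ∣)
    ∣∪₂∣ {a} {b} l a∉ b∉ = trans (cong ∣_∣ (∪₂-＋ X a b)) (trans (∣＋∣ (oth (>⇒≢ l) b∉)) (cong suc (∣＋∣ a∉)))

    m≡ : m ≡ suc (suc ∣ X ∣)
    m≡ = trans (sym (coll-size wc (member Xij))) (∣∪₂∣ i<j i∉ j∉)

    Y∈ = member Xjl
    Y′∉ : ¬ (Y′ LM.∈ C)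
    Y′∉ p = coll-noncross wc (subst (LM._∈ C) (∪₂-＋ X i k) p) (mem⁻ C Xjl) i<j j<k k<l
      (in＋ (∈＋ X i) , oth (<⇒≢ i<l) (oth (<⇒≢ i<j) i∉))
      (in＋ (∈＋ X j) , oth (<⇒≢ j<k) (oth (>⇒≢ i<j) j∉))
      (∈＋ (X ＋ i) k , oth (<⇒≢ k<l) (oth (>⇒≢ j<k) k∉))
      (∈＋ (X ＋ j) l , oth (>⇒≢ k<l) (oth (>⇒≢ i<l) l∉))

    frame : FlipFrame n m C i j k l X
    frame = i<j , j<k , k<l , flip clash i∉ , flip clash j∉ , flip clash k∉ , flip clash l∉ ,
            cong (_∸ 2) (sym m≡) , member Xij , member Xkl , member Xil , member Xjk

  lowering : AdmitsLoweringFlip n m C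
  lowering = i , j , k , l , X , frame , Y∈ , Y′∉

  open Exchange Y Y′
  lowered : Collection n
  lowered = List.map exch C

  private
    replaced : Replaced C Y Y′ lowered
    replaced S = mk⇔ fwd bwd
      where
      fwd : S LM.∈ lowered → (S LM.∈ C × S ≢ Y) ⊎ S ≡ Y′
      fwd p with LM.∈-map⁻ exch p
      ... | R , r , refl with R ≟ˢ Y | R ≟ˢ Y′
      ... | yes _ | _ = inj₂ refl
      ... | no _ | yes refl = ⊥-elim (Y′∉ r)
      ... | no ne | no _ = inj₁ (r , ne)
      bwd : (S LM.∈ C × S ≢ Y) ⊎ S ≡ Y′ → S LM.∈ lowered
      bwd (inj₁ (p , ne)) = subst (LM._∈ lowered) (exch-other ne λ e → Y′∉ (subst (LM._∈ C) e p)) (LM.∈-map⁺ exch p)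
      bwd (inj₂ refl) = subst (LM._∈ lowered) exch-Y (LM.∈-map⁺ exch Y∈)

    replaced⁻ : Replaced lowered Y′ Y C
    replaced⁻ S = mk⇔ fwd bwd
      where
      fwd : S LM.∈ C → (S LM.∈ lowered × S ≢ Y′) ⊎ S ≡ Y
      fwd p with S ≟ˢ Y
      ... | yes e = inj₂ e
      ... | no ne = inj₁ (from (replaced S) (inj₁ (p , ne)) , λ e → Y′∉ (subst (LM._∈ C) e p))
      bwd : (S LM.∈ lowered × S ≢ Y′) ⊎ S ≡ Y → S LM.∈ C
      bwd (inj₁ (p , ne)) = [ proj₁ , (λ e → ⊥-elim (ne e)) ]′ (to (replaced S) p)
      bwd (inj₂ refl) = Y∈

    keep : ∀ {a b} → memᵇ C ∋ X ＋ a ＋ b → X ＋ a ＋ b ≢ X ＋ j ＋ l → (X ∪₂ a , b) LM.∈ lowered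
    keep {a} {b} p ne = from (replaced _) (inj₁ (member p , λ e → ne (trans (sym (∪₂-＋ X a b)) (trans e (∪₂-＋ X j l)))))

    differs : ∀ {c} {S T : Subset n} → c ∈ S → c ∉ T → S ≢ T
    differs p q refl = clash p q

    frame⁻ : FlipFrame n m lowered i j k l X
    frame⁻ = i<j , j<k , k<l , flip clash i∉ , flip clash j∉ , flip clash k∉ , flip clash l∉ , cong (_∸ 2) (sym m≡) ,
      keep Xij (differs (in＋ (∈＋ X i)) i∉jl) , keep Xkl (differs (in＋ (∈＋ X k)) k∉jl) ,
      keep Xil (differs (in＋ (∈＋ X i)) i∉jl) , keep Xjk (differs (∈＋ (X ＋ j) k) k∉jl)
      where
      i∉jl : i ∉ X ＋ j ＋ l
      i∉jl = oth (<⇒≢ i<l) (oth (<⇒≢ i<j) i∉)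
      k∉jl : k ∉ X ＋ j ＋ l
      k∉jl = oth (<⇒≢ k<l) (oth (>⇒≢ j<k) k∉)

  flip-down : FourFlip n m C lowered
  flip-down = i , j , k , l , X , frame , inj₁ (Y∈ , Y′∉ , replaced)

  flip-up : FourFlip n m lowered C
  flip-up = i , j , k , l , X , frame⁻ , inj₂ (from (replaced Y′) (inj₂ refl) , Y∉ , replaced⁻)
    where
    Y∉ : ¬ (Y LM.∈ lowered)
    Y∉ p with to (replaced Y) p
    ... | inj₁ (_ , ne) = ne refl
    ... | inj₂ e = Y′∉ (subst (LM._∈ C) e Y∈)

  lowered-max : MaxWSCollection n m lowered
  lowered-max = mkWS (Unique.map⁺ exch-injective (proj₁ wc)) sz nc ,
                λ D wD → ℕ.≤-trans (proj₂ mx D wD) (ℕ.≤-reflexive (sym (length-map exch C)))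
    where
    sz : ∀ {S} → S LM.∈ lowered → ∣ S ∣ ≡ m
    sz {S} p with to (replaced S) p
    ... | inj₁ (q , _) = coll-size wc q
    ... | inj₂ refl = trans (∣∪₂∣ i<k i∉ k∉) (sym m≡)
    sep : ∀ {A Z} → A LM.∈ C → Z LM.∈ C → Sep A Z
    sep a z = toSep (coll-noncross wc a z) (coll-noncross wc z a)
    new : ∀ {Z} → Z LM.∈ C → Z ≢ Y → Sep Y′ Z
    new {Z} z ne = subst (λ V → Sep V Z) (sym (∪₂-＋ X i k))
      (FlipSep.flip-sep i<j j<k k<l i∉ j∉ k∉ l∉
        (trans (coll-size wc z) (sym (coll-size wc (mem⁻ C Xjl)))) (λ e → ne (trans e (sym (∪₂-＋ X j l))))
        (sep (mem⁻ C Xij) z) (sep (mem⁻ C Xkl) z) (sep (mem⁻ C Xil) z) (sep (mem⁻ C Xjk) z))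
    nc : ∀ {A B} → A LM.∈ lowered → B LM.∈ lowered → Noncross A B
    nc {A} {B} a b with to (replaced A) a | to (replaced B) b
    ... | inj₁ (a , _) | inj₁ (b , _) = coll-noncross wc a b
    ... | inj₂ refl | inj₁ (b , ne) = proj₁ (fromSep (new b ne))
    ... | inj₁ (a , ne) | inj₂ refl = proj₂ (fromSep (new a ne))
    ... | inj₂ refl | inj₂ refl = λ _ _ _ p _ _ _ → clash (proj₁ p) (proj₂ p)

  lowered-potential : potential lowered ℕ.< potential C
  lowered-potential = potential-< (subst₂ ℕ._<_ (eq i<k i∉ k∉) (eq j<l j∉ l∉) (ℕ.+-mono-< k<l (ℕ.+-monoˡ-< (ht X) i<j))) C Y′∉ Y∈
    where
    eq : ∀ {a b} → a < b → a ∉ X → b ∉ X → toℕ b + (toℕ a + ht X) ≡ ht (X ∪₂ a , b)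
    eq {a} {b} l a∉ b∉ = sym (trans (cong ht (∪₂-＋ X a b)) (trans (ht-＋ (oth (>⇒≢ l) b∉)) (cong (toℕ b +_) (ht-＋ a∉))))

-- The way back is collected during the descent, each lowering flip being undone by a raising flip
-- on the same frame.
to-IS : ∀ f (C : Collection n) → potential C ℕ.< f → MaxWSCollection n m C →
        Σ[ C* ∈ Collection n ] Star (FourFlip n m) C C* × Star (FourFlip n m) C* C × EqualsIS n m C*
to-IS (suc f) C (s≤s le) mx with is-or-flip mx
... | inj₁ is = C , ε , ε , is
... | inj₂ F with to-IS f (Lower.lowered mx F) (ℕ.≤-trans (Lower.lowered-potential mx F) le) (Lower.lowered-max mx F)
... | C* , down , up , is = C* , Lower.flip-down mx F ◅ down , (up ◅◅ (Lower.flip-up mx F ◅ ε)) , is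

-- Two descents may end in different orderings of IS, so a path out of one ordering has to be
-- restarted from the other.
same-flip : {A B D : Collection n} → SameSet A B → FourFlip n m B D → FourFlip n m A D
same-flip {n} {m} {A} {B} {D} s (i , j , k , l , X , (a , b , c , d , e , f , g , h , ij , kl , il , jk) , t) =
  i , j , k , l , X , (a , b , c , d , e , f , g , h , from (s _) ij , from (s _) kl , from (s _) il , from (s _) jk) , res t
  where
  rep : ∀ {Y Y′} → Replaced B Y Y′ D → Replaced A Y Y′ D
  rep r S = mk⇔ (λ p → [ (λ { (q , ne) → inj₁ (from (s S) q , ne) }) , inj₂ ]′ (to (r S) p))
                (λ { (inj₁ (q , ne)) → from (r S) (inj₁ (to (s S) q , ne)) ; (inj₂ e) → from (r S) (inj₂ e) })
  swapped : ∀ {Y Y′} → Y LM.∈ B × ¬ (Y′ LM.∈ B) × Replaced B Y Y′ D → Y LM.∈ A × ¬ (Y′ LM.∈ A) × Replaced A Y Y′ D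
  swapped (p , q , r) = from (s _) p , (λ x → q (to (s _) x)) , rep r
  res = [ inj₁ ∘ swapped , inj₂ ∘ swapped ]′

same-star : {A B D : Collection n} → SameSet A B → Star (FourFlip n m) B D → FlipConnected n m A D
same-star s ε = _ , ε , s
-- The first flip absorbs the change of ordering, since `Replaced` speaks of members only; the rest
-- of the path is unchanged.
same-star {m = m} s (x ◅ xs) = _ , same-flip {m = m} s x ◅ xs , λ S → mk⇔ id id

theorem11p1 : (n m : ℕ) → m ≤ n →
    ((C : Collection n) → MaxWSCollection n m C → ¬ EqualsIS n m C → AdmitsLoweringFlip n m C)
    × ((C D : Collection n) → MaxWSCollection n m C → MaxWSCollection n m D → FlipConnected n m C D)
theorem11p1 n m _ = part₁ , part₂
  where
  part₁ : (C : Collection n) → MaxWSCollection n m C → ¬ EqualsIS n m C → AdmitsLoweringFlip n m C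
  part₁ C mx ≢IS with is-or-flip mx
  ... | inj₁ is = ⊥-elim (≢IS is)
  ... | inj₂ F = Lower.lowering mx F
  part₂ : (C D : Collection n) → MaxWSCollection n m C → MaxWSCollection n m D → FlipConnected n m C D
  part₂ C D mC mD with to-IS _ C ℕ.≤-refl mC | to-IS _ D ℕ.≤-refl mD
  ... | C* , down , _ , isC | D* , _ , up , isD
    with same-star {m = m} {A = C*} (λ S → mk⇔ (from (isD S) ∘ to (isC S)) (from (isC S) ∘ to (isD S))) up
  ... | E , path , same = E , down ◅◅ path , same
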